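{- Let $\hat\alpha$ be any automorphism of $\hat{\mathcal X}$ and put $\varphi:=\varphi_0\circ\hat\alpha$. Then the map $S\mapsto\varphi(S)$ induces: (a) a bijection from the set of centric hexagons of $\hat{\mathcal X}$ with center $n_0$ onto the set of non-linear $3$-cliques of $\Gamma$; (b) a bijection from the set of centric cubes of $\hat{\mathcal X}$ with center $n_0$ onto the set of non-linear $4$-cliques of $\Gamma$; (c) a bijection from the set of centric dodecades of $\hat{\mathcal X}$ with center $n_0$ onto the set of non-linear $6$-cliques of $\Gamma$.
   Context: Let $q=2^n$, $V=V(6,q)$, and let $Q=Q^-(5,q)$ be the set of singular points of a non-degenerate quadratic form $f$ of Witt index $2$ on $V$, a generalized quadrangle of order $(q,q^2)$ whose lines are the totally singular lines; $\perp$ is the polarity defined by the bilinear form of $f$. Let $H_0$ be a hyperplane with $Q_0:=Q\cap H_0\cong Q(4,q)$ parabolic, and $n_0:=H_0^\perp$ (nucleus of $Q_0$, not on $Q$). An elliptic ovoid of $Q_0$ is $S\cap Q_0$ for a $3$-dimensional subspace $S$ of $H_0$ meeting $Q_0$ in an elliptic quadric; two distinct elliptic ovoids are tangent if they meet in exactly one point. A rosette based at $p\in Q_0$ is a set of $q$ elliptic ovoids pairwise meeting exactly in $\{p\}$. $\Gamma$: vertices the elliptic ovoids, adjacency = tangency; a clique is linear if contained in a rosette, non-linear otherwise. $\hat{\mathcal X}$ is the geometry with points $Q\setminus Q_0$ and lines $\hat l=l\setminus\{l\cap Q_0\}$ for lines $l$ of $Q$ not contained in $Q_0$; $\hat\Gamma$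 is its collinearity graph. $\varphi_0$ is the map $x\mapsto x^\perp\cap Q_0$ on points of $\hat{\mathcal X}$ (a $2$-fold covering of $\mathcal X$, the geometry of elliptic ovoids and rosettes). For $k\ge3$, a centric $2k$-configuration of $\hat{\mathcal X}$ with center $n_0$ is a set of $2k$ points $\{x_i^a: i=1,\dots,k,\ a=1,2\}$ of $Q\setminus Q_0$ such that $x_i^a$ and $x_j^b$ are adjacent in $\hat\Gamma$ iff $i\ne j$ and $a\ne b$, and for each $i$ the projective line through $x_i^1,x_i^2$ passes through $n_0$. It is called a centric hexagon, cube, decade, dodecade for $k=3,4,5,6$ respectively. -}

module Defs where

open import Algebra.Structures using (IsCommutativeRing)
open import Data.Fin.Base using (Fin)
open import Data.Nat.Base using (ℕ; _≤_)
open import Data.Product.Base using (Σ; ∃; Σ-syntax; ∃-syntax; _×_; _,_; proj₁; proj₂)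
open import Data.Vec.Base using (Vec; map; zipWith; replicate; foldr′)
open import Function.Bundles using (Inverse; Bijection; _↔_; _⇔_)
open import Level using (Level; 0ℓ; suc; _⊔_)
open import Relation.Binary.Bundles using (Setoid)
import Relation.Binary.Construct.On as On
open import Relation.Binary.PropositionalEquality.Core using (_≡_; _≢_)
open import Relation.Nullary.Negation.Core using (¬_)
open import Relation.Unary using (Pred; U; _∩_; _∖_; _⊆_; _≐_)
open import Relation.Unary.Relation.Binary.Equality using (≐-setoid)

record FiniteField (q : ℕ) : Set₁ where
  infixl 7 _*_
  infixl 6 _+_ _-_
  field
    Carrier           : Set
    _+_ _*_           : Carrier → Carrier → Carrier
    -_                : Carrier → Carrier
    0# 1#             : Carrier
    isCommutativeRing : IsCommutativeRing _≡_ _+_ _*_ -_ 0# 1#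
    0≢1               : 0# ≢ 1#
    inverse           : ∀ x → x ≢ 0# → ∃[ y ] x * y ≡ 1#
    enumeration       : Carrier ↔ Fin q

  _-_ : Carrier → Carrier → Carrier
  x - y = x + (- y)

module Sets {c ℓ : Level} (𝒮 : Setoid c ℓ) where
  open Setoid 𝒮 using (Carrier; _≈_)

  ｛_｝ : Carrier → Pred Carrier ℓ
  ｛ x ｝ y = y ≈ x

  image : {A : Set} → (A → Carrier) → Pred A 0ℓ → Pred Carrier ℓ
  image g S y = ∃[ x ] S x × y ≈ g x

  record _EnumeratedBy_ {I : Set} (S : Pred Carrier ℓ) (e : I → Carrier) : Set (c ⊔ ℓ) where
    field
      distinct   : ∀ {i j} → e i ≈ e j → i ≡ j
      exhaustive : S ≐ (λ y → ∃[ i ] y ≈ e i)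

  HasSize : ℕ → Pred Carrier ℓ → Set (c ⊔ ℓ)
  HasSize k S = Σ[ e ∈ (Fin k → Carrier) ] S EnumeratedBy e

-- The setoid of those subsets of A that satisfy 𝒫, compared by their elements.
subsetsWith : {a p : Level} {A : Set a} → Pred (Pred A 0ℓ) p → Setoid (a ⊔ suc 0ℓ ⊔ p) a
subsetsWith {A = A} 𝒫 = On.setoid {B = ∃ 𝒫} (≐-setoid A 0ℓ) proj₁

module Space {q : ℕ} (𝔽 : FiniteField q) where
  open FiniteField 𝔽

  V : Set
  V = Vec Carrier 6

  infixl 6 _+ᵥ_
  infixr 7 _*ₗ_

  _+ᵥ_ : V → V → V
  _+ᵥ_ = zipWith _+_

  _*ₗ_ : Carrier → V → V
  a *ₗ v = map (a *_) v

  0ᵥ : V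
  0ᵥ = replicate 6 0#

  combination : {d : ℕ} → Vec Carrier d → Vec V d → V
  combination as vs = foldr′ _+ᵥ_ 0ᵥ (zipWith _*ₗ_ as vs)

  -- A subspace of vector-space dimension d (projective dimension d - 1),
  -- presented by a basis.  Subspaces are only ever compared through ⟦_⟧.
  record Subspace (d : ℕ) : Set where
    field
      basis       : Vec V d
      independent : ∀ as → combination as basis ≡ 0ᵥ → as ≡ replicate d 0#

  ⟦_⟧ : {d : ℕ} → Subspace d → Pred V 0ℓ
  ⟦ W ⟧ v = ∃[ as ] v ≡ combination as (Subspace.basis W)

  _⊕_ : Pred V 0ℓ → Pred V 0ℓ → Pred V 0ℓ
  (X ⊕ Y) v = ∃[ x ] ∃[ y ] X x × Y y × v ≡ x +ᵥ y

  Point : Set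
  Point = Subspace 1

  PointSet : Set₁
  PointSet = Pred Point 0ℓ

  points : Setoid 0ℓ 0ℓ
  points = On.setoid {B = Point} (≐-setoid V 0ℓ) ⟦_⟧

  pointSets : Setoid (suc 0ℓ) 0ℓ
  pointSets = ≐-setoid Point 0ℓ

  pointsOf : Pred V 0ℓ → PointSet
  pointsOf X p = ⟦ p ⟧ ⊆ X

  polar : (V → Carrier) → V → V → Carrier
  polar f u v = f (u +ᵥ v) - f u - f v

  record QuadraticForm : Set where
    field
      form         : V → Carrier
      homogeneous  : ∀ a v → form (a *ₗ v) ≡ a * a * form v
      polar-+ˡ     : ∀ u v w → polar form (u +ᵥ v) w ≡ polar form u w + polar form v w
      polar-+ʳ     : ∀ u v w → polar form u (v +ᵥ w) ≡ polar form u v + polar form u w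
      polar-*ˡ     : ∀ a u v → polar form (a *ₗ u) v ≡ a * polar form u v
      polar-*ʳ     : ∀ a u v → polar form u (a *ₗ v) ≡ a * polar form u v

  module Form (𝑓 : QuadraticForm) where
    open QuadraticForm 𝑓 public renaming (form to f)

    β : V → V → Carrier
    β = polar f

    _^⊥ : Pred V 0ℓ → Pred V 0ℓ
    (X ^⊥) v = ∀ u → X u → β u v ≡ 0#

    TotallySingular : Pred V 0ℓ → Set
    TotallySingular X = ∀ v → X v → f v ≡ 0#

    -- Non-degeneracy of the restriction of f to X.  In characteristic 2 and odd
    -- dimension β always has a radical, so non-degeneracy of f only asks that
    -- the radical contain no non-zero singular vector.
    NonDegenerateOn : Pred V 0ℓ → Set
    NonDegenerateOn X = ∀ v → X v → (X ^⊥) v → f v ≡ 0# → v ≡ 0ᵥ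

    record WittIndexOn (X : Pred V 0ℓ) (m : ℕ) : Set where
      field
        attained : Σ[ W ∈ Subspace m ] ⟦ W ⟧ ⊆ X × TotallySingular ⟦ W ⟧
        maximal  : ∀ {d} (W : Subspace d) → ⟦ W ⟧ ⊆ X → TotallySingular ⟦ W ⟧ → d ≤ m

    -- Together with dim V = 6, this says that the quadric of f is Q⁻(5,q).
    Elliptic₅ : Set
    Elliptic₅ = NonDegenerateOn U × WittIndexOn U 2

    -- f restricts to a form defining a Q(4,q).
    Parabolic₄ : Subspace 5 → Set
    Parabolic₄ W = NonDegenerateOn ⟦ W ⟧ × WittIndexOn ⟦ W ⟧ 2

    -- f restricts to a form defining a Q⁻(3,q).
    Elliptic₃ : Subspace 4 → Set
    Elliptic₃ W = NonDegenerateOn ⟦ W ⟧ × WittIndexOn ⟦ W ⟧ 1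

    Q : PointSet
    Q p = TotallySingular ⟦ p ⟧

  module Geometry (𝑓 : QuadraticForm) (H₀ : Subspace 5) where
    open Form 𝑓

    Q₀ : PointSet
    Q₀ = Q ∩ pointsOf ⟦ H₀ ⟧

    -- A 1-space whenever f is non-degenerate on V.
    n₀ : Pred V 0ℓ
    n₀ = ⟦ H₀ ⟧ ^⊥

    record IsEllipticOvoid (O : PointSet) : Set where
      field
        S        : Subspace 4
        S⊆H₀     : ⟦ S ⟧ ⊆ ⟦ H₀ ⟧
        elliptic : Elliptic₃ S
        section  : O ≐ pointsOf ⟦ S ⟧ ∩ Q₀

    MeetExactlyIn : Point → PointSet → PointSet → Set
    MeetExactlyIn p O O′ = (O ∩ O′) ≐ Sets.｛_｝ points p

    Tangent : PointSet → PointSet → Set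
    Tangent O O′ = ¬ (O ≐ O′) × (∃[ p ] MeetExactlyIn p O O′)

    OvoidSet : Set₁
    OvoidSet = Pred PointSet 0ℓ

    record IsRosetteAt (p : Point) (R : OvoidSet) : Set₁ where
      field
        base     : Q₀ p
        ovoids   : ∀ O → R O → IsEllipticOvoid O
        size     : Sets.HasSize pointSets q R
        pairwise : ∀ O O′ → R O → R O′ → ¬ (O ≐ O′) → MeetExactlyIn p O O′

    record IsClique (k : ℕ) (C : OvoidSet) : Set₁ where
      field
        ovoids   : ∀ O → C O → IsEllipticOvoid O
        size     : Sets.HasSize pointSets k C
        adjacent : ∀ O O′ → C O → C O′ → ¬ (O ≐ O′) → Tangent O O′

    IsLinear : OvoidSet → Set₁
    IsLinear C = ∃[ p ] ∃[ R ] IsRosetteAt p R × C ⊆ R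

    IsNonLinearClique : ℕ → OvoidSet → Set₁
    IsNonLinearClique k C = IsClique k C × ¬ IsLinear C

    X̂Point : Set
    X̂Point = ∃ (Q ∖ Q₀)

    x̂points : Setoid 0ℓ 0ℓ
    x̂points = On.setoid {B = X̂Point} points proj₁

    open Setoid x̂points using () renaming (_≈_ to _≈̂_)

    record X̂Line : Set where
      field
        line     : Subspace 2
        singular : TotallySingular ⟦ line ⟧
        ⊈Q₀      : ¬ (pointsOf ⟦ line ⟧ ⊆ Q₀)

    -- This is l ∖ (l ∩ Q₀), as X̂Point already excludes the points of Q₀.
    hat : X̂Line → Pred X̂Point 0ℓ
    hat l x = pointsOf ⟦ X̂Line.line l ⟧ (proj₁ x)

    Collinear : X̂Point → X̂Point → Set
    Collinear x y = ¬ (x ≈̂ y) × (∃[ l ] hat l x × hat l y)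

    record Automorphism : Set where
      field
        permutation : Inverse x̂points x̂points
      open Inverse permutation public using (to; from)
      field
        to-line   : ∀ l → ∃[ m ] Sets.image x̂points to (hat l) ≐ hat m
        from-line : ∀ l → ∃[ m ] Sets.image x̂points from (hat l) ≐ hat m

    φ₀ : X̂Point → PointSet
    φ₀ (x , _) = pointsOf (⟦ x ⟧ ^⊥) ∩ Q₀

    -- A set of 2k points off Q₀ with center n₀; of interest for k ≥ 3.
    record IsCentricConfiguration (k : ℕ) (S : Pred X̂Point 0ℓ) : Set where
      field
        x          : Fin k × Fin 2 → X̂Point
        enumerated : Sets._EnumeratedBy_ x̂points S x
        adjacency  : ∀ i a j b → Collinear (x (i , a)) (x (j , b)) ⇔ (i ≢ j × a ≢ b)
        -- The two points of each pair are distinct, so the sum of the two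
        -- 1-spaces is the projective line joining them.
        centric    : ∀ i a b → a ≢ b →
                     n₀ ⊆ (⟦ proj₁ (x (i , a)) ⟧ ⊕ ⟦ proj₁ (x (i , b)) ⟧)

    IsCentricHexagon IsCentricCube IsCentricDodecade : Pred (Pred X̂Point 0ℓ) 0ℓ
    IsCentricHexagon  = IsCentricConfiguration 3
    IsCentricCube     = IsCentricConfiguration 4
    IsCentricDodecade = IsCentricConfiguration 6

    -- S ↦ φ(S) is a bijection from the sets satisfying 𝒞 onto those satisfying 𝒦.
    InducesBijection : {p r : Level} → (X̂Point → PointSet) →
      Pred (Pred X̂Point 0ℓ) p → Pred OvoidSet r → Set (p ⊔ r ⊔ suc 0ℓ)
    InducesBijection φ 𝒞 𝒦 =
      Σ[ b ∈ Bijection (subsetsWith 𝒞) (subsetsWith 𝒦) ]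
        (∀ S → proj₁ (Bijection.to b S) ≐ Sets.image pointSets φ (proj₁ S))

-- Let ν span n₀ with f ν = 1, so that H₀ = ν^⊥ and a point of Q ∖ Q₀ is represented by
-- the unique singular vector x on it with β x ν = 1.  The line through ν and x meets Q in
-- the second point bar x = x + ν, and φ₀ x = φ₀ y exactly when y is x or bar x.  Every elliptic
-- ovoid is φ₀ x for some x: if S^⊥ were anisotropic for an elliptic 4-space S ⊆ H₀, then V
-- would contain a totally singular 3-space.
--
-- The radical of ⟨ν, x, y⟩ is spanned by (β x y) ν + x + y, on which f takes the value
-- (β x y)² + β x y.  Hence φ₀ x and φ₀ y are tangent iff β x y is 0 or 1, that is, iff x is
-- collinear with y or with bar y.  Replacing points by their antipodes, a clique of
-- ovoids is represented by points x₀, x₁, … with β x₀ xᵢ = 1.  If β xᵢ xⱼ = 0 for some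
-- i ≠ j, then bar x₀ and all the xₗ with l ≠ 0 lie on one line and the clique is linear; otherwise all
-- β xᵢ xⱼ are 1 and the points xᵢ, bar xᵢ form a centric configuration.
--
-- Points x and y are antipodal iff they are distinct, not collinear and without common
-- neighbour, so automorphisms preserve antipodes and centric configurations.

module Submission where

open import Defs
open import Algebra.Bundles using (CommutativeRing; RawRing)
import Algebra.Properties.CommutativeMonoid.Sum as CommutativeMonoidSum
import Algebra.Properties.Monoid.Mult as MonoidMult
import Algebra.Properties.Semiring.Mult as SemiringMult
import Algebra.Solver.Ring as RingSolver
open import Algebra.Solver.Ring.AlmostCommutativeRing
  using (AlmostCommutativeRing; fromCommutativeRing; _-Raw-AlmostCommutative⟶_)
open import Data.Bool.Base using (Bool; true; false; _∧_; _xor_)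
open import Data.Empty using (⊥; ⊥-elim)
open import Data.Fin.Base as Fin using (Fin; zero; suc; punchOut)
import Data.Fin.Properties as Fin
open import Data.Fin.Permutation using (permutation)
open import Data.Maybe.Base using (Maybe; just; nothing)
open import Data.Nat.Base as ℕ using (ℕ; zero; suc; _^_; _≤_)
import Data.Nat.Properties as ℕ
open import Data.Product.Base using (∃; Σ-syntax; ∃-syntax; _×_; _,_; proj₁; proj₂)
open import Data.Sum.Base using (_⊎_; inj₁; inj₂)
open import Data.Vec.Base as Vec using (Vec; []; _∷_; head; tail; replicate; map)
import Data.Vec.Properties as Vec
open import Function.Base using (_∘_; id; _⟨_⟩_)
open import Function.Bundles using (Inverse; Equivalence; mk⇔)
open import Level using (0ℓ)
open import Relation.Binary.Bundles using (Setoid)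
open import Relation.Binary.Definitions using (DecidableEquality)
open import Relation.Binary.PropositionalEquality
  using (_≡_; _≢_; refl; sym; trans; cong; cong₂; subst; module ≡-Reasoning)
open import Relation.Nullary.Decidable as Dec using (Dec; yes; no; ¬?; _×-dec_; decidable-stable)
open import Relation.Nullary.Negation using (¬_; contradiction)
open import Relation.Unary using (Pred; Decidable; U; _∩_; _⊆_; _≐_)
open import Relation.Unary.Properties using (≐-refl; ≐-sym; ≐-trans)

-- The Artin-Schreier map `℘ s = s² + s` recurs throughout: it is the value of `f` at `x + s ν`,
-- and, for `s = β x y`, on the radical of `⟨ν, x, y⟩`. Tangency of distinct sections amounts to
-- `℘ (β x y) = 0` for this reason: if the radical is singular, Witt index 2 leaves it as the only
-- singular point of `{ν, x, y}⊥`; if it is not, every singular point there comes with another one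
-- not orthogonal to it, so one common point is never alone. The existence of `x` for a given ovoid
-- is additivity of the Arf invariant in disguise: the image of `℘` has index 2, so two anisotropic
-- planes have a sum that contains a totally singular line.
--
-- An automorphism is only a permutation that respects lines and is not assumed to come from a
-- linear map. No value of `β` can be transported along it directly; equality and collinearity have
-- to carry everything.
--
-- Finiteness makes every search over scalars and vectors decidable, which justifies the case
-- distinctions and the proofs by contradiction. Dimension arguments mostly split hyperbolic pairs
-- off a subspace with an explicit basis.

injective⇒surjective : ∀ {m} (g : Fin m → Fin m) → (∀ {i j} → g i ≡ g j → i ≡ j) →
                       ∀ y → ∃[ x ] g x ≡ y
injective⇒surjective {suc m} g inj y with Fin.any? (λ x → g x Fin.≟ y)
... | yes found = found
-- If `y` is missed, punching it out of the codomain gives an injection of `Fin (suc m)` into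
-- `Fin m`.
... | no  ∄x    = contradiction (Fin.injective⇒≤ punched-injective) ℕ.1+n≰n
  where
  y≢g : ∀ x → y ≢ g x
  y≢g x y≡gx = ∄x (x , sym y≡gx)
  punched-injective : ∀ {i j} → punchOut (y≢g i) ≡ punchOut (y≢g j) → i ≡ j
  punched-injective = inj ∘ Fin.punchOut-injective (y≢g _) (y≢g _)

-- Fields of order a power of 2: characteristic, square roots, the Artin-Schreier map.

module FieldTheory {n : ℕ} (𝔽 : FiniteField (2 ^ n)) where
  open FiniteField 𝔽 public

  commutativeRing : CommutativeRing 0ℓ 0ℓ
  commutativeRing = record { isCommutativeRing = isCommutativeRing }

  open CommutativeRing commutativeRing public
    using (+-comm; +-assoc; +-identityˡ; +-identityʳ; *-comm; *-assoc; *-identityˡ; *-identityʳ;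
           zeroˡ; zeroʳ; distribˡ; -‿inverseʳ; -‿inverseˡ)
  private
    module R = CommutativeRing commutativeRing
    module E = Inverse enumeration

  index-injective : ∀ {x y} → E.to x ≡ E.to y → x ≡ y
  index-injective {x} {y} eq =
    trans (sym (E.inverseʳ refl)) (trans (cong E.from eq) (E.inverseʳ refl))

  infix 4 _≟_
  _≟_ : DecidableEquality Carrier
  x ≟ y = Dec.map′ index-injective (cong E.to) (E.to x Fin.≟ E.to y)

  anyScalar? : {P : Pred Carrier 0ℓ} → Decidable P → Dec (∃ P)
  anyScalar? {P} P? = Dec.map′ (λ (i , p) → E.from i , p)
    (λ (x , p) → E.to x , subst P (sym (E.inverseʳ refl)) p)
    (Fin.any? (λ i → P? (E.from i)))

  scalar-injective⇒surjective : (g : Carrier → Carrier) → (∀ {x y} → g x ≡ g y → x ≡ y) →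
                                ∀ y → ∃[ x ] g x ≡ y
  scalar-injective⇒surjective g inj y
    with i , eq ← injective⇒surjective (E.to ∘ g ∘ E.from)
                    (λ {i} {j} e → trans (sym (E.inverseˡ refl))
                      (trans (cong E.to (inj (index-injective e))) (E.inverseˡ refl)))
                    (E.to y)
    = E.from i , index-injective eq

  no-zero-divisors : ∀ {x y} → x * y ≡ 0# → x ≢ 0# → y ≡ 0#
  no-zero-divisors {x} {y} xy≡0 x≢0 with x⁻¹ , xx⁻¹≡1 ← inverse x x≢0 = begin
    y              ≡⟨ *-identityˡ y ⟨
    1# * y         ≡⟨ cong (_* y) (trans (*-comm x⁻¹ x) xx⁻¹≡1) ⟨
    x⁻¹ * x * y    ≡⟨ *-assoc _ _ _ ⟩
    x⁻¹ * (x * y)  ≡⟨ cong (x⁻¹ *_) xy≡0 ⟩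
    x⁻¹ * 0#       ≡⟨ zeroʳ _ ⟩
    0#             ∎
    where open ≡-Reasoning

  private
    module S = CommutativeMonoidSum R.+-commutativeMonoid
    open MonoidMult R.+-monoid using () renaming (_×_ to _·_)

    -- Translation by 1 permutes the field, so the sum of all elements is
    -- unchanged by adding 1 to each of them.
    card·1≡0 : (2 ^ n) · 1# ≡ 0#
    card·1≡0 = begin
      (2 ^ n) · 1#                         ≡⟨ S.sum-replicate (2 ^ n) ⟨
      S.sum {2 ^ n} (λ _ → 1#)             ≡⟨ +-identityˡ _ ⟨
      0# + S.sum {2 ^ n} (λ _ → 1#)        ≡⟨ cong (_+ S.sum {2 ^ n} (λ _ → 1#)) (-‿inverseˡ (S.sum E.from)) ⟨
      - S.sum E.from + S.sum E.from + S.sum {2 ^ n} (λ _ → 1#)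
        ≡⟨ +-assoc _ _ _ ⟩
      - S.sum E.from + (S.sum E.from + S.sum {2 ^ n} (λ _ → 1#))
        ≡⟨ cong (- S.sum E.from +_) (S.∑-distrib-+ E.from (λ _ → 1#)) ⟨
      - S.sum E.from + S.sum (λ i → E.from i + 1#)
        ≡⟨ cong (- S.sum E.from +_) (S.sum-cong-≗ {2 ^ n} (λ i → E.inverseʳ {E.from i + 1#} refl)) ⟨
      - S.sum E.from + S.sum (λ i → E.from (E.to (E.from i + 1#)))
        ≡⟨ cong (- S.sum E.from +_) (S.sum-permute E.from translation) ⟨
      - S.sum E.from + S.sum E.from        ≡⟨ -‿inverseˡ _ ⟩
      0#                                   ∎
      where
      open ≡-Reasoning
      shift unshift : Fin (2 ^ n) → Fin (2 ^ n)
      shift i   = E.to (E.from i + 1#)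
      unshift i = E.to (E.from i + - 1#)
      cancel : ∀ {a b} → a + b ≡ 0# → ∀ i → E.to (E.from (E.to (E.from i + a)) + b) ≡ i
      cancel {a} {b} a+b≡0 i = begin
        E.to (E.from (E.to (E.from i + a)) + b)  ≡⟨ cong (λ x → E.to (x + b)) (E.inverseʳ refl) ⟩
        E.to (E.from i + a + b)                  ≡⟨ cong E.to (+-assoc _ _ _) ⟩
        E.to (E.from i + (a + b))                ≡⟨ cong (λ x → E.to (E.from i + x)) a+b≡0 ⟩
        E.to (E.from i + 0#)                     ≡⟨ cong E.to (+-identityʳ _) ⟩
        E.to (E.from i)                          ≡⟨ E.inverseˡ refl ⟩
        i                                        ∎
      translation = permutation shift unshift
        (cancel (-‿inverseˡ 1#)) (cancel (-‿inverseʳ 1#))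

    -- Twice a power of 2 factors in the field as `2 · 1` times that power, so without zero divisors
    -- the factors 2 can be peeled off one at a time until one of them vanishes. The exponent 0 is
    -- excluded by `0≢1`.
    2^k·1≡0 : ∀ k → (2 ^ k) · 1# ≡ 0# → 1# + 1# ≡ 0#
    2^k·1≡0 zero    eq = contradiction (sym (trans (sym (+-identityʳ 1#)) eq)) 0≢1
    2^k·1≡0 (suc k) eq with 2 · 1# ≟ 0#
    ... | yes two≡0 = trans (cong (1# +_) (sym (+-identityʳ 1#))) two≡0
    ... | no  two≢0 = 2^k·1≡0 k (no-zero-divisors
      (trans (sym (SemiringMult.×1-homo-* R.semiring 2 (2 ^ k))) eq) two≢0)

  1+1≡0 : 1# + 1# ≡ 0#
  1+1≡0 = 2^k·1≡0 n card·1≡0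

  x+x≡0 : ∀ x → x + x ≡ 0#
  x+x≡0 x = begin
    x + x            ≡⟨ cong₂ _+_ (*-identityʳ x) (*-identityʳ x) ⟨
    x * 1# + x * 1#  ≡⟨ distribˡ x 1# 1# ⟨
    x * (1# + 1#)    ≡⟨ cong (x *_) 1+1≡0 ⟩
    x * 0#           ≡⟨ zeroʳ x ⟩
    0#               ∎
    where open ≡-Reasoning

  x+y≡0⇒x≡y : ∀ {x y} → x + y ≡ 0# → x ≡ y
  x+y≡0⇒x≡y {x} {y} eq = begin
    x            ≡⟨ +-identityʳ x ⟨
    x + 0#       ≡⟨ cong (x +_) (x+x≡0 y) ⟨
    x + (y + y)  ≡⟨ +-assoc x y y ⟨
    x + y + y    ≡⟨ cong (_+ y) eq ⟩
    0# + y       ≡⟨ +-identityˡ y ⟩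
    y            ∎
    where open ≡-Reasoning

  -x≡x : ∀ x → - x ≡ x
  -x≡x x = x+y≡0⇒x≡y (-‿inverseˡ x)

  private
    -- With coefficients modulo 2 the ring solver cancels equal terms and treats subtraction as
    -- addition, so it proves the identities of characteristic 2 directly.
    𝔽₂ : RawRing 0ℓ 0ℓ
    𝔽₂ = record { Carrier = Bool ; _≈_ = _≡_ ; _+_ = _xor_ ; _*_ = _∧_ ; -_ = id
                ; 0# = false ; 1# = true }

    ring : AlmostCommutativeRing 0ℓ 0ℓ
    ring = fromCommutativeRing commutativeRing

    ⟦_⟧₂ : Bool → Carrier
    ⟦ false ⟧₂ = 0#
    ⟦ true  ⟧₂ = 1#

    morphism : 𝔽₂ -Raw-AlmostCommutative⟶ ring
    morphism = record
      { ⟦_⟧    = ⟦_⟧₂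
      ; +-homo = λ { false y     → sym (+-identityˡ _)
                   ; true  false → sym (+-identityʳ _)
                   ; true  true  → sym 1+1≡0 }
      ; *-homo = λ { false y → sym (zeroˡ _) ; true y → sym (*-identityˡ _) }
      ; -‿homo = λ x → sym (-x≡x _)
      ; 0-homo = refl
      ; 1-homo = refl
      }

    coeff≟ : (a b : Bool) → Maybe (⟦ a ⟧₂ ≡ ⟦ b ⟧₂)
    coeff≟ false false = just refl
    coeff≟ true  true  = just refl
    coeff≟ _     _     = nothing

  open RingSolver 𝔽₂ ring morphism coeff≟ public
    using (solve; Polynomial; con; _:=_; _:+_; _:*_; _:-_)

  :0 :1 : ∀ {k} → Polynomial k
  :0 = con false
  :1 = con true

  square-injective : ∀ {x y} → x * x ≡ y * y → x ≡ y
  square-injective {x} {y} eq with x + y ≟ 0#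
  ... | yes x+y≡0 = x+y≡0⇒x≡y x+y≡0
  ... | no  x+y≢0 = x+y≡0⇒x≡y (no-zero-divisors (begin
    (x + y) * (x + y)  ≡⟨ solve 2 (λ x y → (x :+ y) :* (x :+ y) := x :* x :+ y :* y) refl x y ⟩
    x * x + y * y      ≡⟨ cong (_+ y * y) eq ⟩
    y * y + y * y      ≡⟨ x+x≡0 _ ⟩
    0#                 ∎) x+y≢0)
    where open ≡-Reasoning

  -- Squaring is additive in characteristic 2 and has trivial kernel; an injective self-map of a
  -- finite set is onto.
  sqrt : ∀ a → ∃[ r ] r * r ≡ a
  sqrt = scalar-injective⇒surjective (λ x → x * x) square-injective

  -- The Artin-Schreier map: `X² + X + c` has a root in the field exactly when `c` is one of its
  -- values.
  ℘ : Carrier → Carrier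
  ℘ s = s * s + s

  ℘-roots : ∀ {c} → ℘ c ≡ 0# → c ≡ 0# ⊎ c ≡ 1#
  ℘-roots {c} eq with c ≟ 0#
  ... | yes c≡0 = inj₁ c≡0
  ... | no  c≢0 = inj₂ (x+y≡0⇒x≡y (no-zero-divisors
    (trans (solve 1 (λ c → c :* (c :+ :1) := c :* c :+ c) refl c) eq) c≢0))

  ℘-+ : ∀ s t → ℘ (s + t) ≡ ℘ s + ℘ t
  ℘-+ = solve 2 (λ s t → (s :+ t) :* (s :+ t) :+ (s :+ t) := s :* s :+ s :+ (t :* t :+ t)) refl

  ℘-fibre : ∀ {s t} → ℘ s ≡ ℘ t → s ≡ t ⊎ s ≡ t + 1#
  ℘-fibre {s} {t} eq with ℘-roots (trans (℘-+ s t) (trans (cong (_+ ℘ t) eq) (x+x≡0 _)))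
  ... | inj₁ s+t≡0 = inj₁ (x+y≡0⇒x≡y s+t≡0)
  ... | inj₂ s+t≡1 = inj₂ (trans (solve 2 (λ s t → s := t :+ (s :+ t)) refl s t)
                                 (cong (t +_) s+t≡1))

  -- ℘ is additive with kernel {0,1}, so its image has index 2 in the field.  To see
  -- this without counting, for a outside the image send one element of each fibre
  -- {s, s + 1} to ℘ s and the other one to ℘ s + a: this map is injective, hence onto.
  ℘-index-two : ∀ {a b} → ¬ (∃[ s ] ℘ s ≡ a) → ¬ (∃[ s ] ℘ s ≡ b) → ∃[ s ] ℘ s ≡ a + b
  ℘-index-two {a} {b} a∉ b∉ = conclude (scalar-injective⇒surjective h h-injective b)
    where
    -- The order of the enumeration makes the choice in each fibre: the element with the smaller
    -- index is the one sent to `℘ s`.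
    lower? : ∀ s → Dec (E.to s Fin.< E.to (s + 1#))
    lower? s = E.to s Fin.<? E.to (s + 1#)

    s+1+1≡s : ∀ s → s + 1# + 1# ≡ s
    s+1+1≡s = solve 1 (λ s → s :+ :1 :+ :1 := s) refl

    s+1≢s : ∀ s → s + 1# ≢ s
    s+1≢s s eq = 0≢1 (sym (trans (solve 1 (λ s → :1 := s :+ (s :+ :1)) refl s)
                               (trans (cong (s +_) eq) (x+x≡0 s))))

    select : ∀ s → Dec (E.to s Fin.< E.to (s + 1#)) → Carrier
    select s (yes _) = ℘ s
    select s (no _)  = ℘ s + a

    h : Carrier → Carrier
    h s = select s (lower? s)

    mixed : ∀ s t → ℘ s ≢ ℘ t + a
    mixed s t eq = a∉ (s + t , trans (℘-+ s t) (trans (cong (_+ ℘ t) eq)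
      (solve 2 (λ u a → u :+ a :+ u := a) refl (℘ t) a)))

    same : ∀ {s t} (ds : Dec (E.to s Fin.< E.to (s + 1#))) (dt : Dec (E.to t Fin.< E.to (t + 1#))) →
           select s ds ≡ select t dt → s ≡ t
    same {s} {t} (yes s<) (yes t<) eq with ℘-fibre eq
    ... | inj₁ s≡t   = s≡t
    ... | inj₂ refl = contradiction t<
      (Fin.<-asym (subst (λ u → E.to (t + 1#) Fin.< E.to u) (s+1+1≡s t) s<))
    same {s} {t} (yes _) (no _) eq = contradiction eq (mixed s t)
    same {s} {t} (no _) (yes _) eq = contradiction (sym eq) (mixed t s)
    same {s} {t} (no s≮) (no t≮) eq
      with ℘-fibre (trans (solve 2 (λ u a → u := u :+ a :+ a) refl (℘ s) a)
             (trans (cong (_+ a) eq) (solve 2 (λ u a → u :+ a :+ a := u) refl (℘ t) a)))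
    ... | inj₁ s≡t   = s≡t
    ... | inj₂ refl = contradiction
      (Fin.≤∧≢⇒< (ℕ.≮⇒≥ s≮′) (λ e → s+1≢s t (sym (index-injective e)))) t≮
      where
      s≮′ : ¬ (E.to (t + 1#) Fin.< E.to t)
      s≮′ = subst (λ u → ¬ (E.to (t + 1#) Fin.< E.to u)) (s+1+1≡s t) s≮

    h-injective : ∀ {s t} → h s ≡ h t → s ≡ t
    h-injective {s} {t} = same (lower? s) (lower? t)

    conclude : ∃[ s ] h s ≡ b → ∃[ s ] ℘ s ≡ a + b
    conclude (s , eq) with lower? s
    ... | yes _ = contradiction (s , eq) b∉
    ... | no  _ = s , trans (solve 2 (λ u a → u := a :+ (u :+ a)) refl (℘ s) a) (cong (a +_) eq)

-- Linear algebra in V(6,q): bases, spans, kernels of functionals.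

module LinearAlgebra {n : ℕ} (𝔽 : FiniteField (2 ^ n)) where
  open FieldTheory {n} 𝔽 public
  open Space 𝔽 public

  infixl 6 _⊞_
  infixr 7 _⊡_
  -- One syntax of linear combinations with several readings: as a vector, as a scalar in each
  -- coordinate, and later as the expansion of `β` or `f` on the combination. Each reading reduces a
  -- vector identity to a scalar one that the ring solver handles.
  data Expr (m : ℕ) : Set where
    var : Fin m → Expr m
    𝟘   : Expr m
    _⊞_ : Expr m → Expr m → Expr m
    _⊡_ : Carrier → Expr m → Expr m

  pattern #0 = var zero
  pattern #1 = var (suc zero)
  pattern #2 = var (suc (suc zero))

  vectorValue : ∀ {m} → Expr m → Vec V m → V
  vectorValue (var i) ρ  = Vec.lookup ρ i
  vectorValue 𝟘 ρ        = 0ᵥ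
  vectorValue (e ⊞ e′) ρ = vectorValue e ρ +ᵥ vectorValue e′ ρ
  vectorValue (c ⊡ e) ρ  = c *ₗ vectorValue e ρ

  scalarValue : ∀ {m} → Expr m → Vec Carrier m → Carrier
  scalarValue (var i) σ  = Vec.lookup σ i
  scalarValue 𝟘 σ        = 0#
  scalarValue (e ⊞ e′) σ = scalarValue e σ + scalarValue e′ σ
  scalarValue (c ⊡ e) σ  = c * scalarValue e σ

  private
    lookup-vectorValue : ∀ {m} (e : Expr m) (ρ : Vec V m) k →
      Vec.lookup (vectorValue e ρ) k ≡ scalarValue e (map (λ v → Vec.lookup v k) ρ)
    lookup-vectorValue (var i) ρ k  = sym (Vec.lookup-map i (λ v → Vec.lookup v k) ρ)
    lookup-vectorValue 𝟘 ρ k        = Vec.lookup-replicate k 0#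
    lookup-vectorValue (e ⊞ e′) ρ k = trans (Vec.lookup-zipWith _+_ k (vectorValue e ρ) (vectorValue e′ ρ))
      (cong₂ _+_ (lookup-vectorValue e ρ k) (lookup-vectorValue e′ ρ k))
    lookup-vectorValue (c ⊡ e) ρ k  = trans (Vec.lookup-map k (c *_) (vectorValue e ρ))
      (cong (c *_) (lookup-vectorValue e ρ k))

    lookup-ext : ∀ {m} {u v : Vec Carrier m} → (∀ k → Vec.lookup u k ≡ Vec.lookup v k) → u ≡ v
    lookup-ext {u = []}    {[]}    _  = refl
    lookup-ext {u = _ ∷ _} {_ ∷ _} eq = cong₂ _∷_ (eq zero) (lookup-ext (eq ∘ suc))

  by-coordinates : ∀ {m} (ρ : Vec V m) (e e′ : Expr m) →
    (∀ σ → scalarValue e σ ≡ scalarValue e′ σ) → vectorValue e ρ ≡ vectorValue e′ ρ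
  by-coordinates ρ e e′ eq = lookup-ext λ k →
    trans (lookup-vectorValue e ρ k) (trans (eq _) (sym (lookup-vectorValue e′ ρ k)))

  +ᵥ-comm : ∀ u v → u +ᵥ v ≡ v +ᵥ u
  +ᵥ-comm u v = by-coordinates (u ∷ v ∷ []) (#0 ⊞ #1) (#1 ⊞ #0) λ { (x ∷ y ∷ []) → +-comm x y }

  +ᵥ-identityˡ : ∀ v → 0ᵥ +ᵥ v ≡ v
  +ᵥ-identityˡ v = by-coordinates (v ∷ []) (𝟘 ⊞ #0) #0 λ { (x ∷ []) → +-identityˡ x }

  +ᵥ-identityʳ : ∀ v → v +ᵥ 0ᵥ ≡ v
  +ᵥ-identityʳ v = by-coordinates (v ∷ []) (#0 ⊞ 𝟘) #0 λ { (x ∷ []) → +-identityʳ x }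

  v+v≡0 : ∀ v → v +ᵥ v ≡ 0ᵥ
  v+v≡0 v = by-coordinates (v ∷ []) (#0 ⊞ #0) 𝟘 λ { (x ∷ []) → x+x≡0 x }

  +ᵥ-cancelʳ : ∀ u v → u +ᵥ v +ᵥ v ≡ u
  +ᵥ-cancelʳ u v = by-coordinates (u ∷ v ∷ []) (#0 ⊞ #1 ⊞ #1) #0
    λ { (x ∷ y ∷ []) → solve 2 (λ x y → x :+ y :+ y := x) refl x y }

  u+v≡0⇒u≡v : ∀ {u v} → u +ᵥ v ≡ 0ᵥ → u ≡ v
  u+v≡0⇒u≡v {u} {v} eq = trans (sym (+ᵥ-cancelʳ u v)) (trans (cong (_+ᵥ v) eq) (+ᵥ-identityˡ v))

  *ₗ-identity : ∀ v → 1# *ₗ v ≡ v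
  *ₗ-identity v = by-coordinates (v ∷ []) (1# ⊡ #0) #0 λ { (x ∷ []) → *-identityˡ x }

  *ₗ-zeroˡ : ∀ v → 0# *ₗ v ≡ 0ᵥ
  *ₗ-zeroˡ v = by-coordinates (v ∷ []) (0# ⊡ #0) 𝟘 λ { (x ∷ []) → zeroˡ x }

  *ₗ-zeroʳ : ∀ a → a *ₗ 0ᵥ ≡ 0ᵥ
  *ₗ-zeroʳ a = by-coordinates [] (a ⊡ 𝟘) 𝟘 λ _ → zeroʳ a

  *ₗ-assoc : ∀ a b v → a *ₗ b *ₗ v ≡ (a * b) *ₗ v
  *ₗ-assoc a b v = by-coordinates (v ∷ []) (a ⊡ b ⊡ #0) ((a * b) ⊡ #0)
    λ { (x ∷ []) → sym (*-assoc a b x) }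

  *ₗ-cancel : ∀ {a} u → a ≢ 0# → a *ₗ u ≡ 0ᵥ → u ≡ 0ᵥ
  *ₗ-cancel {a} u a≢0 au≡0 with b , ab≡1 ← inverse a a≢0 = begin
    u               ≡⟨ *ₗ-identity u ⟨
    1# *ₗ u         ≡⟨ cong (_*ₗ u) (trans (*-comm b a) ab≡1) ⟨
    (b * a) *ₗ u    ≡⟨ *ₗ-assoc b a u ⟨
    b *ₗ a *ₗ u     ≡⟨ cong (b *ₗ_) au≡0 ⟩
    b *ₗ 0ᵥ         ≡⟨ *ₗ-zeroʳ b ⟩
    0ᵥ              ∎
    where open ≡-Reasoning

  infix 4 _≟ᵥ_
  _≟ᵥ_ : DecidableEquality V
  _≟ᵥ_ = Vec.≡-dec _≟_

  abstract
    -- Exhaustive search, one coordinate at a time. It decides membership in a subspace and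
    -- existence of vectors with a decidable property, so non-existence can be refuted by
    -- `decidable-stable`.
    anyVec? : ∀ {m} {P : Pred (Vec Carrier m) 0ℓ} → Decidable P → Dec (∃ P)
    anyVec? {zero}  P? = Dec.map′ (λ p → [] , p) (λ { ([] , p) → p }) (P? [])
    anyVec? {suc m} P? = Dec.map′ (λ { (a , as , p) → a ∷ as , p }) (λ { (a ∷ as , p) → a , as , p })
      (anyScalar? λ a → anyVec? λ as → P? (a ∷ as))

  span : ∀ {d} → Vec V d → Pred V 0ℓ
  span vs v = ∃[ as ] v ≡ combination as vs

  Independent : ∀ {d} → Vec V d → Set
  Independent {d} vs = ∀ as → combination as vs ≡ 0ᵥ → as ≡ replicate d 0#

  infix 4 _∈?_
  _∈?_ : ∀ {d} v (W : Subspace d) → Dec (⟦ W ⟧ v)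
  v ∈? W = anyVec? λ as → v ≟ᵥ combination as (Subspace.basis W)

  combination-0 : ∀ {d} (vs : Vec V d) → combination (replicate d 0#) vs ≡ 0ᵥ
  combination-0 []       = refl
  combination-0 (v ∷ vs) =
    trans (cong₂ _+ᵥ_ (*ₗ-zeroˡ v) (combination-0 vs)) (+ᵥ-identityˡ 0ᵥ)

  combination-+ : ∀ {d} as bs (vs : Vec V d) →
    combination (Vec.zipWith _+_ as bs) vs ≡ combination as vs +ᵥ combination bs vs
  combination-+ [] [] [] = sym (+ᵥ-identityˡ 0ᵥ)
  combination-+ (a ∷ as) (b ∷ bs) (v ∷ vs) =
    trans (cong ((a + b) *ₗ v +ᵥ_) (combination-+ as bs vs))
      (by-coordinates (v ∷ combination as vs ∷ combination bs vs ∷ [])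
        ((a + b) ⊡ #0 ⊞ (#1 ⊞ #2)) (a ⊡ #0 ⊞ #1 ⊞ (b ⊡ #0 ⊞ #2))
        λ { (x ∷ y ∷ z ∷ []) → solve 5 (λ a b x y z →
              (a :+ b) :* x :+ (y :+ z) := a :* x :+ y :+ (b :* x :+ z)) refl a b x y z })

  combination-* : ∀ {d} c as (vs : Vec V d) → combination (map (c *_) as) vs ≡ c *ₗ combination as vs
  combination-* c [] []             = sym (*ₗ-zeroʳ c)
  combination-* c (a ∷ as) (v ∷ vs) =
    trans (cong ((c * a) *ₗ v +ᵥ_) (combination-* c as vs))
      (by-coordinates (v ∷ combination as vs ∷ []) ((c * a) ⊡ #0 ⊞ c ⊡ #1) (c ⊡ (a ⊡ #0 ⊞ #1))
        λ { (x ∷ y ∷ []) → solve 4 (λ a c x y → (c :* a) :* x :+ c :* y := c :* (a :* x :+ y)) refl a c x y })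

  module _ {d} (vs : Vec V d) where
    span-+ : ∀ {u v} → span vs u → span vs v → span vs (u +ᵥ v)
    span-+ (as , eq) (bs , eq′) =
      Vec.zipWith _+_ as bs , trans (cong₂ _+ᵥ_ eq eq′) (sym (combination-+ as bs vs))

    span-* : ∀ c {u} → span vs u → span vs (c *ₗ u)
    span-* c (as , eq) = map (c *_) as , trans (cong (c *ₗ_) eq) (sym (combination-* c as vs))

    span-0 : span vs 0ᵥ
    span-0 = replicate d 0# , sym (combination-0 vs)

  module _ {d} (W : Subspace d) where
    private vs = Subspace.basis W
    +-closed : ∀ {u v} → ⟦ W ⟧ u → ⟦ W ⟧ v → ⟦ W ⟧ (u +ᵥ v)
    +-closed = span-+ vs

    *-closed : ∀ c {u} → ⟦ W ⟧ u → ⟦ W ⟧ (c *ₗ u)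
    *-closed = span-* vs

    0-closed : ⟦ W ⟧ 0ᵥ
    0-closed = span-0 vs

  standardBasis : Vec V 6
  standardBasis =
    (1# ∷ 0# ∷ 0# ∷ 0# ∷ 0# ∷ 0# ∷ []) ∷
    (0# ∷ 1# ∷ 0# ∷ 0# ∷ 0# ∷ 0# ∷ []) ∷
    (0# ∷ 0# ∷ 1# ∷ 0# ∷ 0# ∷ 0# ∷ []) ∷
    (0# ∷ 0# ∷ 0# ∷ 1# ∷ 0# ∷ 0# ∷ []) ∷
    (0# ∷ 0# ∷ 0# ∷ 0# ∷ 1# ∷ 0# ∷ []) ∷
    (0# ∷ 0# ∷ 0# ∷ 0# ∷ 0# ∷ 1# ∷ []) ∷ []

  combination-standardBasis : ∀ v → combination v standardBasis ≡ v
  combination-standardBasis (a ∷ b ∷ c ∷ d ∷ e ∷ f ∷ []) =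
    cong₂ _∷_ (solve 6 (λ a b c d e f →
      a :* :1 :+ (b :* :0 :+ (c :* :0 :+ (d :* :0 :+ (e :* :0 :+ (f :* :0 :+ :0))))) := a)
      refl a b c d e f) (
    cong₂ _∷_ (solve 6 (λ a b c d e f →
      a :* :0 :+ (b :* :1 :+ (c :* :0 :+ (d :* :0 :+ (e :* :0 :+ (f :* :0 :+ :0))))) := b)
      refl a b c d e f) (
    cong₂ _∷_ (solve 6 (λ a b c d e f →
      a :* :0 :+ (b :* :0 :+ (c :* :1 :+ (d :* :0 :+ (e :* :0 :+ (f :* :0 :+ :0))))) := c)
      refl a b c d e f) (
    cong₂ _∷_ (solve 6 (λ a b c d e f →
      a :* :0 :+ (b :* :0 :+ (c :* :0 :+ (d :* :1 :+ (e :* :0 :+ (f :* :0 :+ :0))))) := d)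
      refl a b c d e f) (
    cong₂ _∷_ (solve 6 (λ a b c d e f →
      a :* :0 :+ (b :* :0 :+ (c :* :0 :+ (d :* :0 :+ (e :* :1 :+ (f :* :0 :+ :0))))) := e)
      refl a b c d e f) (
    cong₂ _∷_ (solve 6 (λ a b c d e f →
      a :* :0 :+ (b :* :0 :+ (c :* :0 :+ (d :* :0 :+ (e :* :0 :+ (f :* :1 :+ :0))))) := f)
      refl a b c d e f) (
    refl))))))

  full : Subspace 6
  full = record
    { basis = standardBasis
    ; independent = λ as eq → trans (sym (combination-standardBasis as)) eq
    }

  ∈full : ∀ v → ⟦ full ⟧ v
  ∈full v = v , sym (combination-standardBasis v)

  trivial : Subspace 0
  trivial = record { basis = [] ; independent = λ { [] _ → refl } }

  extend : ∀ {d} (W : Subspace d) x → ¬ ⟦ W ⟧ x → Subspace (suc d)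
  extend W x x∉W = record { basis = x ∷ Subspace.basis W ; independent = indep }
    where
    indep : ∀ as → combination as (x ∷ Subspace.basis W) ≡ 0ᵥ → as ≡ replicate _ 0#
    indep (a ∷ as) eq with a ≟ 0#
    ... | yes refl = cong (0# ∷_) (Subspace.independent W as
      (trans (sym (trans (cong (_+ᵥ combination as _) (*ₗ-zeroˡ x)) (+ᵥ-identityˡ _))) eq))
    ... | no a≢0 with b , ab≡1 ← inverse a a≢0 = contradiction
      (subst ⟦ W ⟧ (begin
        b *ₗ combination as (Subspace.basis W)  ≡⟨ cong (b *ₗ_) (u+v≡0⇒u≡v eq) ⟨
        b *ₗ a *ₗ x                             ≡⟨ *ₗ-assoc b a x ⟩
        (b * a) *ₗ x                            ≡⟨ cong (_*ₗ x) (trans (*-comm b a) ab≡1) ⟩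
        1# *ₗ x                                 ≡⟨ *ₗ-identity x ⟩
        x                                       ∎)
        (*-closed W b (as , refl))) x∉W
      where open ≡-Reasoning

  Independent-tail : ∀ {d} v (vs : Vec V d) → Independent (v ∷ vs) → Independent vs
  Independent-tail v vs indep as eq = cong tail (indep (0# ∷ as)
    (trans (cong₂ _+ᵥ_ (*ₗ-zeroˡ v) eq) (+ᵥ-identityˡ 0ᵥ)))

  module Functional (ℓ : V → Carrier) (ℓ-+ : ∀ u v → ℓ (u +ᵥ v) ≡ ℓ u + ℓ v)
                    (ℓ-* : ∀ a v → ℓ (a *ₗ v) ≡ a * ℓ v) where
    ℓ-0 : ℓ 0ᵥ ≡ 0#
    ℓ-0 = trans (cong ℓ (sym (*ₗ-zeroˡ 0ᵥ))) (trans (ℓ-* 0# 0ᵥ) (zeroˡ _))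

    Hyperplane : ∀ {d} → Vec V (suc d) → Vec V d → Set
    Hyperplane vs us = (∀ {v} → span us v → span vs v × ℓ v ≡ 0#) × (∀ {v} → span vs v → ℓ v ≡ 0# → span us v)

    private
      module Pivot {d} v (vs : Vec V d) (c : Carrier) (pivot : ℓ v * c ≡ 1#)
                   (indep : Independent (v ∷ vs)) where
        us : Vec V d
        -- Since `c` is the inverse of `ℓ v`, the multiple of `v` cancels `ℓ w`, and every swept
        -- vector lies in the kernel.
        us = map (λ w → w +ᵥ (ℓ w * c) *ₗ v) vs

        swept : ∀ {d} as (vs : Vec V d) →
          combination as (map (λ w → w +ᵥ (ℓ w * c) *ₗ v) vs) ≡
          (ℓ (combination as vs) * c) *ₗ v +ᵥ combination as vs
        swept [] [] = sym (trans (+ᵥ-identityʳ _) (trans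
          (cong (λ t → (t * c) *ₗ v) ℓ-0) (trans (cong (_*ₗ v) (zeroˡ c)) (*ₗ-zeroˡ v))))
        swept (a ∷ as) (w ∷ ws) = begin
          a *ₗ (w +ᵥ (ℓ w * c) *ₗ v) +ᵥ combination as (map _ ws)
            ≡⟨ cong (a *ₗ (w +ᵥ (ℓ w * c) *ₗ v) +ᵥ_) (swept as ws) ⟩
          a *ₗ (w +ᵥ (ℓ w * c) *ₗ v) +ᵥ ((ℓ y * c) *ₗ v +ᵥ y)
            ≡⟨ by-coordinates (w ∷ v ∷ y ∷ []) (a ⊡ (#0 ⊞ (ℓ w * c) ⊡ #1) ⊞ ((ℓ y * c) ⊡ #1 ⊞ #2))
                 (((a * ℓ w + ℓ y) * c) ⊡ #1 ⊞ (a ⊡ #0 ⊞ #2))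
                 (λ { (w′ ∷ v′ ∷ y′ ∷ []) → solve 7 (λ a c lw ly w v y →
                        a :* (w :+ (lw :* c) :* v) :+ ((ly :* c) :* v :+ y) :=
                        ((a :* lw :+ ly) :* c) :* v :+ (a :* w :+ y)) refl a c (ℓ w) (ℓ y) w′ v′ y′ }) ⟩
          ((a * ℓ w + ℓ y) * c) *ₗ v +ᵥ (a *ₗ w +ᵥ y)
            ≡⟨ cong (λ t → (t * c) *ₗ v +ᵥ (a *ₗ w +ᵥ y)) (trans (ℓ-+ _ _) (cong (_+ ℓ y) (ℓ-* a w))) ⟨
          (ℓ (a *ₗ w +ᵥ y) * c) *ₗ v +ᵥ (a *ₗ w +ᵥ y) ∎
          where
          open ≡-Reasoning
          y = combination as ws

        us-independent : Independent us
        us-independent as eq = cong tail (indep (ℓ (combination as vs) * c ∷ as)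
          (trans (sym (swept as vs)) eq))

        hyperplane : Hyperplane (v ∷ vs) us
        hyperplane = into , from
          where
          into : ∀ {w} → span us w → span (v ∷ vs) w × ℓ w ≡ 0#
          into {w} (as , eq) = (ℓ y * c ∷ as , trans eq (swept as vs)) , (begin
            ℓ w                          ≡⟨ cong ℓ (trans eq (swept as vs)) ⟩
            ℓ ((ℓ y * c) *ₗ v +ᵥ y)      ≡⟨ trans (ℓ-+ _ _) (cong (_+ ℓ y) (ℓ-* _ v)) ⟩
            ℓ y * c * ℓ v + ℓ y          ≡⟨ solve 3 (λ y c v → y :* c :* v :+ y := y :* (v :* c) :+ y) refl (ℓ y) c (ℓ v) ⟩
            ℓ y * (ℓ v * c) + ℓ y        ≡⟨ cong (λ t → ℓ y * t + ℓ y) pivot ⟩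
            ℓ y * 1# + ℓ y               ≡⟨ solve 1 (λ y → y :* :1 :+ y := :0) refl (ℓ y) ⟩
            0#                           ∎)
            where
            open ≡-Reasoning
            y = combination as vs
          from : ∀ {w} → span (v ∷ vs) w → ℓ w ≡ 0# → span us w
          from {w} (a ∷ as , eq) ℓw≡0 = as , trans eq (trans (cong (λ t → t *ₗ v +ᵥ y) (begin
            a               ≡⟨ *-identityʳ a ⟨
            a * 1#          ≡⟨ cong (a *_) pivot ⟨
            a * (ℓ v * c)   ≡⟨ *-assoc _ _ _ ⟨
            a * ℓ v * c     ≡⟨ cong (_* c) (x+y≡0⇒x≡y (trans (sym
                                 (trans (cong ℓ eq) (trans (ℓ-+ _ _) (cong (_+ ℓ y) (ℓ-* a v))))) ℓw≡0)) ⟩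
            ℓ y * c         ∎)) (sym (swept as vs)))
            where
            open ≡-Reasoning
            y = combination as vs

    ℓ-absorb : ∀ {v} → ℓ v ≡ 0# → ∀ a y → ℓ (a *ₗ v +ᵥ y) ≡ ℓ y
    ℓ-absorb ℓv≡0 a y = trans (ℓ-+ _ _) (trans (cong (_+ ℓ y)
      (trans (ℓ-* a _) (trans (cong (a *_) ℓv≡0) (zeroʳ a)))) (+-identityˡ _))

    -- Gaussian elimination for one equation. A first basis vector with `ℓ v ≢ 0#` serves as pivot
    -- and is swept out of the others; one with `ℓ v ≡ 0#` is kept, and the search goes on in the
    -- tail, where `ℓ` is still not identically zero.
    hyperplane : ∀ {d} (vs : Vec V (suc d)) → Independent vs → (∃[ w ] span vs w × ℓ w ≢ 0#) →
                 Σ[ us ∈ Vec V d ] Independent us × Hyperplane vs us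
    hyperplane (v ∷ vs) indep (w , w∈ , ℓw≢0) with ℓ v ≟ 0#
    hyperplane (v ∷ vs) indep _ | no ℓv≢0 with c , pivot ← inverse (ℓ v) ℓv≢0 =
      us , us-independent , hyperplane′
      where open Pivot v vs c pivot indep renaming (hyperplane to hyperplane′)
    hyperplane (v ∷ []) indep (w , (a ∷ [] , eq) , ℓw≢0) | yes ℓv≡0 = contradiction
      (trans (cong ℓ eq) (trans (ℓ-+ _ _) (trans (cong₂ _+_ (ℓ-* a v) ℓ-0)
        (trans (+-identityʳ _) (trans (cong (a *_) ℓv≡0) (zeroʳ a)))))) ℓw≢0
    hyperplane (v ∷ vs@(_ ∷ _)) indep (w , (a ∷ as , eq) , ℓw≢0) | yes ℓv≡0
      with us , us-indep , into , from ←
        hyperplane vs (Independent-tail v vs indep)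
          (combination as vs , (as , refl) , λ ℓy≡0 → ℓw≢0 (trans (cong ℓ eq) (trans (ℓ-absorb ℓv≡0 a _) ℓy≡0)))
      = v ∷ us , indep′ , into′ , from′
      where
      indep′ : Independent (v ∷ us)
      indep′ (b ∷ bs) eq with (cs , eq′) , _ ← into (bs , refl) = cong₂ _∷_ (cong head b∷cs≡0)
        (us-indep bs (trans eq′ (trans (cong (λ as → combination as vs) (cong tail b∷cs≡0)) (combination-0 vs))))
        where
        b∷cs≡0 : b ∷ cs ≡ replicate _ 0#
        b∷cs≡0 = indep (b ∷ cs) (trans (cong (b *ₗ v +ᵥ_) (sym eq′)) eq)
      into′ : ∀ {x} → span (v ∷ us) x → span (v ∷ vs) x × ℓ x ≡ 0#
      into′ (b ∷ bs , eq) with (cs , eq′) , ℓy≡0 ← into (bs , refl) =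
        (b ∷ cs , trans eq (cong (b *ₗ v +ᵥ_) eq′)) , trans (cong ℓ eq) (trans (ℓ-absorb ℓv≡0 b _) ℓy≡0)
      from′ : ∀ {x} → span (v ∷ vs) x → ℓ x ≡ 0# → span (v ∷ us) x
      from′ (b ∷ bs , eq) ℓx≡0
        with cs , eq′ ← from (bs , refl) (trans (sym (ℓ-absorb ℓv≡0 b _)) (trans (cong ℓ (sym eq)) ℓx≡0)) =
        b ∷ cs , trans eq (cong (b *ₗ v +ᵥ_) eq′)

    abstract
      kernel : ∀ {d} (W : Subspace (suc d)) → (∃[ w ] ⟦ W ⟧ w × ℓ w ≢ 0#) →
               Σ[ K ∈ Subspace d ] ((∀ {v} → ⟦ K ⟧ v → ⟦ W ⟧ v × ℓ v ≡ 0#) ×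
                                    (∀ {v} → ⟦ W ⟧ v → ℓ v ≡ 0# → ⟦ K ⟧ v))
      kernel W w with us , us-independent , into , from ← hyperplane (Subspace.basis W) (Subspace.independent W) w =
        record { basis = us ; independent = us-independent } , into , from

  -- The polar form is a field of its own, known only through its laws, so that `β` does not unfold
  -- to a difference of values of `f`.
  record PolarizedForm : Set where
    field
      f      : V → Carrier
      β      : V → V → Carrier
      f-+    : ∀ u v → f (u +ᵥ v) ≡ f u + f v + β u v
      f-*    : ∀ a v → f (a *ₗ v) ≡ a * a * f v
      β-+    : ∀ u v w → β (u +ᵥ v) w ≡ β u w + β v w
      β-*    : ∀ a u v → β (a *ₗ u) v ≡ a * β u v
      β-comm : ∀ u v → β u v ≡ β v u

  -- Here `nd` concerns the radical of `β` alone, with no condition on `f`. In dimension 6 this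
  -- follows from non-degeneracy of the quadratic form, by `polar-nondegenerate`.
  record EllipticForm : Set where
    field
      polarizedForm : PolarizedForm
    open PolarizedForm polarizedForm public
    field
      nd   : ∀ v → (∀ u → β u v ≡ 0#) → v ≡ 0ᵥ
      witt : ∀ {d} (W : Subspace d) → (∀ v → ⟦ W ⟧ v → f v ≡ 0#) → d ≤ 2

-- Quadratic forms in characteristic 2: hyperbolic pairs and their complements.

module Quadratic {n : ℕ} (𝔽 : FiniteField (2 ^ n)) (𝒬 : LinearAlgebra.PolarizedForm {n} 𝔽) where
  open LinearAlgebra {n} 𝔽
  open PolarizedForm 𝒬

  infix 4 _⟂_
  _⟂_ : V → V → Set
  u ⟂ v = β u v ≡ 0#

  ⟂-sym : ∀ {u v} → u ⟂ v → v ⟂ u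
  ⟂-sym {u} {v} = trans (β-comm v u)

  f-0 : f 0ᵥ ≡ 0#
  f-0 = trans (cong f (sym (*ₗ-zeroˡ 0ᵥ))) (trans (f-* 0# 0ᵥ)
    (solve 1 (λ x → :0 :* :0 :* x := :0) refl (f 0ᵥ)))

  β-self : ∀ v → v ⟂ v
  β-self v = begin
    β v v              ≡⟨ solve 2 (λ x y → x := y :+ y :+ x) refl (β v v) (f v) ⟩
    f v + f v + β v v  ≡⟨ f-+ v v ⟨
    f (v +ᵥ v)         ≡⟨ cong f (v+v≡0 v) ⟩
    f 0ᵥ               ≡⟨ f-0 ⟩
    0#                 ∎
    where open ≡-Reasoning

  0⟂ : ∀ v → 0ᵥ ⟂ v
  0⟂ v = trans (cong (λ u → β u v) (sym (*ₗ-zeroˡ 0ᵥ))) (trans (β-* 0# 0ᵥ v) (zeroˡ _))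

  β-expandˡ : ∀ {m} (ρ : Vec V m) (e : Expr m) z →
              β (vectorValue e ρ) z ≡ scalarValue e (map (λ v → β v z) ρ)
  β-expandˡ ρ (var i) z  = sym (Vec.lookup-map i (λ v → β v z) ρ)
  β-expandˡ ρ 𝟘 z        = 0⟂ z
  β-expandˡ ρ (e ⊞ e′) z = trans (β-+ _ _ z) (cong₂ _+_ (β-expandˡ ρ e z) (β-expandˡ ρ e′ z))
  β-expandˡ ρ (c ⊡ e) z  = trans (β-* c _ z) (cong (c *_) (β-expandˡ ρ e z))

  β-expandʳ : ∀ {m} (ρ : Vec V m) (e : Expr m) z →
              β z (vectorValue e ρ) ≡ scalarValue e (map (β z) ρ)
  β-expandʳ ρ e z = trans (β-comm z _) (trans (β-expandˡ ρ e z)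
    (cong (scalarValue e) (Vec.map-cong (λ v → β-comm v z) ρ)))

  β-expand : ∀ {m} (ρ : Vec V m) (e e′ : Expr m) → β (vectorValue e ρ) (vectorValue e′ ρ) ≡
             scalarValue e (map (λ u → scalarValue e′ (map (β u) ρ)) ρ)
  β-expand ρ e e′ = trans (β-expandˡ ρ e _)
    (cong (scalarValue e) (Vec.map-cong (λ u → β-expandʳ ρ e′ u) ρ))

  formValue : ∀ {m} → Expr m → Vec V m → Carrier
  formValue (var i) ρ  = f (Vec.lookup ρ i)
  formValue 𝟘 ρ        = 0#
  formValue (e ⊞ e′) ρ = formValue e ρ + formValue e′ ρ +
                         scalarValue e (map (λ u → scalarValue e′ (map (β u) ρ)) ρ)
  formValue (c ⊡ e) ρ  = c * c * formValue e ρ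

  f-expand : ∀ {m} (ρ : Vec V m) (e : Expr m) → f (vectorValue e ρ) ≡ formValue e ρ
  f-expand ρ (var i)  = refl
  f-expand ρ 𝟘        = f-0
  f-expand ρ (e ⊞ e′) = trans (f-+ _ _)
    (cong₂ _+_ (cong₂ _+_ (f-expand ρ e) (f-expand ρ e′)) (β-expand ρ e e′))
  f-expand ρ (c ⊡ e)  = trans (f-* c _) (cong (c * c *_) (f-expand ρ e))

  ⟂-+ : ∀ {u v z} → u ⟂ z → v ⟂ z → (u +ᵥ v) ⟂ z
  ⟂-+ u⟂z v⟂z = trans (β-+ _ _ _) (trans (cong₂ _+_ u⟂z v⟂z) (+-identityˡ 0#))

  ⟂-* : ∀ c {u z} → u ⟂ z → (c *ₗ u) ⟂ z
  ⟂-* c u⟂z = trans (β-* c _ _) (trans (cong (c *_) u⟂z) (zeroʳ c))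

  f-*-singular : ∀ c {v} → f v ≡ 0# → f (c *ₗ v) ≡ 0#
  f-*-singular c fv≡0 = trans (f-* c _) (trans (cong (c * c *_) fv≡0) (zeroʳ _))

  f-+-singular : ∀ {u v} → f u ≡ 0# → f v ≡ 0# → u ⟂ v → f (u +ᵥ v) ≡ 0#
  f-+-singular fu fv u⟂v = trans (f-+ _ _) (trans (cong₂ _+_ (cong₂ _+_ fu fv) u⟂v)
    (solve 0 (:0 :+ :0 :+ :0 := :0) refl))

  infix 4 _⟂⟨_,_⟩
  _⟂⟨_,_⟩ : V → V → V → Set
  v ⟂⟨ a , b ⟩ = v ⟂ a × v ⟂ b

  -- A hyperbolic pair of the alternating form `β`; its members need not be singular for `f`.
  Pair : V → V → Set
  Pair a b = β a b ≡ 1#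

  -- For a hyperbolic pair `a`, `b` this is the projection along `⟨a, b⟩` onto its orthogonal
  -- complement.
  project : V → V → V → V
  project a b v = v +ᵥ (β v b *ₗ a +ᵥ β v a *ₗ b)

  module _ {a b : V} where
    private
      e : V → Expr 3
      e v = #0 ⊞ (β v b ⊡ #1 ⊞ β v a ⊡ #2)

    project-⟂ : Pair a b → ∀ v → project a b v ⟂⟨ a , b ⟩
    project-⟂ ab v = ⟂a , ⟂b
      where
      ⟂a : project a b v ⟂ a
      ⟂a rewrite β-expandˡ (v ∷ a ∷ b ∷ []) (e v) a | β-self a | β-comm b a | ab =
        solve 2 (λ x y → x :+ (y :* :0 :+ x :* :1) := :0) refl (β v a) (β v b)
      ⟂b : project a b v ⟂ b
      ⟂b rewrite β-expandˡ (v ∷ a ∷ b ∷ []) (e v) b | β-self b | ab =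
        solve 2 (λ x y → y :+ (y :* :1 :+ x :* :0) := :0) refl (β v a) (β v b)

    project-β : ∀ v {z} → z ⟂⟨ a , b ⟩ → β (project a b v) z ≡ β v z
    project-β v {z} (z⟂a , z⟂b)
      rewrite β-expandˡ (v ∷ a ∷ b ∷ []) (e v) z | β-comm a z | β-comm b z | z⟂a | z⟂b =
      solve 3 (λ x y w → w :+ (y :* :0 :+ x :* :0) := w) refl (β v a) (β v b) (β v z)

    project-+ : ∀ v → v ≡ project a b v +ᵥ (β v b *ₗ a +ᵥ β v a *ₗ b)
    project-+ v = sym (+ᵥ-cancelʳ v _)

    project-⟂-other : ∀ {v z} → v ⟂ z → a ⟂ z → b ⟂ z → project a b v ⟂ z
    project-⟂-other v⟂z a⟂z b⟂z = ⟂-+ v⟂z (⟂-+ (⟂-* _ a⟂z) (⟂-* _ b⟂z))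

    project-∈ : ∀ {d} (W : Subspace d) {v} → ⟦ W ⟧ a → ⟦ W ⟧ b → ⟦ W ⟧ v → ⟦ W ⟧ (project a b v)
    project-∈ W a∈W b∈W v∈W =
      +-closed W v∈W (+-closed W (*-closed W _ a∈W) (*-closed W _ b∈W))

    project-∈⁻¹ : ∀ {d} (W : Subspace d) {v} → ⟦ W ⟧ a → ⟦ W ⟧ b → ⟦ W ⟧ (project a b v) → ⟦ W ⟧ v
    project-∈⁻¹ W {v} a∈W b∈W v′∈W = subst ⟦ W ⟧ (sym (project-+ v))
      (+-closed W v′∈W (+-closed W (*-closed W _ a∈W) (*-closed W _ b∈W)))

  Complement : ∀ {d d′} → Subspace d′ → V → V → Subspace d → Set
  Complement W a b K = (∀ {v} → ⟦ K ⟧ v → ⟦ W ⟧ v × v ⟂⟨ a , b ⟩) ×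
                       (∀ {v} → ⟦ W ⟧ v → v ⟂⟨ a , b ⟩ → ⟦ K ⟧ v)

  abstract
    -- Each of the two cuts loses exactly one dimension: orthogonality to `a` fails at `b`, and `a`
    -- survives the first cut but fails orthogonality to `b`.
    complement : ∀ {d} (W : Subspace (suc (suc d))) {a b} → Pair a b → ⟦ W ⟧ a → ⟦ W ⟧ b →
      Σ[ K ∈ Subspace d ] Complement W a b K
    complement W {a} {b} ab a∈W b∈W
      with K₁ , into₁ , from₁ ← Functional.kernel (λ v → β v a) (λ u v → β-+ u v a) (λ c v → β-* c v a)
             W (b , b∈W , λ ba≡0 → 0≢1 (trans (sym (⟂-sym ba≡0)) ab))
      with K₂ , into₂ , from₂ ← Functional.kernel (λ v → β v b) (λ u v → β-+ u v b) (λ c v → β-* c v b)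
             K₁ (a , from₁ a∈W (β-self a) , λ ab≡0 → 0≢1 (trans (sym ab≡0) ab))
      = K₂ ,
        (λ v∈K₂ → let v∈K₁ , v⟂b = into₂ v∈K₂ ; v∈W , v⟂a = into₁ v∈K₁ in v∈W , v⟂a , v⟂b) ,
        (λ v∈W (v⟂a , v⟂b) → from₂ (from₁ v∈W v⟂a) v⟂b)

  trivial-⟦⟧ : ∀ (W : Subspace 0) {v} → ⟦ W ⟧ v → v ≡ 0ᵥ
  trivial-⟦⟧ W ([] , eq) with Subspace.basis W
  ... | [] = eq

  -- Splitting off the three mutually orthogonal pairs takes `V` through dimensions 4, 2 and 0.
  three-pairs : ∀ {a₁ b₁ a₂ b₂ a₃ b₃} → Pair a₁ b₁ → Pair a₂ b₂ → Pair a₃ b₃ →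
    a₂ ⟂⟨ a₁ , b₁ ⟩ → b₂ ⟂⟨ a₁ , b₁ ⟩ → a₃ ⟂⟨ a₁ , b₁ ⟩ → b₃ ⟂⟨ a₁ , b₁ ⟩ →
    a₃ ⟂⟨ a₂ , b₂ ⟩ → b₃ ⟂⟨ a₂ , b₂ ⟩ →
    ∀ {v} → v ⟂⟨ a₁ , b₁ ⟩ → v ⟂⟨ a₂ , b₂ ⟩ → v ⟂⟨ a₃ , b₃ ⟩ → v ≡ 0ᵥ
  three-pairs p₁ p₂ p₃ a₂⟂₁ b₂⟂₁ a₃⟂₁ b₃⟂₁ a₃⟂₂ b₃⟂₂ {v} v⟂₁ v⟂₂ v⟂₃
    with K₄ , _ , from₄ ← complement full p₁ (∈full _) (∈full _)
    with K₂ , _ , from₂ ← complement K₄ p₂ (from₄ (∈full _) a₂⟂₁) (from₄ (∈full _) b₂⟂₁)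
    with K₀ , _ , from₀ ← complement K₂ p₃ (from₂ (from₄ (∈full _) a₃⟂₁) a₃⟂₂)
                                           (from₂ (from₄ (∈full _) b₃⟂₁) b₃⟂₂)
    = trivial-⟦⟧ K₀ (from₀ (from₂ (from₄ (∈full v) v⟂₁) v⟂₂) v⟂₃)

  NonDegenerate : Pred V 0ℓ → Set
  NonDegenerate X = ∀ v → X v → (∀ u → X u → β u v ≡ 0#) → f v ≡ 0# → v ≡ 0ᵥ

  -- On a subspace of the radical f is additive, and semilinear for a ↦ a², which
  -- is onto: in dimension at least 2 it has a non-trivial zero.
  radical-line : ∀ {d X} → NonDegenerate X → (W : Subspace (suc (suc d))) →
    (∀ v → ⟦ W ⟧ v → X v) → (∀ v → ⟦ W ⟧ v → ∀ u → X u → β u v ≡ 0#) → ⊥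
  radical-line {X = X} nd W@(record { basis = w₁ ∷ w₂ ∷ ws ; independent = indep }) W⊆X W⊆X⊥ = contradict
    where
    two-terms : ∀ a b → combination (a ∷ b ∷ replicate _ 0#) (w₁ ∷ w₂ ∷ ws) ≡ a *ₗ w₁ +ᵥ b *ₗ w₂
    two-terms a b = trans (cong (λ t → a *ₗ w₁ +ᵥ (b *ₗ w₂ +ᵥ t)) (combination-0 ws))
      (cong (a *ₗ w₁ +ᵥ_) (+ᵥ-identityʳ _))
    member : ∀ a b → ⟦ W ⟧ (a *ₗ w₁ +ᵥ b *ₗ w₂)
    member a b = a ∷ b ∷ replicate _ 0# , sym (two-terms a b)
    zero⇒trivial : ∀ a b → f (a *ₗ w₁ +ᵥ b *ₗ w₂) ≡ 0# → a ≡ 0# × b ≡ 0#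
    zero⇒trivial a b fv≡0 = cong head as≡0 , cong (head ∘ tail) as≡0
      where
      as≡0 : a ∷ b ∷ replicate _ 0# ≡ replicate _ 0#
      as≡0 = indep _ (trans (two-terms a b)
        (nd _ (W⊆X _ (member a b)) (W⊆X⊥ _ (member a b)) fv≡0))
    w₁∈W : ⟦ W ⟧ w₁
    w₁∈W = subst ⟦ W ⟧ (by-coordinates (w₁ ∷ w₂ ∷ []) (1# ⊡ #0 ⊞ 0# ⊡ #1) #0
      λ { (x ∷ y ∷ []) → solve 2 (λ x y → :1 :* x :+ :0 :* y := x) refl x y }) (member 1# 0#)
    w₂∈W : ⟦ W ⟧ w₂
    w₂∈W = subst ⟦ W ⟧ (by-coordinates (w₁ ∷ w₂ ∷ []) (0# ⊡ #0 ⊞ 1# ⊡ #1) #1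
      λ { (x ∷ y ∷ []) → solve 2 (λ x y → :0 :* x :+ :1 :* y := y) refl x y }) (member 0# 1#)
    f-combination : ∀ a b → f (a *ₗ w₁ +ᵥ b *ₗ w₂) ≡ a * a * f w₁ + b * b * f w₂
    f-combination a b rewrite f-expand (w₁ ∷ w₂ ∷ []) (a ⊡ #0 ⊞ b ⊡ #1)
      | W⊆X⊥ w₂ w₂∈W w₁ (W⊆X w₁ w₁∈W) =
      solve 4 (λ a b x y → a :* a :* x :+ b :* b :* y :+ a :* (b :* :0) :=
                           a :* a :* x :+ b :* b :* y) refl a b (f w₁) (f w₂)
    contradict : ⊥
    contradict with f w₁ ≟ 0#
    ... | yes fw₁≡0 = 0≢1 (sym (proj₁ (zero⇒trivial 1# 0#
      (trans (f-combination 1# 0#) (trans (cong (λ t → 1# * 1# * t + 0# * 0# * f w₂) fw₁≡0)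
        (solve 1 (λ y → :1 :* :1 :* :0 :+ :0 :* :0 :* y := :0) refl (f w₂)))))))
    ... | no fw₁≢0 with c , fw₁c≡1 ← inverse (f w₁) fw₁≢0 with r , rr≡ ← sqrt (c * f w₂) =
      0≢1 (sym (proj₂ (zero⇒trivial r 1# (begin
        f (r *ₗ w₁ +ᵥ 1# *ₗ w₂)          ≡⟨ f-combination r 1# ⟩
        r * r * f w₁ + 1# * 1# * f w₂    ≡⟨ cong (λ t → t * f w₁ + 1# * 1# * f w₂) rr≡ ⟩
        c * f w₂ * f w₁ + 1# * 1# * f w₂ ≡⟨ solve 3 (λ c x y → c :* y :* x :+ :1 :* :1 :* y := (x :* c) :* y :+ y) refl c (f w₁) (f w₂) ⟩
        f w₁ * c * f w₂ + f w₂           ≡⟨ cong (λ t → t * f w₂ + f w₂) fw₁c≡1 ⟩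
        1# * f w₂ + f w₂                 ≡⟨ solve 1 (λ y → :1 :* y :+ y := :0) refl (f w₂) ⟩
        0#                               ∎))))
      where open ≡-Reasoning

  abstract
    scale-pair : ∀ {a b} → β a b ≢ 0# → ∃[ c ] Pair a (c *ₗ b)
    scale-pair {a} {b} ab≢0 with c , abc≡1 ← inverse (β a b) ab≢0 =
      c , trans (β-comm a _) (trans (β-* c b a) (trans (cong (c *_) (β-comm b a)) (trans (*-comm c _) abc≡1)))

  abstract
    -- If `β` vanished on `W`, the last premise would put `W` into the radical of `X`, which
    -- `radical-line` forbids in dimension at least 2. That premise passes from a space to the
    -- complement of a pair by `complement-radical`, so pairs can be extracted repeatedly.
    hyperbolic-pair : ∀ {d X} → NonDegenerate X → (W : Subspace (suc (suc d))) →
      (∀ v → ⟦ W ⟧ v → X v) →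
      (∀ v → ⟦ W ⟧ v → (∀ u → ⟦ W ⟧ u → β u v ≡ 0#) → ∀ u → X u → β u v ≡ 0#) →
      ∃[ a ] ∃[ b ] ⟦ W ⟧ a × ⟦ W ⟧ b × Pair a b
    hyperbolic-pair nd W W⊆X radical
      with anyVec? (λ a → anyVec? (λ b → (a ∈? W) ×-dec (b ∈? W) ×-dec ¬? (β a b ≟ 0#)))
    ... | yes (a , b , a∈W , b∈W , ab≢0) with c , pair ← scale-pair ab≢0 =
      a , c *ₗ b , a∈W , *-closed W c b∈W , pair
    ... | no none = ⊥-elim (radical-line nd W W⊆X λ v v∈W → radical v v∈W λ u u∈W →
      decidable-stable (β u v ≟ 0#) (λ uv≢0 → none (u , v , u∈W , v∈W , uv≢0)))

  -- A vector of `W` differs from its projection by a combination of `a` and `b`, both orthogonal to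
  -- `v`, and the projection lies in `K`. Thus the radical of `K` is contained in that of `W`.
  complement-radical : ∀ {d d′} (W : Subspace d′) {a b} (ab : Pair a b) (a∈W : ⟦ W ⟧ a) (b∈W : ⟦ W ⟧ b)
    (K : Subspace d) → Complement W a b K →
    ∀ v → ⟦ K ⟧ v → (∀ u → ⟦ K ⟧ u → β u v ≡ 0#) → ∀ u → ⟦ W ⟧ u → β u v ≡ 0#
  complement-radical W ab a∈W b∈W K (into , from) v v∈K v⟂K u u∈W =
    trans (sym (project-β u (proj₂ (into v∈K))))
          (v⟂K _ (from (project-∈ W a∈W b∈W u∈W) (project-⟂ ab u)))

  -- The radical of an alternating form on an even-dimensional space has even
  -- dimension, while the radical of a non-degenerate quadratic form is at most 1-dimensional.
  polar-nondegenerate : NonDegenerate U → ∀ v → (∀ u → β u v ≡ 0#) → v ≡ 0ᵥ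
  polar-nondegenerate nd
    with a₁ , b₁ , a₁∈ , b₁∈ , p₁ ← hyperbolic-pair nd full (λ _ _ → _)
           (λ v _ v⟂ u _ → v⟂ u (∈full u))
    with K₄ , C₄@(into₄ , _) ← complement full p₁ a₁∈ b₁∈
    with r₁ ← complement-radical full p₁ a₁∈ b₁∈ K₄ C₄
    with a₂ , b₂ , a₂∈ , b₂∈ , p₂ ← hyperbolic-pair nd K₄ (λ _ _ → _)
           (λ v v∈ v⟂ u _ → r₁ v v∈ v⟂ u (∈full u))
    with K₂ , C₂@(into₂ , _) ← complement K₄ p₂ a₂∈ b₂∈
    with r₂ ← complement-radical K₄ p₂ a₂∈ b₂∈ K₂ C₂
    with a₃ , b₃ , a₃∈ , b₃∈ , p₃ ← hyperbolic-pair nd K₂ (λ _ _ → _)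
           (λ v v∈ v⟂ u _ → r₁ v (proj₁ (into₂ v∈)) (r₂ v v∈ v⟂) u (∈full u))
    = λ v v⟂ → three-pairs p₁ p₂ p₃ (proj₂ (into₄ a₂∈)) (proj₂ (into₄ b₂∈))
        (proj₂ (into₄ (proj₁ (into₂ a₃∈)))) (proj₂ (into₄ (proj₁ (into₂ b₃∈))))
        (proj₂ (into₂ a₃∈)) (proj₂ (into₂ b₃∈))
        (⟂-sym (v⟂ a₁) , ⟂-sym (v⟂ b₁)) (⟂-sym (v⟂ a₂) , ⟂-sym (v⟂ b₂)) (⟂-sym (v⟂ a₃) , ⟂-sym (v⟂ b₃))

-- Singular vectors in a space of Witt index 2.

module Elliptic {n : ℕ} (𝔽 : FiniteField (2 ^ n)) (ℰ : LinearAlgebra.EllipticForm {n} 𝔽) where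
  open LinearAlgebra {n} 𝔽
  open EllipticForm ℰ
  open Quadratic {n} 𝔽 polarizedForm

  anyVector? : {P : Pred V 0ℓ} → Decidable P → Dec (∃ P)
  anyVector? = anyVec?

  abstract
    partner : ∀ {e} → e ≢ 0ᵥ → ∃[ w ] Pair e w
    partner {e} e≢0 with anyVector? (λ w → ¬? (β e w ≟ 0#))
    ... | yes (w , ew≢0) = let c , pair = scale-pair ew≢0 in c *ₗ w , pair
    ... | no none = contradiction (nd e λ u → ⟂-sym (decidable-stable (β e u ≟ 0#) λ eu≢0 → none (u , eu≢0))) e≢0

    partner-⟂ : ∀ {a b e} → Pair a b → e ⟂⟨ a , b ⟩ → e ≢ 0ᵥ → ∃[ w ] w ⟂⟨ a , b ⟩ × Pair e w
    partner-⟂ {a} {b} {e} ab e⟂ e≢0 with w , ew ← partner e≢0 =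
      project a b w , project-⟂ ab w , trans (β-comm e _) (trans (project-β w e⟂) (trans (β-comm w e) ew))

  -- For `e` singular with `β e w = 1`, adding `t e` to `w` adds `t` to `f w`; the choice `t = f w`
  -- makes the result singular.
  singularize : ∀ e w → V
  singularize e w = w +ᵥ f w *ₗ e

  f-singularize : ∀ {e w} → f e ≡ 0# → Pair e w → f (singularize e w) ≡ 0#
  f-singularize {e} {w} fe ew rewrite f-expand (w ∷ e ∷ []) (#0 ⊞ f w ⊡ #1) | fe | β-comm w e | ew =
    solve 1 (λ x → x :+ x :* x :* :0 :+ x :* :1 := :0) refl (f w)

  Pair-singularize : ∀ {e w} → Pair e w → Pair e (singularize e w)
  Pair-singularize {e} {w} ew rewrite β-expandʳ (w ∷ e ∷ []) (#0 ⊞ f w ⊡ #1) e | β-self e | ew =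
    solve 1 (λ x → :1 :+ x :* :0 := :1) refl (f w)

  abstract
    singular-partner : ∀ {a b e} → Pair a b → e ⟂⟨ a , b ⟩ → e ≢ 0ᵥ → f e ≡ 0# →
                       ∃[ g ] g ⟂⟨ a , b ⟩ × f g ≡ 0# × Pair e g
    singular-partner {e = e} ab (e⟂a , e⟂b) e≢0 fe with w , (w⟂a , w⟂b) , ew ← partner-⟂ ab (e⟂a , e⟂b) e≢0 =
      singularize e w , (⟂-+ w⟂a (⟂-* _ e⟂a) , ⟂-+ w⟂b (⟂-* _ e⟂b)) ,
      f-singularize fe ew , Pair-singularize ew

    -- The double complement of `⟨a, b⟩` is `⟨a, b⟩` itself: the projection of `y` is orthogonal to
    -- all of `V`, hence zero, and the coefficients are those that `project` removes.
    determined : ∀ {a b y} → Pair a b → (∀ w → w ⟂⟨ a , b ⟩ → w ⟂ y) → y ≡ β y b *ₗ a +ᵥ β y a *ₗ b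
    determined {a} {b} {y} ab ⟂y = u+v≡0⇒u≡v (nd (project a b y) λ u →
      let (y′⟂a , y′⟂b) = project-⟂ ab y
          (u′⟂a , u′⟂b) = project-⟂ ab u in
      trans (sym (project-β u (y′⟂a , y′⟂b)))
        (trans (β-comm _ _) (trans (project-β y (u′⟂a , u′⟂b)) (⟂-sym (⟂y _ (u′⟂a , u′⟂b))))))

    -- For a hyperbolic pair e, g of singular vectors and w ⟂ e, g the vector
    -- e + f w g + w is singular, so singular vectors span.
    singular-determined : ∀ {a b e y} → Pair a b → e ⟂⟨ a , b ⟩ → e ≢ 0ᵥ → f e ≡ 0# →
      (∀ s → f s ≡ 0# → s ⟂⟨ a , b ⟩ → s ⟂ y) → y ≡ β y b *ₗ a +ᵥ β y a *ₗ b
    singular-determined {a} {b} {e} {y} ab e⟂@(e⟂a , e⟂b) e≢0 fe ⟂y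
      with g , g⟂@(g⟂a , g⟂b) , fg , eg ← singular-partner ab e⟂ e≢0 fe = determined ab w⟂y
      where
      e⟂y : e ⟂ y
      e⟂y = ⟂y e fe e⟂
      g⟂y : g ⟂ y
      g⟂y = ⟂y g fg g⟂
      w⟂y : ∀ w → w ⟂⟨ a , b ⟩ → w ⟂ y
      w⟂y w (w⟂a , w⟂b) = trans (sym (project-β w (⟂-sym e⟂y , ⟂-sym g⟂y))) w₀⟂y
        where
        w₀ s : V
        w₀ = project e g w
        s = e +ᵥ f w₀ *ₗ g +ᵥ w₀
        w₀⟂e : w₀ ⟂ e
        w₀⟂e = proj₁ (project-⟂ eg w)
        w₀⟂g : w₀ ⟂ g
        w₀⟂g = proj₂ (project-⟂ eg w)
        fs : f s ≡ 0#
        fs rewrite f-expand (e ∷ g ∷ w₀ ∷ []) (#0 ⊞ f w₀ ⊡ #1 ⊞ #2) | fe | fg | eg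
          | ⟂-sym w₀⟂e | ⟂-sym w₀⟂g =
          solve 1 (λ x → :0 :+ x :* x :* :0 :+ x :* :1 :+ x :+ (:0 :+ x :* :0) := :0) refl (f w₀)
        s⟂ : ∀ {z} → e ⟂ z → g ⟂ z → w ⟂ z → s ⟂ z
        s⟂ e⟂z g⟂z w⟂z = ⟂-+ (⟂-+ e⟂z (⟂-* _ g⟂z)) (project-⟂-other w⟂z e⟂z g⟂z)
        w₀⟂y : w₀ ⟂ y
        w₀⟂y with s⟂y ← ⟂y s fs (s⟂ e⟂a g⟂a w⟂a , s⟂ e⟂b g⟂b w⟂b)
          rewrite β-expandˡ (e ∷ g ∷ w₀ ∷ []) (#0 ⊞ f w₀ ⊡ #1 ⊞ #2) y | e⟂y | g⟂y =
          trans (solve 2 (λ t x → t := :0 :+ x :* :0 :+ t) refl _ (f w₀)) s⟂y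

  ∉trivial : ∀ {v} → v ≢ 0ᵥ → ¬ ⟦ trivial ⟧ v
  ∉trivial v≢0 ([] , eq) = v≢0 eq

  extend-singular : ∀ {d} (W : Subspace d) {x} (x∉W : ¬ ⟦ W ⟧ x) →
    (∀ v → ⟦ W ⟧ v → f v ≡ 0#) → f x ≡ 0# → (∀ v → ⟦ W ⟧ v → x ⟂ v) →
    ∀ v → ⟦ extend W x x∉W ⟧ v → f v ≡ 0#
  extend-singular W x∉W fW fx x⟂W _ (a ∷ as , refl) =
    f-+-singular (f-*-singular a fx) (fW _ (as , refl)) (⟂-* a (x⟂W _ (as , refl)))

  -- Such vectors would span a totally singular 3-space, against Witt index 2. Independence is given
  -- as successive non-membership, the form in which `extend` consumes it.
  no-singular-triple : ∀ {a b c} → f a ≡ 0# → f b ≡ 0# → f c ≡ 0# → b ⟂ a → c ⟂ a → c ⟂ b →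
    a ≢ 0ᵥ → (∀ s → b ≢ s *ₗ a) → (∀ s t → c ≢ s *ₗ b +ᵥ t *ₗ a) → ⊥
  no-singular-triple {a} {b} {c} fa fb fc b⟂a c⟂a c⟂b a≢0 b≢ c≢ = ℕ.1+n≰n (witt W₃ fW₃)
    where
    W₁ = extend trivial a (∉trivial a≢0)
    fW₁ = extend-singular trivial (∉trivial a≢0) (λ { _ ([] , refl) → f-0 }) fa (λ { _ ([] , refl) → ⟂-sym (0⟂ _) })
    b∉W₁ : ¬ ⟦ W₁ ⟧ b
    b∉W₁ (s ∷ [] , eq) = b≢ s (trans eq (+ᵥ-identityʳ _))
    b⟂W₁ : ∀ v → ⟦ W₁ ⟧ v → b ⟂ v
    b⟂W₁ _ (s ∷ [] , refl) = ⟂-sym (⟂-+ (⟂-* s (⟂-sym b⟂a)) (0⟂ b))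
    W₂ = extend W₁ b b∉W₁
    fW₂ = extend-singular W₁ b∉W₁ fW₁ fb b⟂W₁
    c∉W₂ : ¬ ⟦ W₂ ⟧ c
    c∉W₂ (s ∷ t ∷ [] , eq) = c≢ s t (trans eq (cong (s *ₗ b +ᵥ_) (+ᵥ-identityʳ _)))
    c⟂W₂ : ∀ v → ⟦ W₂ ⟧ v → c ⟂ v
    c⟂W₂ _ (s ∷ t ∷ [] , refl) = ⟂-sym (⟂-+ (⟂-* s (⟂-sym c⟂b)) (⟂-+ (⟂-* t (⟂-sym c⟂a)) (0⟂ c)))
    W₃ = extend W₂ c c∉W₂
    fW₃ = extend-singular W₂ c∉W₂ fW₂ fc c⟂W₂

-- The nucleus of a parabolic hyperplane.

module Nucleus {n : ℕ} (𝔽 : FiniteField (2 ^ n)) (ℰ : LinearAlgebra.EllipticForm {n} 𝔽) where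
  open LinearAlgebra {n} 𝔽
  open EllipticForm ℰ
  open Quadratic {n} 𝔽 polarizedForm
  open Elliptic {n} 𝔽 ℰ

  abstract
    normalize : ∀ {k} → f k ≢ 0# → ∃[ c ] f (c *ₗ k) ≡ 1#
    normalize {k} fk≢0 with d , fkd≡1 ← inverse (f k) fk≢0 with c , cc≡d ← sqrt d =
      c , trans (f-* c k) (trans (cong (_* f k) cc≡d) (trans (*-comm d _) fkd≡1))

    -- Two hyperbolic pairs split off the 5-space `H` leave a 1-space, which is orthogonal to all of
    -- `H`. Non-degeneracy on `H` keeps `f` from vanishing there, and as every scalar is a square,
    -- rescaling reaches the value 1.
    nucleus : (H : Subspace 5) → NonDegenerate ⟦ H ⟧ →
      ∃[ ν ] f ν ≡ 1# × (∀ v → ⟦ H ⟧ v → v ⟂ ν) × (∀ v → v ⟂ ν → ⟦ H ⟧ v)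
    nucleus H ndH
      with a₁ , b₁ , a₁∈ , b₁∈ , p₁ ← hyperbolic-pair ndH H (λ _ v∈ → v∈) (λ v _ v⟂ → v⟂)
      with K₃ , C₃@(into₃ , from₃) ← complement H p₁ a₁∈ b₁∈
      with r₁ ← complement-radical H p₁ a₁∈ b₁∈ K₃ C₃
      with a₂ , b₂ , a₂∈ , b₂∈ , p₂ ← hyperbolic-pair ndH K₃ (λ _ v∈ → proj₁ (into₃ v∈)) r₁
      with K₁ , C₁@(into₁ , from₁) ← complement K₃ p₂ a₂∈ b₂∈
      with r₂ ← complement-radical K₃ p₂ a₂∈ b₂∈ K₁ C₁
      = result K₁ into₁ from₁ r₂
      where
      result : (K : Subspace 1) → (∀ {v} → ⟦ K ⟧ v → ⟦ K₃ ⟧ v × v ⟂⟨ a₂ , b₂ ⟩) →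
        (∀ {v} → ⟦ K₃ ⟧ v → v ⟂⟨ a₂ , b₂ ⟩ → ⟦ K ⟧ v) →
        (∀ v → ⟦ K ⟧ v → (∀ u → ⟦ K ⟧ u → β u v ≡ 0#) → ∀ u → ⟦ K₃ ⟧ u → β u v ≡ 0#) →
        ∃[ ν ] f ν ≡ 1# × (∀ v → ⟦ H ⟧ v → v ⟂ ν) × (∀ v → v ⟂ ν → ⟦ H ⟧ v)
      result K@(record { basis = k ∷ [] ; independent = indep }) into from rad =
        ν , fν , (λ v v∈H → k⟂H v v∈H) , ν⟂⇒∈H
        where
        k∈K : ⟦ K ⟧ k
        k∈K = 1# ∷ [] , sym (trans (+ᵥ-identityʳ _) (*ₗ-identity k))
        k∈K₃ : ⟦ K₃ ⟧ k
        k∈K₃ = proj₁ (into k∈K)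
        k∈H : ⟦ H ⟧ k
        k∈H = proj₁ (into₃ k∈K₃)
        k≢0 : k ≢ 0ᵥ
        k≢0 k≡0 = 0≢1 (sym (cong head (indep (1# ∷ []) (trans (+ᵥ-identityʳ _) (trans (*ₗ-identity k) k≡0)))))
        K⟂k : ∀ u → ⟦ K ⟧ u → u ⟂ k
        K⟂k _ (c ∷ [] , refl) = ⟂-+ (⟂-* c (β-self k)) (0⟂ k)
        H⟂k : ∀ v → ⟦ H ⟧ v → v ⟂ k
        H⟂k = r₁ k k∈K₃ (rad k k∈K K⟂k)
        fk≢0 : f k ≢ 0#
        fk≢0 fk≡0 = k≢0 (ndH k k∈H H⟂k fk≡0)
        c : Carrier
        c = proj₁ (normalize fk≢0)
        ν : V
        ν = c *ₗ k
        fν : f ν ≡ 1#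
        fν = proj₂ (normalize fk≢0)
        ν≢0 : ν ≢ 0ᵥ
        ν≢0 eq = 0≢1 (trans (sym f-0) (trans (cong f (sym eq)) fν))
        ν∈H : ⟦ H ⟧ ν
        ν∈H = *-closed H c k∈H
        k⟂H : ∀ v → ⟦ H ⟧ v → v ⟂ ν
        k⟂H v v∈H = ⟂-sym (⟂-* c (⟂-sym (H⟂k v v∈H)))
        a₂∈H : ⟦ H ⟧ a₂
        a₂∈H = proj₁ (into₃ a₂∈)
        b₂∈H : ⟦ H ⟧ b₂
        b₂∈H = proj₁ (into₃ b₂∈)
        a₂⟂₁ : a₂ ⟂⟨ a₁ , b₁ ⟩
        a₂⟂₁ = proj₂ (into₃ a₂∈)
        b₂⟂₁ : b₂ ⟂⟨ a₁ , b₁ ⟩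
        b₂⟂₁ = proj₂ (into₃ b₂∈)
        ν⟂₁ : ν ⟂⟨ a₁ , b₁ ⟩
        ν⟂₁ = ⟂-sym (k⟂H a₁ a₁∈) , ⟂-sym (k⟂H b₁ b₁∈)
        ν⟂₂ : ν ⟂⟨ a₂ , b₂ ⟩
        ν⟂₂ = ⟂-sym (k⟂H a₂ a₂∈H) , ⟂-sym (k⟂H b₂ b₂∈H)
        twice : V → V
        twice v = project a₂ b₂ (project a₁ b₁ v)
        twice-⟂₁ : ∀ v → twice v ⟂⟨ a₁ , b₁ ⟩
        twice-⟂₁ v = let (⟂a , ⟂b) = project-⟂ p₁ v in
          project-⟂-other ⟂a (proj₁ a₂⟂₁) (proj₁ b₂⟂₁) , project-⟂-other ⟂b (proj₂ a₂⟂₁) (proj₂ b₂⟂₁)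
        twice-⟂₂ : ∀ v → twice v ⟂⟨ a₂ , b₂ ⟩
        twice-⟂₂ v = project-⟂ p₂ (project a₁ b₁ v)
        twice-ν : ∀ v → β (twice v) ν ≡ β v ν
        twice-ν v = trans (project-β (project a₁ b₁ v) ν⟂₂) (project-β v ν⟂₁)
        -- What remains of `v` after removing both pairs lies in the span of `ν` and its partner
        -- `t`, by `three-pairs`. Being orthogonal to `ν`, it is a multiple of `ν`, and everything
        -- removed was in `H`.
        ν⟂⇒∈H : ∀ v → v ⟂ ν → ⟦ H ⟧ v
        ν⟂⇒∈H v v⟂ν with t₀ , νt₀ ← partner ν≢0 =
          project-∈⁻¹ H a₁∈ b₁∈ (project-∈⁻¹ H a₂∈H b₂∈H (subst ⟦ H ⟧ (sym v′≡) (*-closed H _ ν∈H)))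
          where
          t v′ : V
          t  = twice t₀
          v′ = twice v
          v′⟂ν : v′ ⟂ ν
          v′⟂ν = trans (twice-ν v) v⟂ν
          νt : Pair ν t
          νt = trans (β-comm ν t) (trans (twice-ν t₀) (trans (β-comm t₀ ν) νt₀))
          v″≡0 : project ν t v′ ≡ 0ᵥ
          v″≡0 = three-pairs p₁ p₂ νt a₂⟂₁ b₂⟂₁ ν⟂₁ (twice-⟂₁ t₀) ν⟂₂ (twice-⟂₂ t₀)
            (project-⟂-other (proj₁ (twice-⟂₁ v)) (proj₁ ν⟂₁) (proj₁ (twice-⟂₁ t₀)) ,
             project-⟂-other (proj₂ (twice-⟂₁ v)) (proj₂ ν⟂₁) (proj₂ (twice-⟂₁ t₀)))
            (project-⟂-other (proj₁ (twice-⟂₂ v)) (proj₁ ν⟂₂) (proj₁ (twice-⟂₂ t₀)) ,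
             project-⟂-other (proj₂ (twice-⟂₂ v)) (proj₂ ν⟂₂) (proj₂ (twice-⟂₂ t₀)))
            (project-⟂ νt v′)
          v′≡ : v′ ≡ β v′ t *ₗ ν
          v′≡ = trans (u+v≡0⇒u≡v v″≡0) (trans (cong (λ c → β v′ t *ₗ ν +ᵥ c *ₗ t) v′⟂ν)
            (trans (cong (β v′ t *ₗ ν +ᵥ_) (*ₗ-zeroˡ t)) (+ᵥ-identityʳ _)))

-- Singular vectors off the hyperplane of the nucleus, and how their sections meet.

module AffineQuadric {n : ℕ} (𝔽 : FiniteField (2 ^ n)) (ℰ : LinearAlgebra.EllipticForm {n} 𝔽)
  (ν : Space.V 𝔽) (fν : LinearAlgebra.EllipticForm.f ℰ ν ≡ FiniteField.1# 𝔽)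
  (L : Space.Subspace 𝔽 2)
  (fL : ∀ v → Space.⟦_⟧ 𝔽 L v → LinearAlgebra.EllipticForm.f ℰ v ≡ FiniteField.0# 𝔽)
  (L⟂ν : ∀ v → Space.⟦_⟧ 𝔽 L v → LinearAlgebra.EllipticForm.β ℰ v ν ≡ FiniteField.0# 𝔽)
  where
  open LinearAlgebra {n} 𝔽
  open EllipticForm ℰ
  open Quadratic {n} 𝔽 polarizedForm
  open Elliptic {n} 𝔽 ℰ

  Affine : V → Set
  Affine x = f x ≡ 0# × Pair x ν

  bar : V → V
  bar x = x +ᵥ ν

  ν≢0 : ν ≢ 0ᵥ
  ν≢0 eq = 0≢1 (trans (sym f-0) (trans (cong f (sym eq)) fν))

  bar-affine : ∀ {x} → Affine x → Affine (bar x)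
  bar-affine {x} (fx , xν) = f-bar , β-bar
    where
    f-bar : f (bar x) ≡ 0#
    f-bar rewrite f-+ x ν | fx | fν | xν = solve 0 (:0 :+ :1 :+ :1 := :0) refl
    β-bar : Pair (bar x) ν
    β-bar rewrite β-+ x ν ν | β-self ν | xν = +-identityʳ 1#

  β-bar : ∀ {x} y → Affine x → β x (bar y) ≡ β x y + 1#
  β-bar {x} y (_ , xν) rewrite β-expandʳ (y ∷ ν ∷ []) (#0 ⊞ #1) x | xν = refl

  bar-bar : ∀ x → bar (bar x) ≡ x
  bar-bar x = +ᵥ-cancelʳ x ν

  β-x-barx : ∀ {x} → Affine x → β x (bar x) ≡ 1#
  β-x-barx {x} ax = trans (β-bar x ax) (trans (cong (_+ 1#) (β-self x)) (+-identityˡ 1#))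

  abstract
    -- The totally singular 2-space `L` lies in the hyperplane orthogonal to `ν`, and orthogonality
    -- to `x` is one more linear equation on it, so a non-zero solution is left.
    singular-⟂ : ∀ {x} → Affine x → ∃[ e ] f e ≡ 0# × e ≢ 0ᵥ × e ⟂⟨ x , ν ⟩
    singular-⟂ {x} ax = go L fL L⟂ν
      where
      go : (L : Subspace 2) → (∀ v → ⟦ L ⟧ v → f v ≡ 0#) → (∀ v → ⟦ L ⟧ v → β v ν ≡ 0#) →
           ∃[ e ] f e ≡ 0# × e ≢ 0ᵥ × e ⟂⟨ x , ν ⟩
      go L@(record { basis = l₁ ∷ l₂ ∷ [] ; independent = indep }) fL L⟂ν = cases (β l₁ x ≟ 0#)
        where
        in-L : ∀ a b → ⟦ L ⟧ (a *ₗ l₁ +ᵥ b *ₗ l₂)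
        in-L a b = a ∷ b ∷ [] , cong (a *ₗ l₁ +ᵥ_) (sym (+ᵥ-identityʳ _))
        pick : ∀ a b → (a ∷ b ∷ []) ≢ (0# ∷ 0# ∷ []) → a * β l₁ x + b * β l₂ x ≡ 0# →
               ∃[ e ] f e ≡ 0# × e ≢ 0ᵥ × e ⟂⟨ x , ν ⟩
        pick a b ab≢0 eq = a *ₗ l₁ +ᵥ b *ₗ l₂ , fL _ (in-L a b) ,
          (λ e≡0 → ab≢0 (indep (a ∷ b ∷ []) (trans (cong (a *ₗ l₁ +ᵥ_) (+ᵥ-identityʳ _)) e≡0))) ,
          trans (β-expandˡ (l₁ ∷ l₂ ∷ []) (a ⊡ #0 ⊞ b ⊡ #1) x) eq , L⟂ν _ (in-L a b)
        cases : Dec (β l₁ x ≡ 0#) → ∃[ e ] f e ≡ 0# × e ≢ 0ᵥ × e ⟂⟨ x , ν ⟩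
        cases (yes l₁⟂x) = pick 1# 0# (λ eq → 0≢1 (sym (cong head eq)))
          (trans (cong (λ t → 1# * t + 0# * β l₂ x) l₁⟂x) (solve 1 (λ y → :1 :* :0 :+ :0 :* y := :0) refl (β l₂ x)))
        cases (no l₁x≢0) = pick (β l₂ x) (β l₁ x) (λ eq → l₁x≢0 (cong (head ∘ tail) eq))
          (solve 2 (λ y z → y :* z :+ z :* y := :0) refl (β l₂ x) (β l₁ x))

    -- Because `f (x + c ν) = ℘ c`, singularity leaves only `c = 0` and `c = 1`.
    bar-cases : ∀ {x y c} → Affine x → Affine y → y ≡ x +ᵥ c *ₗ ν → y ≡ x ⊎ y ≡ bar x
    bar-cases {x} {y} {c} (fx , xν) (fy , _) eq with ℘-roots (trans (sym f≡℘) (trans (cong f (sym eq)) fy))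
      where
      f≡℘ : f (x +ᵥ c *ₗ ν) ≡ ℘ c
      f≡℘ rewrite f-expand (x ∷ ν ∷ []) (#0 ⊞ c ⊡ #1) | fx | fν | xν =
        solve 1 (λ c → :0 :+ c :* c :* :1 :+ c :* :1 := c :* c :+ c) refl c
    ... | inj₁ refl = inj₁ (trans eq (trans (cong (x +ᵥ_) (*ₗ-zeroˡ ν)) (+ᵥ-identityʳ x)))
    ... | inj₂ refl = inj₂ (trans eq (cong (x +ᵥ_) (*ₗ-identity ν)))

    -- The singular vectors orthogonal to `x` and `ν` determine the span of `x` and `ν`, so `y` lies
    -- in it; its coefficient at `x` is `β y ν = 1`.
    same-section : ∀ {x y} → Affine x → Affine y →
      (∀ s → f s ≡ 0# → s ⟂⟨ x , ν ⟩ → s ⟂ y) → y ≡ x ⊎ y ≡ bar x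
    same-section {x} {y} ax@(_ , xν) ay@(_ , yν) ⟂y with e , fe , e≢0 , e⟂ ← singular-⟂ ax =
      bar-cases ax ay (trans (singular-determined xν e⟂ e≢0 fe ⟂y)
        (cong (_+ᵥ β y x *ₗ ν) (trans (cong (_*ₗ x) yν) (*ₗ-identity x))))

    -- A singular vector orthogonal to `x` and `y` but not to `ν` gives the neighbour after scaling.
    -- If there were none, all singular vectors of `{x, y}⊥` would be orthogonal to `ν`, so that `ν`
    -- would lie in `⟨x, y⟩`, and this forces `y = bar x`.
    common-neighbour : ∀ {x y} → Affine x → Affine y → β x y ≢ 0# → y ≢ bar x →
      ∃[ z ] Affine z × z ⟂ x × z ⟂ y
    common-neighbour {x} {y} ax@(fx , xν) ay@(fy , yν) xy≢0 y≢x̄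
      with anyVector? (λ s → (f s ≟ 0#) ×-dec (β s x ≟ 0#) ×-dec (β s y ≟ 0#) ×-dec ¬? (β s ν ≟ 0#))
    ... | yes (s , fs , s⟂x , s⟂y , sν≢0) with c , sνc≡1 ← inverse (β s ν) sν≢0 =
      c *ₗ s , (f-*-singular c fs , trans (β-* c s ν) (trans (*-comm c _) sνc≡1)) , ⟂-* c s⟂x , ⟂-* c s⟂y
    ... | no none with e , fe , e≢0 , e⟂x , e⟂ν ← singular-⟂ ax | c , xyc≡1 ← inverse (β x y) xy≢0 =
      ⊥-elim (y≢x̄ (trans y≡ (+ᵥ-comm ν x)))
      where
      pair : Pair x (c *ₗ y)
      pair = trans (β-comm x _) (trans (β-* c y x) (trans (cong (c *_) (β-comm y x)) (trans (*-comm c _) xyc≡1)))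
      -- `e` is orthogonal to `x` but perhaps not to `y`. Adding this multiple of `x` corrects that
      -- and keeps the vector singular: it is the singular vector of `{x, y}⊥` from which
      -- `singular-determined` starts.
      λ′ : Carrier
      λ′ = β e y * c
      e′ : V
      e′ = e +ᵥ λ′ *ₗ x
      e′⟂x : e′ ⟂ x
      e′⟂x = ⟂-+ e⟂x (⟂-* λ′ (β-self x))
      e′⟂y : e′ ⟂ y
      e′⟂y rewrite β-expandˡ (e ∷ x ∷ []) (#0 ⊞ λ′ ⊡ #1) y =
        trans (solve 3 (λ a c b → a :+ a :* c :* b := a :+ a :* (b :* c)) refl (β e y) c (β x y))
          (trans (cong (λ t → β e y + β e y * t) xyc≡1) (solve 1 (λ a → a :+ a :* :1 := :0) refl (β e y)))
      fe′ : f e′ ≡ 0#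
      fe′ = f-+-singular fe (f-*-singular λ′ fx) (⟂-sym (⟂-* λ′ (⟂-sym e⟂x)))
      e′≢0 : e′ ≢ 0ᵥ
      e′≢0 e′≡0 = e≢0 (trans (sym (trans (cong (λ t → e +ᵥ t *ₗ x) λ′≡0)
        (trans (cong (e +ᵥ_) (*ₗ-zeroˡ x)) (+ᵥ-identityʳ e)))) e′≡0)
        where
        λ′≡0 : λ′ ≡ 0#
        λ′≡0 with eq ← cong (λ v → β v ν) (sym e′≡0)
          rewrite β-expandˡ (e ∷ x ∷ []) (#0 ⊞ λ′ ⊡ #1) ν | e⟂ν | xν =
          trans (solve 1 (λ l → l := :0 :+ l :* :1) refl λ′) (trans (sym eq) (0⟂ ν))
      cy≢ : ∀ s → f s ≡ 0# → s ⟂⟨ x , c *ₗ y ⟩ → s ⟂ ν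
      cy≢ s fs (s⟂x , s⟂cy) = decidable-stable (β s ν ≟ 0#) λ sν≢0 → none (s , fs , s⟂x , s⟂y , sν≢0)
        where
        s⟂y : s ⟂ y
        s⟂y = no-zero-divisors (trans (cong (c *_) (β-comm s y)) (trans (sym (β-* c y s)) (⟂-sym s⟂cy)))
          (λ c≡0 → 0≢1 (trans (trans (sym (zeroʳ (β x y))) (cong (β x y *_) (sym c≡0))) xyc≡1))
      ν≡ : ν ≡ c *ₗ x +ᵥ c *ₗ y
      ν≡ = trans (singular-determined pair (e′⟂x , ⟂-sym (⟂-* c (⟂-sym e′⟂y))) e′≢0 fe′ cy≢)
        (cong₂ (λ a b → a *ₗ x +ᵥ b *ₗ c *ₗ y)
          (trans (β-comm ν _) (trans (β-* c y ν) (trans (cong (c *_) yν) (*-identityʳ c))))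
          (trans (β-comm ν x) xν) ⟨ trans ⟩ cong (c *ₗ x +ᵥ_) (*ₗ-identity _))
      -- Evaluate `f` on `ν = c x + c y`: the left side is 1 and the right side is `c² β x y`, which
      -- is `c` because `c` inverts `β x y`.
      c≡1 : c ≡ 1#
      c≡1 with eq ← trans (cong f (sym ν≡)) fν
        rewrite f-expand (x ∷ y ∷ []) (c ⊡ #0 ⊞ c ⊡ #1) | fx | fy =
        trans (trans (trans (sym (*-identityʳ c)) (cong (c *_) (sym xyc≡1)))
          (solve 2 (λ c b → c :* (b :* c) := c :* c :* :0 :+ c :* c :* :0 :+ c :* (c :* b)) refl c (β x y))) eq
      y≡ : y ≡ ν +ᵥ x
      y≡ = trans (by-coordinates (x ∷ y ∷ []) #1 (1# ⊡ #0 ⊞ 1# ⊡ #1 ⊞ #0)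
          λ { (a ∷ b ∷ []) → solve 2 (λ a b → b := :1 :* a :+ :1 :* b :+ a) refl a b })
        (cong (_+ᵥ x) (trans (cong (λ c → c *ₗ x +ᵥ c *ₗ y) (sym c≡1)) (sym ν≡)))

    -- Otherwise `a`, `b` and `x` would be a forbidden singular triple; `x` is independent of the
    -- other two because it alone is not orthogonal to `ν`.
    proportional : ∀ {x a b} → Affine x → f a ≡ 0# → f b ≡ 0# → a ⟂⟨ x , ν ⟩ → b ⟂⟨ x , ν ⟩ → b ⟂ a →
      a ≢ 0ᵥ → ∃[ s ] b ≡ s *ₗ a
    proportional {x} {a} {b} (fx , xν) fa fb (a⟂x , a⟂ν) (b⟂x , b⟂ν) b⟂a a≢0
      with anyScalar? (λ s → b ≟ᵥ s *ₗ a)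
    ... | yes found = found
    ... | no none = ⊥-elim (no-singular-triple fa fb fx b⟂a (⟂-sym a⟂x) (⟂-sym b⟂x) a≢0
      (λ s eq → none (s , eq))
      (λ s t eq → 0≢1 (trans (sym (trans (cong (λ v → β v ν) eq) (⟂-+ (⟂-* s b⟂ν) (⟂-* t a⟂ν)))) xν)))

  -- The radical of ⟨ν, x, y⟩, hence the point common to the sections of x and y
  -- when it is singular.
  touch : V → V → V
  touch x y = β x y *ₗ ν +ᵥ x +ᵥ y

  private
    touchᵉ : Carrier → Expr 3
    touchᵉ c = c ⊡ #0 ⊞ #1 ⊞ #2

  module _ {x y} (ax : Affine x) (ay : Affine y) where
    private
      fx = proj₁ ax
      fy = proj₁ ay
      xν = proj₂ ax
      yν = proj₂ ay

    touch⟂ν : touch x y ⟂ ν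
    touch⟂ν rewrite β-expandˡ (ν ∷ x ∷ y ∷ []) (touchᵉ (β x y)) ν | β-self ν | xν | yν =
      solve 1 (λ c → c :* :0 :+ :1 :+ :1 := :0) refl (β x y)

    touch⟂x : touch x y ⟂ x
    touch⟂x rewrite β-expandˡ (ν ∷ x ∷ y ∷ []) (touchᵉ (β x y)) x | β-comm ν x | xν | β-self x | β-comm y x =
      solve 1 (λ c → c :* :1 :+ :0 :+ c := :0) refl (β x y)

    touch⟂y : touch x y ⟂ y
    touch⟂y rewrite β-expandˡ (ν ∷ x ∷ y ∷ []) (touchᵉ (β x y)) y | β-comm ν y | yν | β-self y =
      solve 1 (λ c → c :* :1 :+ c :+ :0 := :0) refl (β x y)

    f-touch : f (touch x y) ≡ ℘ (β x y)
    f-touch rewrite f-expand (ν ∷ x ∷ y ∷ []) (touchᵉ (β x y)) | fx | fy | fν | β-comm ν x | β-comm ν y | xν | yν =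
      solve 1 (λ c → c :* c :* :1 :+ :0 :+ c :* :1 :+ :0 :+ (c :* :1 :+ c) := c :* c :+ c) refl (β x y)

    ⟂touch : ∀ {s} → s ⟂ ν → s ⟂ x → s ⟂ y → s ⟂ touch x y
    ⟂touch s⟂ν s⟂x s⟂y = ⟂-sym (⟂-+ (⟂-+ (⟂-* _ (⟂-sym s⟂ν)) (⟂-sym s⟂x)) (⟂-sym s⟂y))

    ⟂touch⇒⟂y : ∀ {s} → s ⟂ ν → s ⟂ x → s ⟂ touch x y → s ⟂ y
    ⟂touch⇒⟂y {s} s⟂ν s⟂x s⟂t rewrite β-expandʳ (ν ∷ x ∷ y ∷ []) (touchᵉ (β x y)) s | s⟂ν | s⟂x =
      trans (solve 2 (λ b c → b := c :* :0 :+ :0 :+ b) refl (β s y) (β x y)) s⟂t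

    touch≢0 : y ≢ x → y ≢ bar x → touch x y ≢ 0ᵥ
    touch≢0 y≢x y≢x̄ t≡0 with bar-cases {c = β x y} ax ay
      (trans (sym (u+v≡0⇒u≡v t≡0)) (+ᵥ-comm _ x))
    ... | inj₁ y≡x = y≢x y≡x
    ... | inj₂ y≡x̄ = y≢x̄ y≡x̄

    abstract
      -- The hypothesis on `℘` makes `touch x y` singular. A common singular vector `s` is
      -- orthogonal to it, since it is a combination of `ν`, `x` and `y`, and then `proportional`
      -- applies.
      touch-unique : ℘ (β x y) ≡ 0# → y ≢ x → y ≢ bar x →
        ∀ s → f s ≡ 0# → s ⟂ ν → s ⟂ x → s ⟂ y → ∃[ c ] s ≡ c *ₗ touch x y
      touch-unique ℘≡0 y≢x y≢x̄ s fs s⟂ν s⟂x s⟂y =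
        proportional ax (trans f-touch ℘≡0) fs (touch⟂x , touch⟂ν) (s⟂x , s⟂ν) (⟂touch s⟂ν s⟂x s⟂y) (touch≢0 y≢x y≢x̄)

      -- If touch x y is not singular, the space {ν, x, y}^⊥ is the orthogonal sum of it
      -- and a hyperbolic line.
      second-point : ℘ (β x y) ≢ 0# → ∀ s → f s ≡ 0# → s ≢ 0ᵥ → s ⟂ ν → s ⟂ x → s ⟂ y →
        ∃[ s′ ] f s′ ≡ 0# × s′ ⟂ ν × s′ ⟂ x × s′ ⟂ y × Pair s s′
      second-point ℘≢0 s fs s≢0 s⟂ν s⟂x s⟂y
        with g , (g⟂x , g⟂ν) , fg , sg ← singular-partner xν (s⟂x , s⟂ν) s≢0 fs = finish
          (partner-⟂ xν (r′⟂x , r′⟂ν) r′≢0)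
        where
        r r′ : V
        r = touch x y
        d : Carrier
        d = β g r
        r′ = r +ᵥ d *ₗ s
        s⟂r : s ⟂ r
        s⟂r = ⟂touch s⟂ν s⟂x s⟂y
        r′⟂x : r′ ⟂ x
        r′⟂x = ⟂-+ touch⟂x (⟂-* d s⟂x)
        r′⟂ν : r′ ⟂ ν
        r′⟂ν = ⟂-+ touch⟂ν (⟂-* d s⟂ν)
        r′⟂s : r′ ⟂ s
        r′⟂s = ⟂-+ (⟂-sym s⟂r) (⟂-* d (β-self s))
        r′⟂g : r′ ⟂ g
        r′⟂g rewrite β-expandˡ (r ∷ s ∷ []) (#0 ⊞ d ⊡ #1) g | sg | β-comm r g =
          solve 1 (λ d → d :+ d :* :1 := :0) refl d
        fr′ : f r′ ≡ ℘ (β x y)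
        fr′ rewrite f-expand (r ∷ s ∷ []) (#0 ⊞ d ⊡ #1) | fs | ⟂-sym s⟂r | f-touch =
          solve 2 (λ p d → p :+ d :* d :* :0 :+ d :* :0 := p) refl (℘ (β x y)) d
        r′≢0 : r′ ≢ 0ᵥ
        r′≢0 eq = ℘≢0 (trans (sym fr′) (trans (cong f eq) f-0))
        finish : ∃[ m ] m ⟂⟨ x , ν ⟩ × Pair r′ m →
          ∃[ s′ ] f s′ ≡ 0# × s′ ⟂ ν × s′ ⟂ x × s′ ⟂ y × Pair s s′
        finish (m₁ , (m₁⟂x , m₁⟂ν) , r′m₁) =
          singularize s w , f-singularize fs sw , ⟂-+ w⟂ν (⟂-* _ s⟂ν) , ⟂-+ w⟂x (⟂-* _ s⟂x) ,
          ⟂-+ (⟂touch⇒⟂y w⟂ν w⟂x w⟂r) (⟂-* _ s⟂y) , Pair-singularize sw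
          where
          m w : V
          m = project s g m₁
          -- `g` pairs with `s`, but `β g r = d`. Since `β m r = 1` and `β m s = 0`, adding `d m`
          -- gives orthogonality to `r`, hence to `y`, and keeps the product with `s`.
          w = g +ᵥ d *ₗ m
          m⟂s : m ⟂ s
          m⟂s = proj₁ (project-⟂ sg m₁)
          mr′ : β m r′ ≡ 1#
          mr′ = trans (project-β m₁ (r′⟂s , r′⟂g)) (trans (β-comm m₁ r′) r′m₁)
          mr : β m r ≡ 1#
          mr with eq ← mr′ rewrite β-expandʳ (r ∷ s ∷ []) (#0 ⊞ d ⊡ #1) m | m⟂s =
            trans (solve 2 (λ b d → b := b :+ d :* :0) refl (β m r) d) eq
          w⟂r : w ⟂ r
          w⟂r rewrite β-expandˡ (g ∷ m ∷ []) (#0 ⊞ d ⊡ #1) r | mr = solve 1 (λ d → d :+ d :* :1 := :0) refl d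
          w⟂x : w ⟂ x
          w⟂x = ⟂-+ g⟂x (⟂-* d (project-⟂-other m₁⟂x s⟂x g⟂x))
          w⟂ν : w ⟂ ν
          w⟂ν = ⟂-+ g⟂ν (⟂-* d (project-⟂-other m₁⟂ν s⟂ν g⟂ν))
          sw : Pair s w
          sw rewrite β-expandʳ (g ∷ m ∷ []) (#0 ⊞ d ⊡ #1) s | sg | ⟂-sym m⟂s =
            solve 1 (λ d → :1 :+ d :* :0 := :1) refl d

  -- The orthogonal complement of an elliptic 4-space S ⊆ ν^⊥ is a plane through ν; if it
  -- were anisotropic, then by ℘-index-two its sum with an anisotropic plane of S would
  -- contain a singular line, and V a singular plane.
  module Ovoid (S : Subspace 4) (S⟂ν : ∀ v → ⟦ S ⟧ v → v ⟂ ν) (ndS : NonDegenerate ⟦ S ⟧)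
    {e : V} (e∈S : ⟦ S ⟧ e) (fe : f e ≡ 0#) (e≢0 : e ≢ 0ᵥ)
    (witt₁ : ∀ b → ⟦ S ⟧ b → f b ≡ 0# → b ⟂ e → ∃[ c ] b ≡ c *ₗ e) where

    Apex : V → Set
    Apex x = Affine x × (∀ v → ⟦ S ⟧ v → v ⟂ x) × (∀ v → v ⟂ ν → v ⟂ x → ⟦ S ⟧ v)

    private
      -- `S` is the orthogonal sum of the pairs `e`, `g` and `u`, `v`, while `ν` and `t` span its
      -- complement in `V`. As `f (t + s ν) = f t + ℘ s`, an apex amounts to solving `℘ s = f t`.
      module Anisotropic {g u v t : V} (K : Subspace 2) (K₀ : Subspace 0)
        (C : Complement S e g K) (C₀ : Complement K u v K₀)
        (g∈S : ⟦ S ⟧ g) (u∈K : ⟦ K ⟧ u) (v∈K : ⟦ K ⟧ v)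
        (eg : Pair e g) (uv : Pair u v) (tν : Pair t ν)
        (t⟂₁ : t ⟂⟨ e , g ⟩) (t⟂₂ : t ⟂⟨ u , v ⟩) where

        u∈S : ⟦ S ⟧ u
        u∈S = proj₁ (proj₁ C u∈K)
        v∈S : ⟦ S ⟧ v
        v∈S = proj₁ (proj₁ C v∈K)
        u⟂₁ : u ⟂⟨ e , g ⟩
        u⟂₁ = proj₂ (proj₁ C u∈K)
        v⟂₁ : v ⟂⟨ e , g ⟩
        v⟂₁ = proj₂ (proj₁ C v∈K)

        twice : V → V
        twice w = project u v (project e g w)

        twice-β : ∀ w {z} → z ⟂⟨ e , g ⟩ → z ⟂⟨ u , v ⟩ → β (twice w) z ≡ β w z
        twice-β w z⟂₁ z⟂₂ = trans (project-β _ z⟂₂) (project-β w z⟂₁)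

        apex : ∃[ s ] ℘ s ≡ f t → ∃ Apex
        apex (s , ℘s≡ft) = x , (fx , xν) , S⟂x , into-S
          where
          x : V
          x = t +ᵥ s *ₗ ν
          fx : f x ≡ 0#
          fx rewrite f-expand (t ∷ ν ∷ []) (#0 ⊞ s ⊡ #1) | fν | tν | sym ℘s≡ft =
            solve 1 (λ s → s :* s :+ s :+ s :* s :* :1 :+ s :* :1 := :0) refl s
          xν : Pair x ν
          xν rewrite β-expandˡ (t ∷ ν ∷ []) (#0 ⊞ s ⊡ #1) ν | β-self ν | tν = solve 1 (λ s → :1 :+ s :* :0 := :1) refl s
          x⟂ : ∀ {w} → t ⟂ w → ⟦ S ⟧ w → x ⟂ w
          x⟂ t⟂w w∈S = ⟂-+ t⟂w (⟂-* s (⟂-sym (S⟂ν _ w∈S)))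
          x⟂₁ : x ⟂⟨ e , g ⟩
          x⟂₁ = x⟂ (proj₁ t⟂₁) e∈S , x⟂ (proj₂ t⟂₁) g∈S
          x⟂₂ : x ⟂⟨ u , v ⟩
          x⟂₂ = x⟂ (proj₁ t⟂₂) u∈S , x⟂ (proj₂ t⟂₂) v∈S
          S⟂x : ∀ w → ⟦ S ⟧ w → w ⟂ x
          S⟂x w w∈S = trans (sym (twice-β w x⟂₁ x⟂₂)) (trans (cong (λ w → β w x) w″≡0) (0⟂ x))
            where
            w′∈K : ⟦ K ⟧ (project e g w)
            w′∈K = proj₂ C (project-∈ S e∈S g∈S w∈S) (project-⟂ eg w)
            w″≡0 : twice w ≡ 0ᵥ
            w″≡0 = trivial-⟦⟧ K₀ (proj₂ C₀ (project-∈ K u∈K v∈K w′∈K) (project-⟂ uv _))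
          into-S : ∀ w → w ⟂ ν → w ⟂ x → ⟦ S ⟧ w
          into-S w w⟂ν w⟂x = project-∈⁻¹ S e∈S g∈S (project-∈⁻¹ S u∈S v∈S (subst ⟦ S ⟧ (sym w″≡0) (0-closed S)))
            where
            ν⟂₁ : ν ⟂⟨ e , g ⟩
            ν⟂₁ = ⟂-sym (S⟂ν e e∈S) , ⟂-sym (S⟂ν g g∈S)
            ν⟂₂ : ν ⟂⟨ u , v ⟩
            ν⟂₂ = ⟂-sym (S⟂ν u u∈S) , ⟂-sym (S⟂ν v v∈S)
            w′⟂₁ = project-⟂ eg w
            w″≡0 : twice w ≡ 0ᵥ
            w″≡0 = three-pairs eg uv xν u⟂₁ v⟂₁ x⟂₁ ν⟂₁ x⟂₂ ν⟂₂
              (project-⟂-other (proj₁ w′⟂₁) (proj₁ u⟂₁) (proj₁ v⟂₁) ,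
               project-⟂-other (proj₂ w′⟂₁) (proj₂ u⟂₁) (proj₂ v⟂₁))
              (project-⟂ uv _)
              (trans (twice-β w x⟂₁ x⟂₂) w⟂x , trans (twice-β w ν⟂₁ ν⟂₂) w⟂ν)

        fu≢0 : f u ≢ 0#
        fu≢0 fu≡0 with c , refl ← witt₁ u u∈S fu≡0 (proj₁ u⟂₁) =
          0≢1 (trans (sym (⟂-* c (⟂-sym (proj₁ v⟂₁)))) uv)

        -- Rescale so that `f u₁ = 1`. Then `f (v₁ + s u₁) = f v₁ + ℘ s` never vanishes, for a zero
        -- would be a singular vector orthogonal to `e` yet no multiple of it; so `f v₁` is not a
        -- value of `℘`. If `f t` were not one either, `f t + f v₁` would be some `℘ s`, and `e`,
        -- `u₁ + ν`, `t + v₁ + s ν` would form a forbidden singular triple.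
        solvable : ∃[ s ] ℘ s ≡ f t
        solvable with r , rr≡fu ← sqrt (f u) with ρ , rρ≡1 ← inverse r (λ r≡0 → fu≢0
          (trans (sym rr≡fu) (trans (cong (_* r) r≡0) (zeroˡ r)))) = decide
          (anyScalar? (λ s → ℘ s ≟ f t)) (anyScalar? (λ s → ℘ s ≟ f v₁))
          where
          u₁ v₁ : V
          u₁ = ρ *ₗ u
          v₁ = r *ₗ v
          fu₁ : f u₁ ≡ 1#
          fu₁ = trans (f-* ρ u) (trans (cong (ρ * ρ *_) (sym rr≡fu)) (trans
            (solve 2 (λ r ρ → ρ :* ρ :* (r :* r) := (r :* ρ) :* (r :* ρ)) refl r ρ)
            (trans (cong₂ _*_ rρ≡1 rρ≡1) (*-identityˡ 1#))))
          u₁v₁ : Pair u₁ v₁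
          u₁v₁ = trans (β-expand (u ∷ v ∷ []) (ρ ⊡ #0) (r ⊡ #1)) (trans
            (solve 3 (λ r ρ b → ρ :* (r :* b) := (r :* ρ) :* b) refl r ρ (β u v))
            (trans (cong₂ _*_ rρ≡1 uv) (*-identityˡ 1#)))
          u₁∈S : ⟦ S ⟧ u₁
          u₁∈S = *-closed S ρ u∈S
          v₁∈S : ⟦ S ⟧ v₁
          v₁∈S = *-closed S r v∈S
          u₁⟂e : u₁ ⟂ e
          u₁⟂e = ⟂-* ρ (proj₁ u⟂₁)
          v₁⟂e : v₁ ⟂ e
          v₁⟂e = ⟂-* r (proj₁ v⟂₁)
          t⟂u₁ : t ⟂ u₁
          t⟂u₁ = ⟂-sym (⟂-* ρ (⟂-sym (proj₁ t⟂₂)))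
          t⟂v₁ : t ⟂ v₁
          t⟂v₁ = ⟂-sym (⟂-* r (⟂-sym (proj₂ t⟂₂)))
          u₁⟂ν : u₁ ⟂ ν
          u₁⟂ν = S⟂ν u₁ u₁∈S
          v₁⟂ν : v₁ ⟂ ν
          v₁⟂ν = S⟂ν v₁ v₁∈S
          e⟂ν : e ⟂ ν
          e⟂ν = S⟂ν e e∈S

          anisotropic : ∀ s → ℘ s ≢ f v₁
          anisotropic s ℘s≡ =
            0≢1 (trans (sym (trans (cong (λ b → β b u₁) (proj₂ multiple)) (⟂-* _ (⟂-sym u₁⟂e)))) bu₁)
            where
            fb : f (v₁ +ᵥ s *ₗ u₁) ≡ 0#
            fb rewrite f-expand (v₁ ∷ u₁ ∷ []) (#0 ⊞ s ⊡ #1) | fu₁ | β-comm v₁ u₁ | u₁v₁ | sym ℘s≡ =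
              solve 1 (λ s → s :* s :+ s :+ s :* s :* :1 :+ s :* :1 := :0) refl s
            multiple : ∃[ c ] v₁ +ᵥ s *ₗ u₁ ≡ c *ₗ e
            multiple = witt₁ (v₁ +ᵥ s *ₗ u₁) (+-closed S v₁∈S (*-closed S s u₁∈S)) fb (⟂-+ v₁⟂e (⟂-* s u₁⟂e))
            bu₁ : β (v₁ +ᵥ s *ₗ u₁) u₁ ≡ 1#
            bu₁ rewrite β-expandˡ (v₁ ∷ u₁ ∷ []) (#0 ⊞ s ⊡ #1) u₁ | β-self u₁ | β-comm v₁ u₁ | u₁v₁ =
              solve 1 (λ s → :1 :+ s :* :0 := :1) refl s

          singular-plane : ∃[ s ] ℘ s ≡ f t + f v₁ → ⊥
          singular-plane (s , ℘s≡) = no-singular-triple fe fb fc b⟂e c⟂e c⟂b e≢0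
            (λ k eq → 0≢1 (trans (sym (trans (cong (λ w → β w v₁) eq) (⟂-* k (⟂-sym v₁⟂e)))) bv₁))
            (λ k l eq → 0≢1 (trans (sym (trans (cong (λ w → β w ν) eq) (⟂-+ (⟂-* k b⟂ν) (⟂-* l e⟂ν)))) cν))
            where
            b c : V
            b = u₁ +ᵥ ν
            c = t +ᵥ v₁ +ᵥ s *ₗ ν
            fb : f b ≡ 0#
            fb rewrite f-+ u₁ ν | fu₁ | fν | u₁⟂ν = solve 0 (:1 :+ :1 :+ :0 := :0) refl
            fc : f c ≡ 0#
            fc rewrite f-expand (t ∷ v₁ ∷ ν ∷ []) (#0 ⊞ #1 ⊞ s ⊡ #2) | fν | tν | t⟂v₁ | v₁⟂ν =
              trans (solve 3 (λ a b s → a :+ b :+ :0 :+ s :* s :* :1 :+ (s :* :1 :+ s :* :0) := a :+ b :+ (s :* s :+ s)) refl (f t) (f v₁) s)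
                (trans (cong (f t + f v₁ +_) ℘s≡) (x+x≡0 _))
            b⟂e : b ⟂ e
            b⟂e = ⟂-+ u₁⟂e (⟂-sym e⟂ν)
            b⟂ν : b ⟂ ν
            b⟂ν = ⟂-+ u₁⟂ν (β-self ν)
            c⟂e : c ⟂ e
            c⟂e = ⟂-+ (⟂-+ (proj₁ t⟂₁) v₁⟂e) (⟂-* s (⟂-sym e⟂ν))
            c⟂b : c ⟂ b
            c⟂b rewrite β-expandˡ (t ∷ v₁ ∷ ν ∷ []) (#0 ⊞ #1 ⊞ s ⊡ #2) b
              | β-expandʳ (u₁ ∷ ν ∷ []) (#0 ⊞ #1) t | β-expandʳ (u₁ ∷ ν ∷ []) (#0 ⊞ #1) v₁
              | β-expandʳ (u₁ ∷ ν ∷ []) (#0 ⊞ #1) ν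
              | t⟂u₁ | tν | β-comm v₁ u₁ | u₁v₁ | v₁⟂ν | β-comm ν u₁ | u₁⟂ν | β-self ν =
              solve 1 (λ s → :0 :+ :1 :+ (:1 :+ :0) :+ s :* (:0 :+ :0) := :0) refl s
            bv₁ : β b v₁ ≡ 1#
            bv₁ rewrite β-+ u₁ ν v₁ | u₁v₁ | β-comm ν v₁ | v₁⟂ν = +-identityʳ 1#
            cν : β c ν ≡ 1#
            cν rewrite β-expandˡ (t ∷ v₁ ∷ ν ∷ []) (#0 ⊞ #1 ⊞ s ⊡ #2) ν | tν | v₁⟂ν | β-self ν =
              solve 1 (λ s → :1 :+ :0 :+ s :* :0 := :1) refl s

          decide : Dec (∃[ s ] ℘ s ≡ f t) → Dec (∃[ s ] ℘ s ≡ f v₁) → ∃[ s ] ℘ s ≡ f t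
          decide (yes found) _           = found
          decide (no _) (yes (s , ℘s≡))  = contradiction ℘s≡ (anisotropic s)
          decide (no t∉) (no v₁∉)        = ⊥-elim (singular-plane (℘-index-two t∉ v₁∉))

      choose : ∀ {g u v t₀} (K : Subspace 2) (K₀ : Subspace 0) →
        Complement S e g K → Complement K u v K₀ → ⟦ S ⟧ g → ⟦ K ⟧ u → ⟦ K ⟧ v →
        Pair e g → Pair u v → Pair ν t₀ → ∃ Apex
      choose {g} {u} {v} {t₀} K K₀ C C₀ g∈S u∈K v∈K eg uv νt₀ = apex solvable
        where
        t₁ t : V
        t₁ = project e g t₀
        t  = project u v t₁
        u∈S : ⟦ S ⟧ u
        u∈S = proj₁ (proj₁ C u∈K)
        v∈S : ⟦ S ⟧ v
        v∈S = proj₁ (proj₁ C v∈K)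
        u⟂ : u ⟂⟨ e , g ⟩
        u⟂ = proj₂ (proj₁ C u∈K)
        v⟂ : v ⟂⟨ e , g ⟩
        v⟂ = proj₂ (proj₁ C v∈K)
        t₁⟂ : t₁ ⟂⟨ e , g ⟩
        t₁⟂ = project-⟂ eg t₀
        ⟂ν : ∀ {w} → ⟦ S ⟧ w → ν ⟂ w
        ⟂ν w∈S = ⟂-sym (S⟂ν _ w∈S)
        tν : Pair t ν
        tν = trans (project-β t₁ (⟂ν u∈S , ⟂ν v∈S))
          (trans (project-β t₀ (⟂ν e∈S , ⟂ν g∈S)) (trans (β-comm t₀ ν) νt₀))
        t⟂₁ : t ⟂⟨ e , g ⟩
        t⟂₁ = project-⟂-other (proj₁ t₁⟂) (proj₁ u⟂) (proj₁ v⟂) , project-⟂-other (proj₂ t₁⟂) (proj₂ u⟂) (proj₂ v⟂)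
        open Anisotropic {t = t} K K₀ C C₀ g∈S u∈K v∈K eg uv tν t⟂₁ (project-⟂ uv t₁) using (apex; solvable)

    abstract
      ovoid-apex : ∃ Apex
      ovoid-apex with anyVector? (λ w → (w ∈? S) ×-dec ¬? (β e w ≟ 0#))
      ... | no none = contradiction (ndS e e∈S (λ w w∈S → ⟂-sym (decidable-stable (β e w ≟ 0#)
              (λ ew≢0 → none (w , w∈S , ew≢0)))) fe) e≢0
      ... | yes (w , w∈S , ew≢0)
        with c , ecw ← scale-pair ew≢0
        with eg ← Pair-singularize ecw
        with g∈S ← +-closed S (*-closed S c w∈S) (*-closed S (f (c *ₗ w)) e∈S)
        with K , C ← complement S eg e∈S g∈S
        with u , v , u∈K , v∈K , uv ← hyperbolic-pair ndS K (λ _ w∈K → proj₁ (proj₁ C w∈K))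
               (complement-radical S eg e∈S g∈S K C)
        with K₀ , C₀ ← complement K uv u∈K v∈K
        with t₀ , νt₀ ← partner ν≢0
        = choose K K₀ C C₀ g∈S u∈K v∈K eg uv νt₀

-- The given form as an instance of the abstract elliptic form.

module Ambient {n : ℕ} (𝔽 : FiniteField (2 ^ n)) (𝑓 : Space.QuadraticForm 𝔽)
  (elliptic : Space.Form.Elliptic₅ 𝔽 𝑓) where
  open LinearAlgebra {n} 𝔽
  open Form 𝑓

  polarizedForm : PolarizedForm
  polarizedForm = record
    { f      = f
    ; β      = β
    ; f-+    = λ u v → solve 3 (λ s a b → s := a :+ b :+ (s :- a :- b)) refl (f (u +ᵥ v)) (f u) (f v)
    ; f-*    = QuadraticForm.homogeneous 𝑓
    ; β-+    = QuadraticForm.polar-+ˡ 𝑓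
    ; β-*    = QuadraticForm.polar-*ˡ 𝑓
    ; β-comm = λ u v → trans (cong (λ w → f w - f u - f v) (+ᵥ-comm u v))
        (solve 3 (λ s a b → s :- a :- b := s :- b :- a) refl (f (v +ᵥ u)) (f u) (f v))
    }

  ellipticForm : EllipticForm
  ellipticForm = record
    { polarizedForm = polarizedForm
    ; nd            = Quadratic.polar-nondegenerate {n} 𝔽 polarizedForm (proj₁ elliptic)
    ; witt          = λ W fW → WittIndexOn.maximal (proj₂ elliptic) W (λ _ → _) fW
    }

-- Points of the geometry as normalized singular vectors.

module Model {n : ℕ} (𝔽 : FiniteField (2 ^ n))
  (𝑓 : Space.QuadraticForm 𝔽) (H₀ : Space.Subspace 𝔽 5)
  (elliptic : Space.Form.Elliptic₅ 𝔽 𝑓) (parabolic : Space.Form.Parabolic₄ 𝔽 𝑓 H₀)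
  (ν : Space.V 𝔽) (fν : Space.QuadraticForm.form 𝑓 ν ≡ FiniteField.1# 𝔽)
  (H₀⟂ν : ∀ v → Space.⟦_⟧ 𝔽 H₀ v → Space.Form.β 𝔽 𝑓 v ν ≡ FiniteField.0# 𝔽)
  (⟂ν⇒∈H₀ : ∀ v → Space.Form.β 𝔽 𝑓 v ν ≡ FiniteField.0# 𝔽 → Space.⟦_⟧ 𝔽 H₀ v)
  where
  open LinearAlgebra {n} 𝔽
  open Form 𝑓
  open Geometry 𝑓 H₀
  open Ambient {n} 𝔽 𝑓 elliptic
  open EllipticForm ellipticForm using (nd; witt; f-+; β-+; β-*; β-comm)
  open Quadratic {n} 𝔽 polarizedForm
  open Elliptic {n} 𝔽 ellipticForm
  private
    L = WittIndexOn.attained (proj₂ parabolic)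
  open AffineQuadric {n} 𝔽 ellipticForm ν fν (proj₁ L) (proj₂ (proj₂ L))
    (λ v v∈L → H₀⟂ν v (proj₁ (proj₂ L) v∈L))

  ν∈H₀ : ⟦ H₀ ⟧ ν
  ν∈H₀ = ⟂ν⇒∈H₀ ν (β-self ν)

  gen : Point → V
  gen p = head (Subspace.basis p)

  abstract
    ∈⇒multiple : ∀ (p : Point) {v} → ⟦ p ⟧ v → ∃[ c ] v ≡ c *ₗ gen p
    ∈⇒multiple record { basis = g ∷ [] } (c ∷ [] , eq) = c , trans eq (+ᵥ-identityʳ _)

  abstract
    multiple⇒∈ : ∀ (p : Point) c → ⟦ p ⟧ (c *ₗ gen p)
    multiple⇒∈ record { basis = g ∷ [] } c = c ∷ [] , sym (+ᵥ-identityʳ _)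

  abstract
    gen-∈ : ∀ (p : Point) → ⟦ p ⟧ (gen p)
    gen-∈ p = subst ⟦ p ⟧ (*ₗ-identity _) (multiple⇒∈ p 1#)

  abstract
    gen≢0 : ∀ (p : Point) → gen p ≢ 0ᵥ
    gen≢0 record { basis = g ∷ [] ; independent = indep } g≡0 =
      0≢1 (sym (cong head (indep (1# ∷ []) (trans (+ᵥ-identityʳ _) (trans (*ₗ-identity g) g≡0)))))

  point : ∀ v → v ≢ 0ᵥ → Point
  point v v≢0 = extend trivial v (∉trivial v≢0)

  abstract
    ≐-points : ∀ (p : Point) {v} (v≢0 : v ≢ 0ᵥ) → ⟦ p ⟧ v → ⟦ p ⟧ ≐ ⟦ point v v≢0 ⟧
    ≐-points p {v} v≢0 v∈p with c , v≡cg ← ∈⇒multiple p v∈p =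
      into , λ w∈ → let a , w≡av = ∈⇒multiple (point v v≢0) w∈ in subst ⟦ p ⟧ (sym w≡av) (*-closed p a v∈p)
      where
      c≢0 : c ≢ 0#
      c≢0 c≡0 = v≢0 (trans v≡cg (trans (cong (_*ₗ gen p) c≡0) (*ₗ-zeroˡ _)))
      into : ∀ {w} → ⟦ p ⟧ w → ⟦ point v v≢0 ⟧ w
      into {w} w∈p with a , w≡ag ← ∈⇒multiple p w∈p | d , cd≡1 ← inverse c c≢0 =
        subst ⟦ point v v≢0 ⟧ (begin
          (a * d) *ₗ v             ≡⟨ cong ((a * d) *ₗ_) v≡cg ⟩
          (a * d) *ₗ c *ₗ gen p    ≡⟨ *ₗ-assoc _ _ _ ⟩
          (a * d * c) *ₗ gen p     ≡⟨ cong (_*ₗ gen p) (solve 3 (λ a c d → a :* d :* c := a :* (c :* d)) refl a c d) ⟩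
          (a * (c * d)) *ₗ gen p   ≡⟨ cong (_*ₗ gen p) (trans (cong (a *_) cd≡1) (*-identityʳ a)) ⟩
          a *ₗ gen p               ≡⟨ w≡ag ⟨
          w                        ∎)
          (multiple⇒∈ (point v v≢0) (a * d))
        where open ≡-Reasoning

  abstract
    Q₀-elim : ∀ p → Q₀ p → ∀ {v} → ⟦ p ⟧ v → f v ≡ 0# × v ⟂ ν
    Q₀-elim p (Qp , p⊆H₀) v∈p = Qp _ v∈p , H₀⟂ν _ (p⊆H₀ v∈p)

  abstract
    Q-intro : ∀ p → f (gen p) ≡ 0# → Q p
    Q-intro p fp v v∈p with c , refl ← ∈⇒multiple p v∈p = f-*-singular c fp

  abstract
    Q₀-intro : ∀ p → f (gen p) ≡ 0# → gen p ⟂ ν → Q₀ p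
    Q₀-intro p fp p⟂ν = Q-intro p fp , λ v∈p → let c , v≡cp = ∈⇒multiple p v∈p in
      subst ⟦ H₀ ⟧ (sym v≡cp) (*-closed H₀ c (⟂ν⇒∈H₀ _ p⟂ν))

  private
    genν≢0 : ∀ (x : X̂Point) → β (gen (proj₁ x)) ν ≢ 0#
    genν≢0 (p , Qp , ∉Q₀) p⟂ν = ∉Q₀ (Q₀-intro p (Qp _ (gen-∈ p)) p⟂ν)

    scale : X̂Point → Carrier
    scale x = proj₁ (inverse _ (genν≢0 x))

  abstract
    vec : X̂Point → V
    vec x = scale x *ₗ gen (proj₁ x)

    vec-∈ : ∀ x → ⟦ proj₁ x ⟧ (vec x)
    vec-∈ x = multiple⇒∈ (proj₁ x) (scale x)

    vec-affine : ∀ x → Affine (vec x)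
    vec-affine x = proj₁ (proj₂ x) _ (vec-∈ x) ,
      trans (β-* _ _ ν) (trans (*-comm _ _) (proj₂ (inverse _ (genν≢0 x))))

  affine≢0 : ∀ {v} → Affine v → v ≢ 0ᵥ
  affine≢0 (_ , vν) refl = 0≢1 (trans (sym (0⟂ ν)) vν)

  abstract
    vec-≐ : ∀ x → ⟦ proj₁ x ⟧ ≐ ⟦ point (vec x) (affine≢0 (vec-affine x)) ⟧
    vec-≐ x = ≐-points (proj₁ x) (affine≢0 (vec-affine x)) (vec-∈ x)

  abstract
    vec-multiple : ∀ x {v} → ⟦ proj₁ x ⟧ v → ∃[ c ] v ≡ c *ₗ vec x
    vec-multiple x v∈x = ∈⇒multiple (point _ (affine≢0 (vec-affine x))) (proj₁ (vec-≐ x) v∈x)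

  open Setoid x̂points public using () renaming (_≈_ to _≈̂_; refl to ≈̂-refl; sym to ≈̂-sym; trans to ≈̂-trans)

  abstract
    affine-∈ : ∀ x {v} → ⟦ proj₁ x ⟧ v → Affine v → v ≡ vec x
    affine-∈ x {v} v∈x (_ , vν) = let c , v≡cx = vec-multiple x v∈x in
      trans v≡cx (trans (cong (_*ₗ vec x) (begin
        c                 ≡⟨ *-identityʳ c ⟨
        c * 1#            ≡⟨ cong (c *_) (proj₂ (vec-affine x)) ⟨
        c * β (vec x) ν   ≡⟨ β-* c (vec x) ν ⟨
        β (c *ₗ vec x) ν  ≡⟨ cong (λ w → β w ν) v≡cx ⟨
        β v ν             ≡⟨ vν ⟩
        1#                ∎)) (*ₗ-identity _))
      where open ≡-Reasoning

  abstract
    vec-cong : ∀ {x y} → x ≈̂ y → vec x ≡ vec y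
    vec-cong {x} {y} (x⊆y , _) = affine-∈ y (x⊆y (vec-∈ x)) (vec-affine x)

  abstract
    vec-injective : ∀ {x y} → vec x ≡ vec y → x ≈̂ y
    vec-injective {x} {y} eq = within x y eq , within y x (sym eq)
      where
      within : ∀ x y → vec x ≡ vec y → ⟦ proj₁ x ⟧ ⊆ ⟦ proj₁ y ⟧
      within x y eq v∈x = let c , v≡cx = vec-multiple x v∈x in
        subst ⟦ proj₁ y ⟧ (sym v≡cx) (*-closed (proj₁ y) c {vec x} (subst ⟦ proj₁ y ⟧ (sym eq) (vec-∈ y)))

  abstract
    fromAffine : ∀ v → Affine v → X̂Point
    fromAffine v av@(fv , vν) = p , Q-intro p fv , λ p∈Q₀ →
      0≢1 (trans (sym (proj₂ (Q₀-elim p p∈Q₀ (gen-∈ p)))) vν)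
      where
      p : Point
      p = point v (affine≢0 av)

    vec-fromAffine : ∀ v (av : Affine v) → vec (fromAffine v av) ≡ v
    vec-fromAffine v av = sym (affine-∈ (fromAffine v av) (gen-∈ (proj₁ (fromAffine v av))) av)

  -- The sections `φ₀ x` and the elliptic ovoids.

  abstract
    φ₀-elim : ∀ x p → φ₀ x p → ∀ {v} → ⟦ p ⟧ v → f v ≡ 0# × v ⟂ ν × v ⟂ vec x
    φ₀-elim x p (p⊆x⊥ , p∈Q₀) v∈p = let fv , v⟂ν = Q₀-elim p p∈Q₀ v∈p in
      fv , v⟂ν , ⟂-sym (p⊆x⊥ v∈p _ (vec-∈ x))

  abstract
    φ₀-intro : ∀ x p → f (gen p) ≡ 0# → gen p ⟂ ν → gen p ⟂ vec x → φ₀ x p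
    φ₀-intro x p fp p⟂ν p⟂x = orthogonal , Q₀-intro p fp p⟂ν
      where
      orthogonal : ∀ {v} → ⟦ p ⟧ v → ∀ u → ⟦ proj₁ x ⟧ u → β u v ≡ 0#
      orthogonal {v} v∈p u u∈x = let c , v≡cp = ∈⇒multiple p v∈p ; d , u≡dx = vec-multiple x u∈x in
        subst (_⟂ v) (sym u≡dx) (⟂-* d {vec x} (subst (vec x ⟂_) (sym v≡cp) (⟂-sym (⟂-* c {gen p} p⟂x))))

  abstract
    φ₀-⊆ : ∀ x y → (∀ s → s ⟂ ν → s ⟂ vec x → s ⟂ vec y) → φ₀ x ⊆ φ₀ y
    φ₀-⊆ x y imp {p} p∈x = let fp , p⟂ν , p⟂x = φ₀-elim x p p∈x (gen-∈ p) in
      φ₀-intro y p fp p⟂ν (imp _ p⟂ν p⟂x)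

  abstract
    φ₀-cong : ∀ {x y} → vec x ≡ vec y → φ₀ x ≐ φ₀ y
    φ₀-cong {x} {y} eq = (λ {p} → φ₀-⊆ x y (λ s _ → subst (s ⟂_) eq) {p}) ,
                         (λ {p} → φ₀-⊆ y x (λ s _ → subst (s ⟂_) (sym eq)) {p})

  abstract
    -- Adding `ν` to a vector does not change its products with vectors orthogonal to `ν`.
    φ₀-bar : ∀ {x y} → vec y ≡ bar (vec x) → φ₀ y ≐ φ₀ x
    φ₀-bar {x} {y} eq =
      (λ {p} → φ₀-⊆ y x (λ s s⟂ν s⟂y →
        ⟂-sym (subst (_⟂ s) (trans (cong bar eq) (bar-bar (vec x))) (shift s⟂ν s⟂y))) {p}) ,
      (λ {p} → φ₀-⊆ x y (λ s s⟂ν s⟂x → ⟂-sym (subst (_⟂ s) (sym eq) (shift s⟂ν s⟂x))) {p})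
      where
      shift : ∀ {s v} → s ⟂ ν → s ⟂ v → bar v ⟂ s
      shift s⟂ν s⟂v = ⟂-+ (⟂-sym s⟂v) (⟂-sym s⟂ν)

  abstract
    φ₀-injective : ∀ {x y} → φ₀ x ≐ φ₀ y → vec y ≡ vec x ⊎ vec y ≡ bar (vec x)
    φ₀-injective {x} {y} (x⊆y , _) = same-section (vec-affine x) (vec-affine y) section
      where
      section : ∀ s → f s ≡ 0# → s ⟂⟨ vec x , ν ⟩ → s ⟂ vec y
      section s fs (s⟂x , s⟂ν) with s ≟ᵥ 0ᵥ
      ... | yes refl = 0⟂ _
      ... | no s≢0   = proj₂ (proj₂ (φ₀-elim y (point s s≢0) (x⊆y {point s s≢0} (φ₀-intro x (point s s≢0) fs s⟂ν s⟂x)) (gen-∈ (point s s≢0))))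

  abstract
    -- Here `S` is the complement of the hyperbolic pair `x`, `ν`, hence non-degenerate. A totally
    -- singular subspace of `S` is enlarged by `x`, which is singular, orthogonal to it and outside
    -- `H₀`, so its dimension is at most one less than 2.
    φ₀-section : ∀ x (S : Subspace 4) → (∀ {v} → ⟦ S ⟧ v → ⟦ H₀ ⟧ v × v ⟂ vec x) →
      (∀ {v} → ⟦ H₀ ⟧ v → v ⟂ vec x → ⟦ S ⟧ v) → IsEllipticOvoid (φ₀ x)
    φ₀-section x S into from = record
      { S        = S
      ; S⊆H₀     = λ v∈S → proj₁ (into v∈S)
      ; elliptic = nondegenerate , record { attained = attained (singular-⟂ (vec-affine x)) ; maximal = maximal }
      ; section  =
          (λ {p} p∈ → (λ v∈p → let _ , v⟂ν , v⟂x = φ₀-elim x p p∈ v∈p in from (⟂ν⇒∈H₀ _ v⟂ν) v⟂x) , proj₂ p∈) ,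
          (λ {p} (p⊆S , p∈Q₀) → let fp , p⟂ν = Q₀-elim p p∈Q₀ (gen-∈ p) in
            φ₀-intro x p fp p⟂ν (proj₂ (into (p⊆S (gen-∈ p)))))
      }
      where
      fx : f (vec x) ≡ 0#
      fx = proj₁ (vec-affine x)
      xν : Pair (vec x) ν
      xν = proj₂ (vec-affine x)
      nondegenerate : NonDegenerateOn ⟦ S ⟧
      nondegenerate v v∈S v⟂S _ = nd v λ u →
        trans (sym (project-β u {v} (proj₂ (into v∈S) , H₀⟂ν v (proj₁ (into v∈S)))))
          (v⟂S _ (from (⟂ν⇒∈H₀ _ (proj₂ (project-⟂ xν u))) (proj₁ (project-⟂ xν u))))
      attained : ∃[ e ] f e ≡ 0# × e ≢ 0ᵥ × e ⟂⟨ vec x , ν ⟩ →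
                 Σ[ W ∈ Subspace 1 ] ⟦ W ⟧ ⊆ ⟦ S ⟧ × TotallySingular ⟦ W ⟧
      attained (e , fe , e≢0 , e⟂x , e⟂ν) = point e e≢0 ,
        (λ v∈p → let c , v≡ce = ∈⇒multiple (point e e≢0) v∈p in
          subst ⟦ S ⟧ (sym v≡ce) (*-closed S c {e} (from (⟂ν⇒∈H₀ e e⟂ν) e⟂x))) ,
        Q-intro (point e e≢0) fe
      maximal : ∀ {d} (W : Subspace d) → ⟦ W ⟧ ⊆ ⟦ S ⟧ → TotallySingular ⟦ W ⟧ → d ≤ 1
      maximal W W⊆S fW = ℕ.≤-pred (witt (extend W (vec x) x∉W)
        (extend-singular W x∉W fW fx (λ v v∈W → ⟂-sym (proj₂ (into (W⊆S v∈W))))))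
        where
        x∉W : ¬ ⟦ W ⟧ (vec x)
        x∉W x∈W = 0≢1 (trans (sym (H₀⟂ν _ (proj₁ (into (W⊆S x∈W))))) xν)

    φ₀-ovoid : ∀ x → IsEllipticOvoid (φ₀ x)
    φ₀-ovoid x = φ₀-section x (proj₁ K) (proj₁ (proj₂ K)) (proj₂ (proj₂ K))
      where
      ν⟂̸x : β ν (vec x) ≢ 0#
      ν⟂̸x ν⟂x = 0≢1 (trans (sym (⟂-sym ν⟂x)) (proj₂ (vec-affine x)))
      K : Σ[ S ∈ Subspace 4 ] ((∀ {v} → ⟦ S ⟧ v → ⟦ H₀ ⟧ v × v ⟂ vec x) ×
                               (∀ {v} → ⟦ H₀ ⟧ v → v ⟂ vec x → ⟦ S ⟧ v))
      K = Functional.kernel (λ v → β v (vec x)) (λ u v → β-+ u v (vec x)) (λ c v → β-* c v (vec x))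
            H₀ (ν , ν∈H₀ , ν⟂̸x)

  abstract
    -- Witt index 1 of `S` supplies both inputs of `Ovoid`: a singular point, and the fact that no
    -- singular vector of `S` orthogonal to that point lies outside it.
    φ₀-surjective : ∀ O → IsEllipticOvoid O → ∃[ x ] O ≐ φ₀ x
    φ₀-surjective O ovoid = from-apex (Ovoid.ovoid-apex S (λ v v∈S → H₀⟂ν v (IsEllipticOvoid.S⊆H₀ ovoid v∈S))
        ndS (W⊆S (gen-∈ W)) (fW _ (gen-∈ W)) (gen≢0 W) λ b b∈S fb b⟂e → witt₁ b b∈S fb b⟂e (b ∈? W))
      where
      S : Subspace 4
      S = IsEllipticOvoid.S ovoid
      O⊆ : O ⊆ pointsOf ⟦ S ⟧ ∩ Q₀
      O⊆ = proj₁ (IsEllipticOvoid.section ovoid)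
      ⊆O : pointsOf ⟦ S ⟧ ∩ Q₀ ⊆ O
      ⊆O = proj₂ (IsEllipticOvoid.section ovoid)
      ndS : NonDegenerateOn ⟦ S ⟧
      ndS = proj₁ (IsEllipticOvoid.elliptic ovoid)
      wittS : WittIndexOn ⟦ S ⟧ 1
      wittS = proj₂ (IsEllipticOvoid.elliptic ovoid)
      W : Subspace 1
      W = proj₁ (WittIndexOn.attained wittS)
      W⊆S : ⟦ W ⟧ ⊆ ⟦ S ⟧
      W⊆S = proj₁ (proj₂ (WittIndexOn.attained wittS))
      fW : TotallySingular ⟦ W ⟧
      fW = proj₂ (proj₂ (WittIndexOn.attained wittS))
      witt₁ : ∀ b → ⟦ S ⟧ b → f b ≡ 0# → b ⟂ gen W → Dec (⟦ W ⟧ b) → ∃[ c ] b ≡ c *ₗ gen W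
      witt₁ b b∈S fb b⟂e (yes b∈W) = ∈⇒multiple W b∈W
      witt₁ b b∈S fb b⟂e (no b∉W)  = contradiction (WittIndexOn.maximal wittS (extend W b b∉W) W₂⊆S
        (extend-singular W b∉W fW fb b⟂W)) ℕ.1+n≰n
        where
        b⟂W : ∀ v → ⟦ W ⟧ v → b ⟂ v
        b⟂W v v∈W = let c , v≡ce = ∈⇒multiple W v∈W in
          subst (b ⟂_) (sym v≡ce) (⟂-sym (⟂-* c {gen W} (⟂-sym b⟂e)))
        W₂⊆S : ⟦ extend W b b∉W ⟧ ⊆ ⟦ S ⟧
        W₂⊆S (a ∷ as , eq) = subst ⟦ S ⟧ (sym eq) (+-closed S (*-closed S a {b} b∈S) (W⊆S (as , refl)))
      from-apex : (∃[ v ] Affine v × (∀ w → ⟦ S ⟧ w → w ⟂ v) × (∀ w → w ⟂ ν → w ⟂ v → ⟦ S ⟧ w)) → ∃[ x ] O ≐ φ₀ x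
      from-apex (v , av , S⟂v , ⟂v⇒∈S) = x , into , from
        where
        x : X̂Point
        x = fromAffine v av
        vec≡ : vec x ≡ v
        vec≡ = vec-fromAffine v av
        into : O ⊆ φ₀ x
        into {p} p∈O = let p⊆S , p∈Q₀ = O⊆ p∈O ; fp , p⟂ν = Q₀-elim p p∈Q₀ (gen-∈ p) in
          φ₀-intro x p fp p⟂ν (subst (gen p ⟂_) (sym vec≡) (S⟂v _ (p⊆S (gen-∈ p))))
        from : φ₀ x ⊆ O
        from {p} p∈φx = ⊆O ((λ v∈p → let _ , v⟂ν , v⟂x = φ₀-elim x p p∈φx v∈p in
          ⟂v⇒∈S _ v⟂ν (subst (_ ⟂_) vec≡ v⟂x)) , proj₂ p∈φx)

  φ₀-resp : ∀ x {p q} → ⟦ p ⟧ ≐ ⟦ q ⟧ → φ₀ x p → φ₀ x q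
  φ₀-resp x {p} {q} (_ , q⊆p) p∈x = let fq , q⟂ν , q⟂x = φ₀-elim x p p∈x (q⊆p (gen-∈ q)) in
    φ₀-intro x q fq q⟂ν q⟂x

  ∈-points : ∀ (p q : Point) → ⟦ q ⟧ (gen p) → ⟦ p ⟧ ≐ ⟦ q ⟧
  ∈-points p q p∈q = ≐-trans (≐-points p (gen≢0 p) (gen-∈ p)) (≐-sym (≐-points q (gen≢0 p) p∈q))

  -- Tangency, collinearity and the center in terms of `β`.

  abstract
    meet-in-touch : ∀ x y → ℘ (β (vec x) (vec y)) ≡ 0# → vec y ≢ vec x → vec y ≢ bar (vec x) →
      (r≢0 : touch (vec x) (vec y) ≢ 0ᵥ) → MeetExactlyIn (point (touch (vec x) (vec y)) r≢0) (φ₀ x) (φ₀ y)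
    meet-in-touch x y ℘≡0 y≢x y≢x̄ r≢0 = (λ {q} → into {q}) , (λ {q} → from {q})
      where
      ax : Affine (vec x)
      ax = vec-affine x
      ay : Affine (vec y)
      ay = vec-affine y
      r : Point
      r = point (touch (vec x) (vec y)) r≢0
      r∈x : φ₀ x r
      r∈x = φ₀-intro x r (trans (f-touch ax ay) ℘≡0) (touch⟂ν ax ay) (touch⟂x ax ay)
      r∈y : φ₀ y r
      r∈y = φ₀-intro y r (trans (f-touch ax ay) ℘≡0) (touch⟂ν ax ay) (touch⟂y ax ay)
      into : φ₀ x ∩ φ₀ y ⊆ Sets.｛_｝ points r
      into {q} (q∈x , q∈y) = ∈-points q r (subst ⟦ r ⟧ (sym (proj₂ multiple)) (multiple⇒∈ r (proj₁ multiple)))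
        where
        q-x : f (gen q) ≡ 0# × gen q ⟂ ν × gen q ⟂ vec x
        q-x = φ₀-elim x q q∈x (gen-∈ q)
        multiple : ∃[ c ] gen q ≡ c *ₗ touch (vec x) (vec y)
        multiple = touch-unique ax ay ℘≡0 y≢x y≢x̄ (gen q) (proj₁ q-x) (proj₁ (proj₂ q-x)) (proj₂ (proj₂ q-x))
          (proj₂ (proj₂ (φ₀-elim y q q∈y (gen-∈ q))))
      from : Sets.｛_｝ points r ⊆ φ₀ x ∩ φ₀ y
      from {q} q≈r = φ₀-resp x {r} {q} (≐-sym q≈r) r∈x , φ₀-resp y {r} {q} (≐-sym q≈r) r∈y

    -- If `℘` did not vanish, `second-point` would produce a common point not orthogonal to `p`,
    -- whereas every multiple of the singular generator of `p` is orthogonal to it.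
    tangent⇒℘≡0 : ∀ x y p → MeetExactlyIn p (φ₀ x) (φ₀ y) → ℘ (β (vec x) (vec y)) ≡ 0#
    tangent⇒℘≡0 x y p (into , from) = decidable-stable (_ ≟ 0#) λ ℘≢0 →
      contradict (second-point (vec-affine x) (vec-affine y) ℘≢0 (gen p) (proj₁ p-x) (gen≢0 p)
        (proj₁ (proj₂ p-x)) (proj₂ (proj₂ p-x)) (proj₂ (proj₂ (φ₀-elim y p (proj₂ p∈xy) (gen-∈ p)))))
      where
      p∈xy : φ₀ x p × φ₀ y p
      p∈xy = from {p} ≐-refl
      p-x : f (gen p) ≡ 0# × gen p ⟂ ν × gen p ⟂ vec x
      p-x = φ₀-elim x p (proj₁ p∈xy) (gen-∈ p)
      contradict : ¬ (∃[ s ] f s ≡ 0# × s ⟂ ν × s ⟂ vec x × s ⟂ vec y × Pair (gen p) s)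
      contradict (s , fs , s⟂ν , s⟂x , s⟂y , ps) = 0≢1 (trans (sym (⟂-sym
        (subst (_⟂ gen p) (sym (proj₂ multiple)) (⟂-* (proj₁ multiple) {gen p} (β-self (gen p)))))) ps)
        where
        s≢0 : s ≢ 0ᵥ
        s≢0 s≡0 = 0≢1 (trans (sym (⟂-sym (subst (_⟂ gen p) (sym s≡0) (0⟂ (gen p))))) ps)
        q : Point
        q = point s s≢0
        multiple : ∃[ c ] s ≡ c *ₗ gen p
        multiple = ∈⇒multiple p (proj₁ (into {q} (φ₀-intro x q fs s⟂ν s⟂x , φ₀-intro y q fs s⟂ν s⟂y)) (gen-∈ q))

    collinear⇒ : ∀ x y → Collinear x y → vec x ≢ vec y × vec x ⟂ vec y
    collinear⇒ x y (x≉y , l , x∈l , y∈l) = (λ eq → x≉y (vec-injective {x} {y} eq)) , (begin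
      β (vec x) (vec y)                              ≡⟨ solve 3 (λ a b c → c := a :+ b :+ (a :+ b :+ c)) refl (f (vec x)) (f (vec y)) (β (vec x) (vec y)) ⟩
      f (vec x) + f (vec y) + (f (vec x) + f (vec y) + β (vec x) (vec y))
                                                     ≡⟨ cong (f (vec x) + f (vec y) +_) (f-+ (vec x) (vec y)) ⟨
      f (vec x) + f (vec y) + f (vec x +ᵥ vec y)     ≡⟨ cong₂ _+_ (cong₂ _+_ (proj₁ (vec-affine x)) (proj₁ (vec-affine y)))
                                                          (X̂Line.singular l _ (+-closed (X̂Line.line l) (x∈l (vec-∈ x)) (y∈l (vec-∈ y)))) ⟩
      0# + 0# + 0#                                   ≡⟨ solve 0 (:0 :+ :0 :+ :0 := :0) refl ⟩
      0#                                             ∎)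
      where open ≡-Reasoning

    ⇒collinear : ∀ x y → vec x ≢ vec y → vec x ⟂ vec y → Collinear x y
    ⇒collinear x y x≢y x⟂y = (λ x≈y → x≢y (vec-cong {x} {y} x≈y)) , l , x∈l , y∈l
      where
      Y : Subspace 1
      Y = point (vec y) (affine≢0 (vec-affine y))
      x∉Y : ¬ ⟦ Y ⟧ (vec x)
      x∉Y x∈Y = x≢y (affine-∈ y (proj₂ (vec-≐ y) x∈Y) (vec-affine x))
      x⟂Y : ∀ v → ⟦ Y ⟧ v → vec x ⟂ v
      x⟂Y v v∈Y = let c , v≡cy = ∈⇒multiple Y v∈Y in
        subst (vec x ⟂_) (sym v≡cy) (⟂-sym (⟂-* c {vec y} (⟂-sym x⟂y)))
      W : Subspace 2
      W = extend Y (vec x) x∉Y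
      x∈W : pointsOf ⟦ W ⟧ (proj₁ x)
      x∈W {v} v∈x = let c , v≡cx = vec-multiple x v∈x in
        c ∷ 0# ∷ [] , trans v≡cx (by-coordinates (vec x ∷ vec y ∷ []) (c ⊡ #0) (c ⊡ #0 ⊞ (0# ⊡ #1 ⊞ 𝟘))
          λ { (a ∷ b ∷ []) → solve 3 (λ c a b → c :* a := c :* a :+ (:0 :* b :+ :0)) refl c a b })
      y∈W : pointsOf ⟦ W ⟧ (proj₁ y)
      y∈W {v} v∈y = let c , v≡cy = vec-multiple y v∈y in
        0# ∷ c ∷ [] , trans v≡cy (by-coordinates (vec x ∷ vec y ∷ []) (c ⊡ #1) (0# ⊡ #0 ⊞ (c ⊡ #1 ⊞ 𝟘))
          λ { (a ∷ b ∷ []) → solve 3 (λ c a b → c :* b := :0 :* a :+ (c :* b :+ :0)) refl c a b })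
      l : X̂Line
      l = record
        { line     = W
        ; singular = extend-singular Y x∉Y (Q-intro Y (proj₁ (vec-affine y))) (proj₁ (vec-affine x)) x⟂Y
        ; ⊈Q₀      = λ W⊆Q₀ → proj₂ (proj₂ x) (W⊆Q₀ {proj₁ x} x∈W)
        }
      x∈l : hat l x
      x∈l = x∈W
      y∈l : hat l y
      y∈l = y∈W

    -- Write `ν = a x + b y`. The product with `ν` gives `a = b`, the product with `x` gives
    -- `a β x y = 1`, and `f ν = 1` gives `a² β x y = 1`; hence `a = b = 1`.
    centre⇒ : ∀ x y → vec x ≢ vec y → n₀ ⊆ (⟦ proj₁ x ⟧ ⊕ ⟦ proj₁ y ⟧) → vec y ≡ bar (vec x)
    centre⇒ x y x≢y n₀⊆ = finish (n₀⊆ {ν} (λ u u∈H₀ → H₀⟂ν u u∈H₀))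
      where
      finish : (⟦ proj₁ x ⟧ ⊕ ⟦ proj₁ y ⟧) ν → vec y ≡ bar (vec x)
      finish (u , v , u∈x , v∈y , ν≡u+v) = y≡
        where
        a b : Carrier
        a = proj₁ (vec-multiple x u∈x)
        b = proj₁ (vec-multiple y v∈y)
        ν≡ax+by : ν ≡ a *ₗ vec x +ᵥ b *ₗ vec y
        ν≡ax+by = trans ν≡u+v (cong₂ _+ᵥ_ (proj₂ (vec-multiple x u∈x)) (proj₂ (vec-multiple y v∈y)))
        a≡b : a ≡ b
        a≡b = x+y≡0⇒x≡y (begin
          a + b                                ≡⟨ cong₂ _+_ (*-identityʳ a) (*-identityʳ b) ⟨
          a * 1# + b * 1#                      ≡⟨ cong₂ (λ s t → a * s + b * t) (proj₂ (vec-affine x)) (proj₂ (vec-affine y)) ⟨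
          a * β (vec x) ν + b * β (vec y) ν    ≡⟨ β-expandˡ (vec x ∷ vec y ∷ []) (a ⊡ #0 ⊞ b ⊡ #1) ν ⟨
          β (a *ₗ vec x +ᵥ b *ₗ vec y) ν       ≡⟨ cong (λ w → β w ν) ν≡ax+by ⟨
          β ν ν                                ≡⟨ β-self ν ⟩
          0#                                   ∎)
          where open ≡-Reasoning
        β-xy : Carrier
        β-xy = β (vec x) (vec y)
        aβ≡1 : a * β-xy ≡ 1#
        aβ≡1 = begin
          a * β-xy                                  ≡⟨ cong (_* β-xy) a≡b ⟩
          b * β-xy                                  ≡⟨ solve 3 (λ a b c → b :* c := a :* :0 :+ b :* c) refl a b β-xy ⟩
          a * 0# + b * β-xy                         ≡⟨ cong (λ t → a * t + b * β-xy) (β-self (vec x)) ⟨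
          a * β (vec x) (vec x) + b * β-xy          ≡⟨ β-expandʳ (vec x ∷ vec y ∷ []) (a ⊡ #0 ⊞ b ⊡ #1) (vec x) ⟨
          β (vec x) (a *ₗ vec x +ᵥ b *ₗ vec y)      ≡⟨ cong (β (vec x)) ν≡ax+by ⟨
          β (vec x) ν                               ≡⟨ proj₂ (vec-affine x) ⟩
          1#                                        ∎
          where open ≡-Reasoning
        aaβ≡1 : a * (a * β-xy) ≡ 1#
        aaβ≡1 = begin
          a * (a * β-xy)
            ≡⟨ solve 3 (λ a b c → a :* (b :* c) := a :* a :* :0 :+ b :* b :* :0 :+ a :* (b :* c)) refl a a β-xy ⟩
          a * a * 0# + a * a * 0# + a * (a * β-xy)
            ≡⟨ cong₂ (λ s t → a * a * s + a * a * t + a * (a * β-xy)) (proj₁ (vec-affine x)) (proj₁ (vec-affine y)) ⟨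
          a * a * f (vec x) + a * a * f (vec y) + a * (a * β-xy)
            ≡⟨ f-expand (vec x ∷ vec y ∷ []) (a ⊡ #0 ⊞ a ⊡ #1) ⟨
          f (a *ₗ vec x +ᵥ a *ₗ vec y)  ≡⟨ cong (λ t → f (a *ₗ vec x +ᵥ t *ₗ vec y)) a≡b ⟩
          f (a *ₗ vec x +ᵥ b *ₗ vec y)  ≡⟨ cong f ν≡ax+by ⟨
          f ν                           ≡⟨ fν ⟩
          1#                            ∎
          where open ≡-Reasoning
        a≡1 : a ≡ 1#
        a≡1 = trans (sym (*-identityʳ a)) (trans (cong (a *_) (sym aβ≡1)) aaβ≡1)
        y≡ : vec y ≡ bar (vec x)
        y≡ = begin
          vec y                                        ≡⟨ by-coordinates (vec x ∷ vec y ∷ []) #1 (#0 ⊞ (1# ⊡ #0 ⊞ 1# ⊡ #1))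
            (λ { (p ∷ q ∷ []) → solve 2 (λ p q → q := p :+ (:1 :* p :+ :1 :* q)) refl p q }) ⟩
          vec x +ᵥ (1# *ₗ vec x +ᵥ 1# *ₗ vec y)        ≡⟨ cong₂ (λ s t → vec x +ᵥ (s *ₗ vec x +ᵥ t *ₗ vec y)) a≡1 (trans (sym a≡b) a≡1) ⟨
          vec x +ᵥ (a *ₗ vec x +ᵥ b *ₗ vec y)          ≡⟨ cong (vec x +ᵥ_) ν≡ax+by ⟨
          vec x +ᵥ ν                                   ∎
          where open ≡-Reasoning

    -- By `determined` for the pair `x`, `ν`, a vector of `n₀` is a multiple of `ν`, and
    -- `ν = x + bar x`.
    ⇒centre : ∀ x y → vec y ≡ bar (vec x) → n₀ ⊆ (⟦ proj₁ x ⟧ ⊕ ⟦ proj₁ y ⟧)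
    ⇒centre x y y≡x̄ {v} v⟂H₀ = c *ₗ vec x , c *ₗ vec y ,
      *-closed (proj₁ x) c (vec-∈ x) , *-closed (proj₁ y) c (vec-∈ y) , (begin
        v                               ≡⟨ determined (proj₂ (vec-affine x)) (λ w w⟂ → v⟂H₀ w (⟂ν⇒∈H₀ w (proj₂ w⟂))) ⟩
        β v ν *ₗ vec x +ᵥ c *ₗ ν        ≡⟨ cong (λ t → t *ₗ vec x +ᵥ c *ₗ ν) (⟂-sym (v⟂H₀ ν ν∈H₀)) ⟩
        0# *ₗ vec x +ᵥ c *ₗ ν           ≡⟨ by-coordinates (vec x ∷ ν ∷ []) (0# ⊡ #0 ⊞ c ⊡ #1) (c ⊡ #0 ⊞ c ⊡ (#0 ⊞ #1))
          (λ { (p ∷ q ∷ []) → solve 3 (λ c p q → :0 :* p :+ c :* q := c :* p :+ c :* (p :+ q)) refl c p q }) ⟩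
        c *ₗ vec x +ᵥ c *ₗ bar (vec x)  ≡⟨ cong (λ t → c *ₗ vec x +ᵥ c *ₗ t) y≡x̄ ⟨
        c *ₗ vec x +ᵥ c *ₗ vec y        ∎)
      where
      open ≡-Reasoning
      c : Carrier
      c = β v (vec x)

  -- Antipodes, and their preservation by automorphisms.

  Antipodal : X̂Point → X̂Point → Set
  Antipodal x y = ¬ (x ≈̂ y) × ¬ Collinear x y × (∀ z → Collinear z x → Collinear z y → ⊥)

  abstract
    -- `β x (bar x) = 1` excludes equality and collinearity, and `β z x + β z (bar x) = 1` keeps `z`
    -- from being orthogonal to both.
    bar⇒antipodal : ∀ x y → vec y ≡ bar (vec x) → Antipodal x y
    bar⇒antipodal x y y≡x̄ =
      (λ x≈y → 0≢1 (trans (sym (trans (cong (β (vec x)) (sym (vec-cong {x} {y} x≈y))) (β-self (vec x)))) βxy≡1)) ,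
      (λ xy → 0≢1 (trans (sym (proj₂ (collinear⇒ x y xy))) βxy≡1)) ,
      λ z zx zy → 0≢1 (trans (sym (+-identityˡ 0#) ⟨ trans ⟩ sym (cong₂ _+_
        (proj₂ (collinear⇒ z x zx)) (proj₂ (collinear⇒ z y zy)))) (begin
          β (vec z) (vec x) + β (vec z) (vec y)        ≡⟨ cong (λ t → β (vec z) (vec x) + β (vec z) t) y≡x̄ ⟩
          β (vec z) (vec x) + β (vec z) (bar (vec x))  ≡⟨ cong (β (vec z) (vec x) +_) (β-bar (vec x) (vec-affine z)) ⟩
          β (vec z) (vec x) + (β (vec z) (vec x) + 1#) ≡⟨ solve 1 (λ b → b :+ (b :+ :1) := :1) refl (β (vec z) (vec x)) ⟩
          1#                                           ∎))
      where
      open ≡-Reasoning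
      βxy≡1 : β (vec x) (vec y) ≡ 1#
      βxy≡1 = trans (cong (β (vec x)) y≡x̄) (β-x-barx (vec-affine x))

    antipodal⇒bar : ∀ x y → Antipodal x y → vec y ≡ bar (vec x)
    antipodal⇒bar x y (x≉y , ¬xy , no-common) = decidable-stable (vec y ≟ᵥ bar (vec x)) λ y≢x̄ →
      contradict (common-neighbour (vec-affine x) (vec-affine y) xy≢0 y≢x̄)
      where
      xy≢0 : β (vec x) (vec y) ≢ 0#
      xy≢0 x⟂y = ¬xy (⇒collinear x y (λ eq → x≉y (vec-injective {x} {y} eq)) x⟂y)
      contradict : ¬ (∃[ z ] Affine z × z ⟂ vec x × z ⟂ vec y)
      contradict (v , av , v⟂x , v⟂y) = no-common z
        (⇒collinear z x (λ z≡x → xy≢0 (subst (_⟂ vec y) (trans (sym z≡v) z≡x) v⟂y)) (subst (_⟂ vec x) (sym z≡v) v⟂x))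
        (⇒collinear z y (λ z≡y → xy≢0 (⟂-sym (subst (_⟂ vec x) (trans (sym z≡v) z≡y) v⟂x))) (subst (_⟂ vec y) (sym z≡v) v⟂y))
        where
        z : X̂Point
        z = fromAffine v av
        z≡v : vec z ≡ v
        z≡v = vec-fromAffine v av

    collinear-resp : ∀ {x x′ y y′} → x ≈̂ x′ → y ≈̂ y′ → Collinear x y → Collinear x′ y′
    collinear-resp {x} {x′} {y} {y′} x≈x′ y≈y′ xy = let x≢y , x⟂y = collinear⇒ x y xy in
      ⇒collinear x′ y′
        (λ eq → x≢y (trans (vec-cong {x} {x′} x≈x′) (trans eq (sym (vec-cong {y} {y′} y≈y′)))))
        (trans (cong₂ β (sym (vec-cong {x} {x′} x≈x′)) (sym (vec-cong {y} {y′} y≈y′))) x⟂y)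

  open Automorphism using (to; from)

  inverseAutomorphism : Automorphism → Automorphism
  inverseAutomorphism α = record
    { permutation = record
      { to        = P.from
      ; from      = P.to
      ; to-cong   = λ {x} {y} → P.from-cong {x} {y}
      ; from-cong = λ {x} {y} → P.to-cong {x} {y}
      ; inverse   = (λ {x} {y} → P.inverseʳ {x} {y}) , (λ {x} {y} → P.inverseˡ {x} {y})
      }
    ; to-line   = Automorphism.from-line α
    ; from-line = Automorphism.to-line α
    }
    where module P = Inverse (Automorphism.permutation α)

  module _ (α : Automorphism) where
    private module A = Inverse (Automorphism.permutation α)

    from-to : ∀ x → from α (to α x) ≈̂ x
    from-to x = A.inverseʳ {x} {to α x} (≈̂-refl {to α x})

    to-from : ∀ x → to α (from α x) ≈̂ x
    to-from x = A.inverseˡ {x} {from α x} (≈̂-refl {from α x})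

    to-injective : ∀ {x y} → to α x ≈̂ to α y → x ≈̂ y
    to-injective {x} {y} eq = ≈̂-trans {x} {from α (to α x)} {y} (≈̂-sym {from α (to α x)} {x} (from-to x))
      (A.inverseʳ {y} {to α x} eq)

    abstract
      to-collinear : ∀ x y → Collinear x y → Collinear (to α x) (to α y)
      to-collinear x y (x≉y , l , x∈l , y∈l) = (λ eq → x≉y (to-injective {x} {y} eq)) , proj₁ image ,
        proj₁ (proj₂ image) {to α x} (x , x∈l , ≈̂-refl {to α x}) ,
        proj₁ (proj₂ image) {to α y} (y , y∈l , ≈̂-refl {to α y})
        where
        image : ∃[ m ] Sets.image x̂points (to α) (hat l) ≐ hat m
        image = Automorphism.to-line α l

  module _ (α : Automorphism) where
    abstract
      to-collinear⁻¹ : ∀ x y → Collinear (to α x) (to α y) → Collinear x y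
      to-collinear⁻¹ x y c = collinear-resp {from α (to α x)} {x} {from α (to α y)} {y}
        (from-to α x) (from-to α y)
        (to-collinear (inverseAutomorphism α) (to α x) (to α y) c)

      -- Addition of `ν` has no meaning for `α`, so the relation is carried across as `Antipodal`; a
      -- common neighbour of the images is pulled back along the inverse.
      to-bar : ∀ x y → vec y ≡ bar (vec x) → vec (to α y) ≡ bar (vec (to α x))
      to-bar x y y≡x̄ = antipodal⇒bar (to α x) (to α y)
        ( (λ eq → proj₁ xy (to-injective α {x} {y} eq))
        , (λ c → proj₁ (proj₂ xy) (to-collinear⁻¹ x y c))
        , λ z zx zy → proj₂ (proj₂ xy) (from α z)
            (to-collinear⁻¹ (from α z) x (collinear-resp {z} {to α (from α z)} {to α x} {to α x}
              (≈̂-sym {to α (from α z)} {z} (to-from α z)) (≈̂-refl {to α x}) zx))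
            (to-collinear⁻¹ (from α z) y (collinear-resp {z} {to α (from α z)} {to α y} {to α y}
              (≈̂-sym {to α (from α z)} {z} (to-from α z)) (≈̂-refl {to α y}) zy)) )
        where
        xy : Antipodal x y
        xy = bar⇒antipodal x y y≡x̄

  IsEllipticOvoid-resp : ∀ {O O′} → O ≐ O′ → IsEllipticOvoid O → IsEllipticOvoid O′
  IsEllipticOvoid-resp O≐O′ ovoid = record
    { S        = IsEllipticOvoid.S ovoid
    ; S⊆H₀     = IsEllipticOvoid.S⊆H₀ ovoid
    ; elliptic = IsEllipticOvoid.elliptic ovoid
    ; section  = ≐-trans (≐-sym O≐O′) (IsEllipticOvoid.section ovoid)
    }

  MeetExactlyIn-resp : ∀ {p p′ O₁ O₁′ O₂ O₂′} → ⟦ p ⟧ ≐ ⟦ p′ ⟧ → O₁ ≐ O₁′ → O₂ ≐ O₂′ →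
                       MeetExactlyIn p O₁ O₂ → MeetExactlyIn p′ O₁′ O₂′
  MeetExactlyIn-resp p≈p′ (⊆₁ , ⊇₁) (⊆₂ , ⊇₂) (into , from) =
    (λ { (q∈₁ , q∈₂) → ≐-trans (into (⊇₁ q∈₁ , ⊇₂ q∈₂)) p≈p′ }) ,
    (λ q≈p′ → let q∈₁ , q∈₂ = from (≐-trans q≈p′ (≐-sym p≈p′)) in ⊆₁ q∈₁ , ⊆₂ q∈₂)

  -- Configurations and the cliques they give.

  Distinct : X̂Point → X̂Point → Set
  Distinct x y = vec y ≢ vec x × vec y ≢ bar (vec x)

  abstract
    ≢φ₀⇒distinct : ∀ {x y} → ¬ (φ₀ x ≐ φ₀ y) → Distinct x y
    ≢φ₀⇒distinct {x} {y} ≢ = (λ eq → ≢ (φ₀-cong {x} {y} (sym eq))) , (λ eq → ≢ (≐-sym (φ₀-bar {x} {y} eq)))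

    β-vec-sym : ∀ x y → β (vec x) (vec y) ≡ β (vec y) (vec x)
    β-vec-sym x y = β-comm (vec x) (vec y)

    ℘β≡0⇒tangent : ∀ x y → ℘ (β (vec x) (vec y)) ≡ 0# → Distinct x y → Tangent (φ₀ x) (φ₀ y)
    ℘β≡0⇒tangent x y ℘≡0 (y≢x , y≢x̄) =
      (λ eq → different (φ₀-injective {x} {y} eq)) ,
      point (touch (vec x) (vec y)) r≢0 , meet-in-touch x y ℘≡0 y≢x y≢x̄ r≢0
      where
      r≢0 : touch (vec x) (vec y) ≢ 0ᵥ
      r≢0 = touch≢0 (vec-affine x) (vec-affine y) y≢x y≢x̄
      different : ¬ (vec y ≡ vec x ⊎ vec y ≡ bar (vec x))
      different (inj₁ y≡x) = y≢x y≡x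
      different (inj₂ y≡x̄) = y≢x̄ y≡x̄

  Tangent-resp : ∀ {O₁ O₁′ O₂ O₂′} → O₁ ≐ O₁′ → O₂ ≐ O₂′ → Tangent O₁ O₂ → Tangent O₁′ O₂′
  Tangent-resp {O₁} {O₁′} {O₂} {O₂′} eq₁ eq₂ (≢ , p , meet) =
    (λ eq → ≢ (≐-trans eq₁ (≐-trans eq (≐-sym eq₂)))) ,
    p , MeetExactlyIn-resp {p} {p} {O₁} {O₁′} {O₂} {O₂′} ≐-refl eq₁ eq₂ meet

  -- The two points of each antipodal pair have the same image under φ₀.
  Ovoids : ∀ {k} → (Fin k × Fin 2 → X̂Point) → OvoidSet
  Ovoids x O = ∃[ i ] O ≐ φ₀ (x (i , zero))

  -- Antipodes together with the collinearities in one direction only. All other products follow,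
  -- and with them distinctness and the non-adjacencies of a centric configuration; both fields are
  -- of the kind that `to-bar` and `to-collinear` transport.
  record Configuration {k : ℕ} (x : Fin k × Fin 2 → X̂Point) : Set where
    field
      antipode : ∀ i → vec (x (i , suc zero)) ≡ bar (vec (x (i , zero)))
      cross    : ∀ {i j} → i ≢ j → Collinear (x (i , zero)) (x (j , suc zero))

    abstract
      unit : ∀ {i j} → i ≢ j → β (vec (x (i , zero))) (vec (x (j , zero))) ≡ 1#
      unit {i} {j} i≢j = x+y≡0⇒x≡y (trans (sym (β-bar (vec (x (j , zero))) (vec-affine (x (i , zero)))))
        (trans (cong (β (vec (x (i , zero)))) (sym (antipode j))) (proj₂ (collinear⇒ (x (i , zero)) (x (j , suc zero)) (cross i≢j)))))

      apart : ∀ {i j} → i ≢ j → Distinct (x (i , zero)) (x (j , zero))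
      apart {i} {j} i≢j =
        (λ eq → 0≢1 (trans (sym (β-self (vec (x (i , zero))))) (trans (cong (β (vec (x (i , zero)))) (sym eq)) (unit i≢j)))) ,
        (λ eq → proj₁ (collinear⇒ (x (j , zero)) (x (i , suc zero)) (cross (i≢j ∘ sym))) (trans eq (sym (antipode i))))

  open Configuration

  module _ {k : ℕ} {x : Fin k × Fin 2 → X̂Point} (conf : Configuration x) where
    private
      u : Fin k → V
      u i = vec (x (i , zero))

      au : ∀ i → Affine (u i)
      au i = vec-affine (x (i , zero))

    abstract
      antipode′ : ∀ i {a b} → a ≢ b → vec (x (i , b)) ≡ bar (vec (x (i , a)))
      antipode′ i {zero}     {zero}     a≢b = contradiction refl a≢b
      antipode′ i {zero}     {suc zero} a≢b = antipode conf i
      antipode′ i {suc zero} {zero}     a≢b = trans (sym (bar-bar (u i))) (cong bar (sym (antipode conf i)))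
      antipode′ i {suc zero} {suc zero} a≢b = contradiction refl a≢b

      unit-pair : ∀ i {a b} → a ≢ b → β (vec (x (i , a))) (vec (x (i , b))) ≡ 1#
      unit-pair i {a} a≢b = trans (cong (β (vec (x (i , a)))) (antipode′ i a≢b)) (β-x-barx (vec-affine (x (i , a))))

      unit′ : ∀ {i j} a → i ≢ j → β (vec (x (i , a))) (vec (x (j , a))) ≡ 1#
      unit′ zero i≢j = unit conf i≢j
      unit′ {i} {j} (suc zero) i≢j = begin
        β (vec (x (i , suc zero))) (vec (x (j , suc zero)))  ≡⟨ cong₂ β (antipode conf i) (antipode conf j) ⟩
        β (bar (u i)) (bar (u j))                            ≡⟨ β-bar (u j) (bar-affine (au i)) ⟩
        β (bar (u i)) (u j) + 1#                             ≡⟨ cong (_+ 1#) (β-comm (bar (u i)) (u j)) ⟩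
        β (u j) (bar (u i)) + 1#                             ≡⟨ cong (_+ 1#) (β-bar (u i) (au j)) ⟩
        β (u j) (u i) + 1# + 1#                              ≡⟨ cong (λ t → t + 1# + 1#) (unit conf (i≢j ∘ sym)) ⟩
        1# + 1# + 1#                                         ≡⟨ solve 0 (:1 :+ :1 :+ :1 := :1) refl ⟩
        1#                                                   ∎
        where open ≡-Reasoning

      cross′ : ∀ {i j a b} → i ≢ j → a ≢ b → Collinear (x (i , a)) (x (j , b))
      cross′ {a = zero}     {zero}     i≢j a≢b = contradiction refl a≢b
      cross′ {a = zero}     {suc zero} i≢j a≢b = cross conf i≢j
      cross′ {i} {j} {suc zero} {zero} i≢j a≢b =
        let ≢ , ⟂ = collinear⇒ (x (j , zero)) (x (i , suc zero)) (cross conf (i≢j ∘ sym)) in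
        ⇒collinear (x (i , suc zero)) (x (j , zero)) (≢ ∘ sym) (⟂-sym ⟂)
      cross′ {a = suc zero} {suc zero} i≢j a≢b = contradiction refl a≢b

      unit⇒≢ : ∀ y z → β (vec y) (vec z) ≡ 1# → vec y ≢ vec z
      unit⇒≢ y z yz≡1 eq = 0≢1 (trans (sym (trans (cong (β (vec y)) (sym eq)) (β-self (vec y)))) yz≡1)

      unit⇒¬collinear : ∀ y z → β (vec y) (vec z) ≡ 1# → ¬ Collinear y z
      unit⇒¬collinear y z yz≡1 yz = 0≢1 (trans (sym (proj₂ (collinear⇒ y z yz))) yz≡1)

      configuration-distinct : ∀ i a j b → vec (x (i , a)) ≡ vec (x (j , b)) → (i , a) ≡ (j , b)
      configuration-distinct i a j b eq with i Fin.≟ j | a Fin.≟ b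
      ... | yes refl | yes refl = refl
      ... | yes refl | no a≢b   = contradiction eq (unit⇒≢ (x (i , a)) (x (i , b)) (unit-pair i a≢b))
      ... | no i≢j   | yes refl = contradiction eq (unit⇒≢ (x (i , a)) (x (j , a)) (unit′ a i≢j))
      ... | no i≢j   | no a≢b   = contradiction eq (proj₁ (collinear⇒ (x (i , a)) (x (j , b)) (cross′ i≢j a≢b)))

      configuration-adjacent : ∀ i a j b → Collinear (x (i , a)) (x (j , b)) → i ≢ j × a ≢ b
      configuration-adjacent i a j b c with i Fin.≟ j | a Fin.≟ b
      ... | yes refl | yes refl = contradiction (≈̂-refl {x (i , a)}) (proj₁ c)
      ... | yes refl | no a≢b   = contradiction c (unit⇒¬collinear (x (i , a)) (x (i , b)) (unit-pair i a≢b))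
      ... | no i≢j   | yes refl = contradiction c (unit⇒¬collinear (x (i , a)) (x (j , a)) (unit′ a i≢j))
      ... | no i≢j   | no a≢b   = i≢j , a≢b

    configuration⇒centric : IsCentricConfiguration k (λ z → ∃[ i ] z ≈̂ x i)
    configuration⇒centric = record
      { x          = x
      ; enumerated = record
        { distinct   = λ { {i , a} {j , b} eq →
            configuration-distinct i a j b (vec-cong {x (i , a)} {x (j , b)} eq) }
        ; exhaustive = ≐-refl
        }
      ; adjacency  = λ i a j b → mk⇔ (configuration-adjacent i a j b) (λ (i≢j , a≢b) → cross′ i≢j a≢b)
      ; centric    = λ i a b a≢b → ⇒centre (x (i , a)) (x (i , b)) (antipode′ i a≢b)
      }

    abstract
      ovoids-tangent : ∀ {i j} → i ≢ j → Tangent (φ₀ (x (i , zero))) (φ₀ (x (j , zero)))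
      ovoids-tangent {i} {j} i≢j = ℘β≡0⇒tangent (x (i , zero)) (x (j , zero))
        (trans (cong ℘ (unit conf i≢j)) (solve 0 (:1 :* :1 :+ :1 := :0) refl)) (apart conf i≢j)

      ovoids-distinct : ∀ {i j} → φ₀ (x (i , zero)) ≐ φ₀ (x (j , zero)) → i ≡ j
      ovoids-distinct {i} {j} eq = decidable-stable (i Fin.≟ j) λ i≢j → proj₁ (ovoids-tangent i≢j) eq

    configuration⇒clique : ∀ {C} → C ≐ Ovoids x → IsClique k C
    configuration⇒clique {C} C≐ = record
      { ovoids   = λ O O∈C → let i , O≐ = proj₁ C≐ O∈C in
          IsEllipticOvoid-resp (≐-sym O≐) (φ₀-ovoid (x (i , zero)))
      ; size     = (λ i → φ₀ (x (i , zero))) , record { distinct = ovoids-distinct ; exhaustive = C≐ }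
      ; adjacent = λ O O′ O∈C O′∈C O≢O′ → let i , O≐ = proj₁ C≐ O∈C ; j , O′≐ = proj₁ C≐ O′∈C in
          Tangent-resp {φ₀ (x (i , zero))} {O} {φ₀ (x (j , zero))} {O′} (≐-sym O≐) (≐-sym O′≐)
            (ovoids-tangent λ i≡j → O≢O′ (≐-trans O≐ (≐-trans (≐-reflexive i≡j) (≐-sym O′≐))))
      }
      where
      ≐-reflexive : ∀ {i j} → i ≡ j → φ₀ (x (i , zero)) ≐ φ₀ (x (j , zero))
      ≐-reflexive refl = ≐-refl

  -- In a rosette the first two ovoids meet in touch (x₀) (x₁) = ν + x₀ + x₁, which is
  -- not orthogonal to x₂.
  configuration⇒nonlinear : ∀ {k} {x : Fin (suc (suc (suc k))) × Fin 2 → X̂Point} → Configuration x →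
    ∀ {C} → C ≐ Ovoids x → ¬ IsLinear C
  configuration⇒nonlinear {x = x} conf {C} C≐ (p , R , rosette , C⊆R) = 0≢1 (trans (sym r⟂x₂) rx₂)
    where
    ix : ∀ i → X̂Point
    ix i = x (i , zero)
    O∈R : ∀ i → R (φ₀ (ix i))
    O∈R i = C⊆R (proj₂ C≐ (i , ≐-refl))
    meets : ∀ {i j} → i ≢ j → MeetExactlyIn p (φ₀ (ix i)) (φ₀ (ix j))
    meets {i} {j} i≢j = IsRosetteAt.pairwise rosette (φ₀ (ix i)) (φ₀ (ix j)) (O∈R i) (O∈R j)
      (λ eq → i≢j (ovoids-distinct conf eq))
    i₀ i₁ i₂ : Fin _
    i₀ = zero
    i₁ = suc zero
    i₂ = suc (suc zero)
    x₀ x₁ x₂ : X̂Point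
    x₀ = ix i₀
    x₁ = ix i₁
    x₂ = ix i₂
    i₀≢i₁ : i₀ ≢ i₁
    i₀≢i₁ ()
    i₀≢i₂ : i₀ ≢ i₂
    i₀≢i₂ ()
    i₁≢i₂ : i₁ ≢ i₂
    i₁≢i₂ ()
    rv : V
    rv = touch (vec x₀) (vec x₁)
    rv≢0 : rv ≢ 0ᵥ
    rv≢0 = touch≢0 (vec-affine x₀) (vec-affine x₁) (proj₁ (apart conf i₀≢i₁)) (proj₂ (apart conf i₀≢i₁))
    r : Point
    r = point rv rv≢0
    r∈both : φ₀ x₀ r × φ₀ x₁ r
    r∈both = proj₂ (meet-in-touch x₀ x₁ (trans (cong ℘ (unit conf i₀≢i₁)) (solve 0 (:1 :* :1 :+ :1 := :0) refl))
      (proj₁ (apart conf i₀≢i₁)) (proj₂ (apart conf i₀≢i₁)) rv≢0) {r} ≐-refl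
    r≈p : ⟦ r ⟧ ≐ ⟦ p ⟧
    r≈p = proj₁ (meets i₀≢i₁) {r} r∈both
    r∈x₂ : φ₀ x₂ r
    r∈x₂ = proj₂ (proj₂ (meets i₀≢i₂) {r} r≈p)
    r⟂x₂ : rv ⟂ vec x₂
    r⟂x₂ = proj₂ (proj₂ (φ₀-elim x₂ r r∈x₂ (gen-∈ r)))
    rx₂ : β rv (vec x₂) ≡ 1#
    rx₂ = begin
      β rv (vec x₂)
        ≡⟨ β-expandˡ (ν ∷ vec x₀ ∷ vec x₁ ∷ []) (β (vec x₀) (vec x₁) ⊡ #0 ⊞ #1 ⊞ #2) (vec x₂) ⟩
      β (vec x₀) (vec x₁) * β ν (vec x₂) + β (vec x₀) (vec x₂) + β (vec x₁) (vec x₂)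
        ≡⟨ cong₂ _+_ (cong₂ _+_ (cong₂ _*_ (unit conf i₀≢i₁) (trans (β-comm ν (vec x₂)) (proj₂ (vec-affine x₂))))
             (unit conf i₀≢i₂)) (unit conf i₁≢i₂) ⟩
      1# * 1# + 1# + 1#  ≡⟨ solve 0 (:1 :* :1 :+ :1 :+ :1 := :1) refl ⟩
      1#                 ∎
      where open ≡-Reasoning

  -- Rosettes from lines, and the lifting of cliques.

  module Line (a r : V) (aa : Affine a) (fr : f r ≡ 0#) (r⟂ν : r ⟂ ν) (r⟂a : r ⟂ a) (r≢0 : r ≢ 0ᵥ) where

    at : Carrier → V
    at s = a +ᵥ s *ₗ r

    abstract
      at-affine : ∀ s → Affine (at s)
      at-affine s = f-+-singular (proj₁ aa) (f-*-singular s fr) (⟂-sym (⟂-* s r⟂a)) , (begin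
        β (at s) ν          ≡⟨ β-expandˡ (a ∷ r ∷ []) (#0 ⊞ s ⊡ #1) ν ⟩
        β a ν + s * β r ν   ≡⟨ cong₂ (λ t u → t + s * u) (proj₂ aa) r⟂ν ⟩
        1# + s * 0#         ≡⟨ solve 1 (λ s → :1 :+ s :* :0 := :1) refl s ⟩
        1#                  ∎)
        where open ≡-Reasoning

      at-difference : ∀ s t → at s +ᵥ at t ≡ (s + t) *ₗ r
      at-difference s t = by-coordinates (a ∷ r ∷ []) (#0 ⊞ s ⊡ #1 ⊞ (#0 ⊞ t ⊡ #1)) ((s + t) ⊡ #1)
        λ { (p ∷ q ∷ []) → solve 4 (λ s t p q → p :+ s :* q :+ (p :+ t :* q) := (s :+ t) :* q) refl s t p q }

      at-⟂ : ∀ s t → at s ⟂ at t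
      at-⟂ s t = ⟂-+ (⟂-sym (at⟂a t)) (⟂-* s (⟂-sym (⟂-+ (⟂-sym r⟂a) (⟂-* t (β-self r)))))
        where
        at⟂a : ∀ t → at t ⟂ a
        at⟂a t = ⟂-+ (β-self a) (⟂-* t r⟂a)

      -- `w + a` is singular and orthogonal to `ν`, `a` and `r`, so `proportional` makes it a
      -- multiple of `r`.
      on-line : ∀ w → Affine w → w ⟂ a → w ⟂ r → ∃[ s ] w ≡ at s
      on-line w (fw , wν) w⟂a w⟂r = proj₁ multiple , (begin
        w                                ≡⟨ +ᵥ-cancelʳ w a ⟨
        w +ᵥ a +ᵥ a                      ≡⟨ cong (_+ᵥ a) (proj₂ multiple) ⟩
        proj₁ multiple *ₗ r +ᵥ a         ≡⟨ +ᵥ-comm _ a ⟩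
        a +ᵥ proj₁ multiple *ₗ r         ∎)
        where
        open ≡-Reasoning
        w+a⟂ν : (w +ᵥ a) ⟂ ν
        w+a⟂ν = trans (β-+ w a ν) (trans (cong₂ _+_ wν (proj₂ aa)) 1+1≡0)
        multiple : ∃[ s ] w +ᵥ a ≡ s *ₗ r
        multiple = proportional aa fr (f-+-singular fw (proj₁ aa) w⟂a) (r⟂a , r⟂ν)
          (⟂-+ w⟂a (β-self a) , w+a⟂ν) (⟂-+ w⟂r (⟂-sym r⟂a)) r≢0

    pt : Carrier → X̂Point
    pt s = fromAffine (at s) (at-affine s)

    base : Point
    base = point r r≢0

    Members : OvoidSet
    Members O = ∃[ s ] O ≐ φ₀ (pt s)

    abstract
      vec-pt : ∀ s → vec (pt s) ≡ at s
      vec-pt s = vec-fromAffine (at s) (at-affine s)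

      pt-distinct : ∀ {s t} → s ≢ t → Distinct (pt s) (pt t)
      pt-distinct {s} {t} s≢t =
        (λ eq → s≢t (x+y≡0⇒x≡y (s+t≡0 (trans (sym (at-difference s t))
          (trans (cong₂ _+ᵥ_ (sym (vec-pt s)) (trans (sym (vec-pt t)) eq)) (v+v≡0 (vec (pt s)))))))) ,
        -- Antipodal points differ by `ν`, two points of the line by a multiple of `r`: the latter
        -- is singular and the former is not.
        (λ eq → 0≢1 (trans (sym (f-*-singular (s + t) fr)) (trans (cong f (trans (sym (at-difference s t))
          (trans (cong₂ _+ᵥ_ (sym (vec-pt s)) (trans (sym (vec-pt t)) eq)) (x+x̄ (vec (pt s)))))) fν)))
        where
        s+t≡0 : (s + t) *ₗ r ≡ 0ᵥ → s + t ≡ 0#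
        s+t≡0 eq = decidable-stable (s + t ≟ 0#) λ ≢0 → r≢0 (*ₗ-cancel r ≢0 eq)
        x+x̄ : ∀ x → x +ᵥ bar x ≡ ν
        x+x̄ x = by-coordinates (x ∷ ν ∷ []) (#0 ⊞ (#0 ⊞ #1)) #1
          λ { (p ∷ q ∷ []) → solve 2 (λ p q → p :+ (p :+ q) := q) refl p q }

      pt-injective : ∀ {s t} → φ₀ (pt s) ≐ φ₀ (pt t) → s ≡ t
      pt-injective {s} {t} eq = decidable-stable (s ≟ t) λ s≢t →
        proj₁ (℘β≡0⇒tangent (pt s) (pt t) (℘≡0 s t) (pt-distinct s≢t)) eq
        where
        ℘≡0 : ∀ s t → ℘ (β (vec (pt s)) (vec (pt t))) ≡ 0#
        ℘≡0 s t = trans (cong ℘ (trans (cong₂ β (vec-pt s) (vec-pt t)) (at-⟂ s t)))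
          (solve 0 (:0 :* :0 :+ :0 := :0) refl)

      -- Since `β` vanishes on the line, `touch` of the points with parameters `s` and `t` is
      -- `(s + t) r`: all these sections touch at the same point.
      pt-meet : ∀ {s t} → s ≢ t → MeetExactlyIn base (φ₀ (pt s)) (φ₀ (pt t))
      pt-meet {s} {t} s≢t = MeetExactlyIn-resp {q} {base} {φ₀ (pt s)} {φ₀ (pt s)} {φ₀ (pt t)} {φ₀ (pt t)}
        q≈base ≐-refl ≐-refl (meet-in-touch (pt s) (pt t) ℘≡0 (proj₁ distinct) (proj₂ distinct) q≢0)
        where
        distinct : Distinct (pt s) (pt t)
        distinct = pt-distinct s≢t
        β≡0 : β (vec (pt s)) (vec (pt t)) ≡ 0#
        β≡0 = trans (cong₂ β (vec-pt s) (vec-pt t)) (at-⟂ s t)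
        ℘≡0 : ℘ (β (vec (pt s)) (vec (pt t))) ≡ 0#
        ℘≡0 = trans (cong ℘ β≡0) (solve 0 (:0 :* :0 :+ :0 := :0) refl)
        q≢0 : touch (vec (pt s)) (vec (pt t)) ≢ 0ᵥ
        q≢0 = touch≢0 (vec-affine (pt s)) (vec-affine (pt t)) (proj₁ distinct) (proj₂ distinct)
        q : Point
        q = point (touch (vec (pt s)) (vec (pt t))) q≢0
        touch≡ : touch (vec (pt s)) (vec (pt t)) ≡ (s + t) *ₗ r
        touch≡ = begin
          β (vec (pt s)) (vec (pt t)) *ₗ ν +ᵥ vec (pt s) +ᵥ vec (pt t)
            ≡⟨ cong (λ c → c *ₗ ν +ᵥ vec (pt s) +ᵥ vec (pt t)) β≡0 ⟩
          0# *ₗ ν +ᵥ vec (pt s) +ᵥ vec (pt t)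
            ≡⟨ cong₂ (λ u v → 0# *ₗ ν +ᵥ u +ᵥ v) (vec-pt s) (vec-pt t) ⟩
          0# *ₗ ν +ᵥ at s +ᵥ at t
            ≡⟨ cong (λ u → u +ᵥ at s +ᵥ at t) (*ₗ-zeroˡ ν) ⟩
          0ᵥ +ᵥ at s +ᵥ at t
            ≡⟨ cong (_+ᵥ at t) (+ᵥ-identityˡ (at s)) ⟩
          at s +ᵥ at t
            ≡⟨ at-difference s t ⟩
          (s + t) *ₗ r ∎
          where open ≡-Reasoning
        q≈base : ⟦ q ⟧ ≐ ⟦ base ⟧
        q≈base = ∈-points q base (subst ⟦ base ⟧ (sym touch≡) (multiple⇒∈ base (s + t)))

    rosette : IsRosetteAt base Members
    rosette = record
      { base     = Q₀-intro base fr r⟂ν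
      ; ovoids   = λ O (s , O≐) → IsEllipticOvoid-resp (≐-sym O≐) (φ₀-ovoid (pt s))
      -- The parameter runs through the field, which has as many elements as a rosette has members.
      ; size     = (λ i → φ₀ (pt (E.from i))) , record
        { distinct   = λ {i} {j} eq → trans (sym (E.inverseˡ refl))
            (trans (cong E.to (pt-injective {E.from i} {E.from j} eq)) (E.inverseˡ refl))
        ; exhaustive =
            (λ (s , O≐) → E.to s , ≐-trans O≐ (reindex (sym (E.inverseʳ refl)))) ,
            (λ (i , O≐) → E.from i , O≐)
        }
      ; pairwise = λ O O′ (s , O≐) (t , O′≐) O≢O′ →
          MeetExactlyIn-resp {base} {base} {φ₀ (pt s)} {O} {φ₀ (pt t)} {O′} ≐-refl (≐-sym O≐) (≐-sym O′≐)
            (pt-meet λ s≡t → O≢O′ (≐-trans O≐ (≐-trans (reindex s≡t) (≐-sym O′≐))))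
      }
      where
      module E = Inverse enumeration
      reindex : ∀ {s t} → s ≡ t → φ₀ (pt s) ≐ φ₀ (pt t)
      reindex refl = ≐-refl

  -- Representatives y of pairwise tangent ovoids, chosen among the two antipodal points
  -- of each fibre of φ₀ so that β y₀ yᵢ = 1 for all i ≠ 0.
  module Normalized {m : ℕ} (y : Fin (suc m) → X̂Point)
    (tangent : ∀ {i j} → i ≢ j → ℘ (β (vec (y i)) (vec (y j))) ≡ 0#)
    (distinct : ∀ {i j} → i ≢ j → Distinct (y i) (y j))
    (unit₀ : ∀ {i} → i ≢ zero → β (vec (y zero)) (vec (y i)) ≡ 1#) where

    Members : OvoidSet
    Members O = ∃[ i ] O ≐ φ₀ (y i)

    module Degenerate {i j : Fin (suc m)} (i≢j : i ≢ j) (ij : vec (y i) ⟂ vec (y j)) where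
      private
        -- Passing to the antipode turns the products 1 with `y zero` into 0, so `a` is collinear
        -- with every other representative. The line through `a` and `c` meets the hyperplane of `ν`
        -- in `r`; the claim is that it contains all of them.
        a c r : V
        a = bar (vec (y zero))
        c = vec (y i)
        r = a +ᵥ c

        ⟂⇒≢0 : ∀ {k l} → k ≢ l → vec (y k) ⟂ vec (y l) → k ≢ zero
        ⟂⇒≢0 k≢l k⟂l k≡0 = 0≢1 (trans (sym k⟂l)
          (trans (cong (λ k → β (vec (y k)) _) k≡0) (unit₀ λ l≡0 → k≢l (trans k≡0 (sym l≡0)))))

        i≢0 : i ≢ zero
        i≢0 = ⟂⇒≢0 i≢j ij
        j≢0 : j ≢ zero
        j≢0 = ⟂⇒≢0 (i≢j ∘ sym) (⟂-sym ij)

        aa : Affine a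
        aa = bar-affine (vec-affine (y zero))

        ⟂a : ∀ {l} → l ≢ zero → vec (y l) ⟂ a
        ⟂a {l} l≢0 = trans (β-bar (vec (y zero)) (vec-affine (y l)))
          (trans (cong (_+ 1#) (trans (β-vec-sym (y l) (y zero)) (unit₀ l≢0))) 1+1≡0)

        fr : f r ≡ 0#
        fr = f-+-singular (proj₁ aa) (proj₁ (vec-affine (y i))) (⟂-sym (⟂a i≢0))
        r⟂ν : r ⟂ ν
        r⟂ν = trans (β-+ a c ν) (trans (cong₂ _+_ (proj₂ aa) (proj₂ (vec-affine (y i)))) 1+1≡0)
        r⟂a : r ⟂ a
        r⟂a = ⟂-+ (β-self a) (⟂a i≢0)
        r≢0 : r ≢ 0ᵥ
        r≢0 r≡0 = proj₂ (distinct (i≢0 ∘ sym)) (sym (u+v≡0⇒u≡v r≡0))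

        open Line a r aa fr r⟂ν r⟂a r≢0 using (at; at-affine; on-line; pt; vec-pt; base; rosette) renaming (Members to Rosette)

        on : ∀ {l} → l ≢ zero → vec (y l) ⟂ c → ∃[ s ] vec (y l) ≡ at s
        on {l} l≢0 l⟂c = on-line (vec (y l)) (vec-affine (y l)) (⟂a l≢0)
          (⟂-sym (⟂-+ (⟂-sym (⟂a l≢0)) (⟂-sym l⟂c)))

        s₀ : Carrier
        s₀ = proj₁ (on j≢0 (⟂-sym ij))
        yj≡ : vec (y j) ≡ at s₀
        yj≡ = proj₂ (on j≢0 (⟂-sym ij))

        s₀≢0 : s₀ ≢ 0#
        s₀≢0 s₀≡0 = proj₂ (distinct (j≢0 ∘ sym)) (begin
          vec (y j)       ≡⟨ yj≡ ⟩
          a +ᵥ s₀ *ₗ r    ≡⟨ cong (λ s → a +ᵥ s *ₗ r) s₀≡0 ⟩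
          a +ᵥ 0# *ₗ r    ≡⟨ cong (a +ᵥ_) (*ₗ-zeroˡ r) ⟩
          a +ᵥ 0ᵥ         ≡⟨ +ᵥ-identityʳ a ⟩
          a               ∎)
          where open ≡-Reasoning

        s₀≢1 : s₀ ≢ 1#
        s₀≢1 s₀≡1 = proj₁ (distinct i≢j) (begin
          vec (y j)           ≡⟨ yj≡ ⟩
          a +ᵥ s₀ *ₗ (a +ᵥ c) ≡⟨ cong (λ s → a +ᵥ s *ₗ r) s₀≡1 ⟩
          a +ᵥ 1# *ₗ (a +ᵥ c) ≡⟨ by-coordinates (a ∷ c ∷ []) (#0 ⊞ 1# ⊡ (#0 ⊞ #1)) #1
            (λ { (p ∷ q ∷ []) → solve 2 (λ p q → p :+ :1 :* (p :+ q) := q) refl p q }) ⟩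
          c                   ∎)
          where open ≡-Reasoning

        -- If β yₗ c = 1 then β yₗ yⱼ is the parameter s₀ of yⱼ, which is neither 0 nor 1.
        ⟂c : ∀ {l} → l ≢ zero → vec (y l) ⟂ c
        ⟂c {l} l≢0 = decidable-stable (_ ≟ 0#) λ lc≢0 → contradict lc≢0
          where
          contradict : ¬ (β (vec (y l)) c ≢ 0#)
          contradict lc≢0 = parameter (℘-roots (tangent l≢i))
            where
            l≢i : l ≢ i
            l≢i l≡i = lc≢0 (trans (cong (λ l → β (vec (y l)) c) l≡i) (β-self c))
            l≢j : l ≢ j
            l≢j l≡j = lc≢0 (trans (cong (λ l → β (vec (y l)) c) l≡j) (⟂-sym ij))
            lj≡s₀ : β (vec (y l)) c ≡ 1# → β (vec (y l)) (vec (y j)) ≡ s₀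
            lj≡s₀ lc≡1 = begin
              β (vec (y l)) (vec (y j))                  ≡⟨ cong (β (vec (y l))) yj≡ ⟩
              β (vec (y l)) (a +ᵥ s₀ *ₗ (a +ᵥ c))        ≡⟨ β-expandʳ (a ∷ c ∷ []) (#0 ⊞ s₀ ⊡ (#0 ⊞ #1)) (vec (y l)) ⟩
              β (vec (y l)) a + s₀ * (β (vec (y l)) a + β (vec (y l)) c)
                                                         ≡⟨ cong₂ (λ t u → t + s₀ * (t + u)) (⟂a l≢0) lc≡1 ⟩
              0# + s₀ * (0# + 1#)                        ≡⟨ solve 1 (λ s → :0 :+ s :* (:0 :+ :1) := s) refl s₀ ⟩
              s₀                                         ∎
              where open ≡-Reasoning
            refute : β (vec (y l)) c ≡ 1# → ¬ (β (vec (y l)) (vec (y j)) ≡ 0# ⊎ β (vec (y l)) (vec (y j)) ≡ 1#)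
            refute lc≡1 (inj₁ ≡0) = s₀≢0 (trans (sym (lj≡s₀ lc≡1)) ≡0)
            refute lc≡1 (inj₂ ≡1) = s₀≢1 (trans (sym (lj≡s₀ lc≡1)) ≡1)
            parameter : ¬ (β (vec (y l)) c ≡ 0# ⊎ β (vec (y l)) c ≡ 1#)
            parameter (inj₁ lc≡0) = lc≢0 lc≡0
            parameter (inj₂ lc≡1) = refute lc≡1 (℘-roots (tangent l≢j))

        member : ∀ l → ∃[ s ] φ₀ (y l) ≐ φ₀ (pt s)
        member zero = 0# , ≐-sym (φ₀-bar {y zero} {pt 0#} (begin
          vec (pt 0#)     ≡⟨ vec-pt 0# ⟩
          a +ᵥ 0# *ₗ r    ≡⟨ cong (a +ᵥ_) (*ₗ-zeroˡ r) ⟩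
          a +ᵥ 0ᵥ         ≡⟨ +ᵥ-identityʳ a ⟩
          a               ∎))
          where open ≡-Reasoning
        member (suc l) = proj₁ on-l , φ₀-cong {y (suc l)} {pt (proj₁ on-l)} (trans (proj₂ on-l) (sym (vec-pt (proj₁ on-l))))
          where
          on-l : ∃[ s ] vec (y (suc l)) ≡ at s
          on-l = on {suc l} (λ ()) (⟂c {suc l} (λ ()))

      linear : IsLinear Members
      linear = base , Rosette , rosette , λ (l , O≐) → let s , eq = member l in s , ≐-trans O≐ eq

    pairing : Fin (suc m) × Fin 2 → X̂Point
    pairing (i , zero)     = y i
    pairing (i , suc zero) = fromAffine (bar (vec (y i))) (bar-affine (vec-affine (y i)))

    module Generic (nowhere⟂ : ∀ {i j} → i ≢ j → ¬ (vec (y i) ⟂ vec (y j))) where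
      all-unit : ∀ {i j} → i ≢ j → β (vec (y i)) (vec (y j)) ≡ 1#
      all-unit {i} {j} i≢j = root (℘-roots (tangent i≢j))
        where
        root : β (vec (y i)) (vec (y j)) ≡ 0# ⊎ β (vec (y i)) (vec (y j)) ≡ 1# → β (vec (y i)) (vec (y j)) ≡ 1#
        root (inj₁ ≡0) = ⊥-elim (nowhere⟂ i≢j ≡0)
        root (inj₂ ≡1) = ≡1

      vec-pairing : ∀ i → vec (pairing (i , suc zero)) ≡ bar (vec (y i))
      vec-pairing i = vec-fromAffine (bar (vec (y i))) (bar-affine (vec-affine (y i)))

      configuration : Configuration pairing
      configuration = record
        { antipode = vec-pairing
        ; cross    = λ {i} {j} i≢j → ⇒collinear (y i) (pairing (j , suc zero))
            (λ eq → proj₂ (distinct (i≢j ∘ sym)) (trans eq (vec-pairing j)))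
            (begin
              β (vec (y i)) (vec (pairing (j , suc zero)))  ≡⟨ cong (β (vec (y i))) (vec-pairing j) ⟩
              β (vec (y i)) (bar (vec (y j)))               ≡⟨ β-bar (vec (y j)) (vec-affine (y i)) ⟩
              β (vec (y i)) (vec (y j)) + 1#                ≡⟨ cong (_+ 1#) (all-unit i≢j) ⟩
              1# + 1#                                       ≡⟨ 1+1≡0 ⟩
              0#                                            ∎)
        }
        where open ≡-Reasoning

    configuration : ¬ IsLinear Members → Configuration pairing
    configuration nonlinear = Generic.configuration λ i≢j ij → nonlinear (Degenerate.linear i≢j ij)

  abstract
    normalize-to : ∀ x₀ x → ℘ (β (vec x₀) (vec x)) ≡ 0# → ∃[ y ] φ₀ x ≐ φ₀ y × β (vec x₀) (vec y) ≡ 1#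
    normalize-to x₀ x ℘≡0 = cases (℘-roots ℘≡0)
      where
      x̄ : X̂Point
      x̄ = fromAffine (bar (vec x)) (bar-affine (vec-affine x))
      vec-x̄ : vec x̄ ≡ bar (vec x)
      vec-x̄ = vec-fromAffine (bar (vec x)) (bar-affine (vec-affine x))
      cases : β (vec x₀) (vec x) ≡ 0# ⊎ β (vec x₀) (vec x) ≡ 1# → ∃[ y ] φ₀ x ≐ φ₀ y × β (vec x₀) (vec y) ≡ 1#
      cases (inj₂ ≡1) = x , ≐-refl , ≡1
      cases (inj₁ ≡0) = x̄ , ≐-sym (φ₀-bar {x} {x̄} vec-x̄) ,
        trans (cong (β (vec x₀)) vec-x̄) (trans (β-bar (vec x) (vec-affine x₀))
          (trans (cong (_+ 1#) ≡0) (+-identityˡ 1#)))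

  clique⇒configuration : ∀ {m C} → IsNonLinearClique (suc m) C →
    ∃[ x ] Configuration {suc m} x × C ≐ Ovoids x
  clique⇒configuration {m} {C} (clique , nonlinear) = pairing , configuration members-nonlinear , C≐members
    where
    e : Fin (suc m) → PointSet
    e = proj₁ (IsClique.size clique)
    open Sets._EnumeratedBy_ (proj₂ (IsClique.size clique)) renaming (distinct to e-distinct)
    e∈C : ∀ i → C (e i)
    e∈C i = proj₂ exhaustive (i , ≐-refl)
    tangents : ∀ {i j} → i ≢ j → Tangent (e i) (e j)
    tangents {i} {j} i≢j = IsClique.adjacent clique (e i) (e j) (e∈C i) (e∈C j) (i≢j ∘ e-distinct)
    representative : ∀ i → ∃[ x ] e i ≐ φ₀ x
    representative i = φ₀-surjective (e i) (IsClique.ovoids clique (e i) (e∈C i))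
    tangent⇒℘ : ∀ {i j x z} → e i ≐ φ₀ x → e j ≐ φ₀ z → i ≢ j → ℘ (β (vec x) (vec z)) ≡ 0#
    tangent⇒℘ {i} {j} {x} {z} eq eq′ i≢j = tangent⇒℘≡0 x z p
      (MeetExactlyIn-resp {p} {p} {e i} {φ₀ x} {e j} {φ₀ z} ≐-refl eq eq′ (proj₂ (proj₂ (tangents i≢j))))
      where
      p : Point
      p = proj₁ (proj₂ (tangents i≢j))
    x₀ : X̂Point
    x₀ = proj₁ (representative zero)
    normalized : ∀ i → zero ≢ i → ∃[ y ] φ₀ (proj₁ (representative i)) ≐ φ₀ y × β (vec x₀) (vec y) ≡ 1#
    normalized i 0≢i = normalize-to x₀ (proj₁ (representative i))
      (tangent⇒℘ {x = x₀} {proj₁ (representative i)} (proj₂ (representative zero)) (proj₂ (representative i)) 0≢i)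
    y : Fin (suc m) → X̂Point
    y zero    = x₀
    y (suc i) = proj₁ (normalized (suc i) λ ())
    e≐ : ∀ i → e i ≐ φ₀ (y i)
    e≐ zero    = proj₂ (representative zero)
    e≐ (suc i) = ≐-trans (proj₂ (representative (suc i))) (proj₁ (proj₂ (normalized (suc i) λ ())))
    unit₀ : ∀ {i} → i ≢ zero → β (vec x₀) (vec (y i)) ≡ 1#
    unit₀ {zero}  0≢0 = contradiction refl 0≢0
    unit₀ {suc i} _   = proj₂ (proj₂ (normalized (suc i) λ ()))
    y-tangent : ∀ {i j} → i ≢ j → ℘ (β (vec (y i)) (vec (y j))) ≡ 0#
    y-tangent {i} {j} = tangent⇒℘ {x = y i} {y j} (e≐ i) (e≐ j)
    y-distinct : ∀ {i j} → i ≢ j → Distinct (y i) (y j)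
    y-distinct {i} {j} i≢j = ≢φ₀⇒distinct {y i} {y j} λ eq →
      i≢j (e-distinct (≐-trans (e≐ i) (≐-trans eq (≐-sym (e≐ j)))))
    open Normalized y y-tangent y-distinct unit₀ using (pairing; configuration; Members)
    C≐members : C ≐ Members
    C≐members = (λ O∈C → let i , O≐ = proj₁ exhaustive O∈C in i , ≐-trans O≐ (e≐ i)) ,
                (λ (i , O≐) → proj₂ exhaustive (i , ≐-trans O≐ (≐-sym (e≐ i))))
    members-nonlinear : ¬ IsLinear Members
    members-nonlinear (p , R , rosette , M⊆R) = nonlinear (p , R , rosette , λ O∈C → M⊆R (proj₁ C≐members O∈C))

  centric⇒configuration : ∀ {k S} (c : IsCentricConfiguration k S) → Configuration (IsCentricConfiguration.x c)
  centric⇒configuration c = record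
    { antipode = λ i → centre⇒ (x (i , zero)) (x (i , suc zero))
        (λ eq → 0≢1₂ (cong proj₂ (distinct {i , zero} {i , suc zero} (vec-injective {x (i , zero)} {x (i , suc zero)} eq))))
        (centric i zero (suc zero) 0≢1₂)
    ; cross    = λ {i} {j} i≢j → Equivalence.from (adjacency i zero j (suc zero)) (i≢j , 0≢1₂)
    }
    where
    open IsCentricConfiguration c
    open Sets._EnumeratedBy_ enumerated
    0≢1₂ : zero ≢ suc (zero {0})
    0≢1₂ ()

  -- The induced bijection.

  module _ (α : Automorphism) where
    φ : X̂Point → PointSet
    φ = φ₀ ∘ to α

    φ-cong : ∀ {x y} → x ≈̂ y → φ x ≐ φ y
    φ-cong {x} {y} x≈y = φ₀-cong {to α x} {to α y} (vec-cong {to α x} {to α y}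
      (Inverse.to-cong (Automorphism.permutation α) {x} {y} x≈y))

    to-configuration : ∀ {k} {x : Fin k × Fin 2 → X̂Point} → Configuration x → Configuration (to α ∘ x)
    to-configuration {x = x} conf = record
      { antipode = λ i → to-bar α (x (i , zero)) (x (i , suc zero)) (antipode conf i)
      ; cross    = λ {i} {j} i≢j → to-collinear α (x (i , zero)) (x (j , suc zero)) (cross conf i≢j)
      }

    -- Each of the pairs is sent by `α` to an antipodal pair and thus to a single ovoid, which is
    -- why `2k` points give `k` ovoids.
    image-ovoids : ∀ {k S} {x : Fin k × Fin 2 → X̂Point} → Configuration x → S ≐ (λ z → ∃[ i ] z ≈̂ x i) →
                   Sets.image pointSets φ S ≐ Ovoids (to α ∘ x)
    image-ovoids {k} {S} {x} conf (S⊆ , ⊆S) =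
      (λ (z , z∈S , O≐) → let (i , a) , z≈ = S⊆ z∈S in
        i , ≐-trans O≐ (≐-trans (φ-cong {z} {x (i , a)} z≈) (fibre i a))) ,
      (λ (i , O≐) → x (i , zero) , ⊆S ((i , zero) , ≈̂-refl {x (i , zero)}) , O≐)
      where
      fibre : ∀ i a → φ (x (i , a)) ≐ φ (x (i , zero))
      fibre i zero       = ≐-refl
      fibre i (suc zero) = φ₀-bar {to α (x (i , zero))} {to α (x (i , suc zero))} (antipode (to-configuration conf) i)

    -- A fibre of `φ` consists of two antipodes, and `S′` contains both or neither; so `S′` is the
    -- full preimage of its image. This yields injectivity of the induced map.
    image-reflects-⊆ : ∀ {k S S′} → IsCentricConfiguration k S′ →
      Sets.image pointSets φ S ⊆ Sets.image pointSets φ S′ → S ⊆ S′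
    image-reflects-⊆ {S = S} {S′} c′ φS⊆φS′ {z} z∈S = antipodes (φS⊆φS′ (z , z∈S , ≐-refl))
      where
      open IsCentricConfiguration c′
      open Sets._EnumeratedBy_ enumerated
      conf : Configuration (to α ∘ x)
      conf = to-configuration (centric⇒configuration c′)
      other : Fin 2 → Fin 2
      other zero       = suc zero
      other (suc zero) = zero
      a≢other : ∀ a → a ≢ other a
      a≢other zero       ()
      a≢other (suc zero) ()
      antipodes : (∃[ z′ ] S′ z′ × φ z ≐ φ z′) → S′ z
      antipodes (z′ , z′∈S′ , eq) = cases (φ₀-injective {to α z′} {to α z} (≐-sym eq))
        where
        i : _
        i = proj₁ (proj₁ (proj₁ exhaustive z′∈S′))
        a : Fin 2
        a = proj₂ (proj₁ (proj₁ exhaustive z′∈S′))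
        z′≈ : z′ ≈̂ x (i , a)
        z′≈ = proj₂ (proj₁ exhaustive z′∈S′)
        to-z′ : vec (to α z′) ≡ vec (to α (x (i , a)))
        to-z′ = vec-cong {to α z′} {to α (x (i , a))} (Inverse.to-cong (Automorphism.permutation α) {z′} {x (i , a)} z′≈)
        within : ∀ b → vec (to α z) ≡ vec (to α (x (i , b))) → S′ z
        within b eq = proj₂ exhaustive ((i , b) , to-injective α {z} {x (i , b)} (vec-injective {to α z} {to α (x (i , b))} eq))
        cases : vec (to α z) ≡ vec (to α z′) ⊎ vec (to α z) ≡ bar (vec (to α z′)) → S′ z
        cases (inj₁ same)     = within a (trans same to-z′)
        cases (inj₂ opposite) = within (other a) (trans opposite (trans (cong bar to-z′) (sym (antipode′ conf i (a≢other a)))))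

    -- The clique is lifted through `φ₀` first; the inverse of `α` is again an automorphism, so it
    -- takes the lifted configuration to one whose image under `φ` is `C`.
    from-configuration : ∀ {k C} → IsNonLinearClique (suc k) C →
      ∃[ S ] IsCentricConfiguration (suc k) S × Sets.image pointSets φ S ≐ C
    from-configuration {k} {C} nonlinear = S , configuration⇒centric conf ,
      ≐-trans (image-ovoids conf ≐-refl) (≐-trans back (≐-sym C≐))
      where
      lifted : ∃[ y ] Configuration {suc k} y × C ≐ Ovoids y
      lifted = clique⇒configuration nonlinear
      y x : Fin (suc k) × Fin 2 → X̂Point
      y = proj₁ lifted
      x = from α ∘ y
      C≐ : C ≐ Ovoids y
      C≐ = proj₂ (proj₂ lifted)
      conf : Configuration x
      conf = record
        { antipode = λ i → to-bar (inverseAutomorphism α) (y (i , zero)) (y (i , suc zero)) (antipode (proj₁ (proj₂ lifted)) i)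
        ; cross    = λ {i} {j} i≢j → to-collinear (inverseAutomorphism α) (y (i , zero)) (y (j , suc zero))
            (cross (proj₁ (proj₂ lifted)) i≢j)
        }
      S : Pred X̂Point 0ℓ
      S z = ∃[ i ] z ≈̂ x i
      to-from-φ₀ : ∀ i → φ₀ (to α (x i)) ≐ φ₀ (y i)
      to-from-φ₀ i = φ₀-cong {to α (x i)} {y i} (vec-cong {to α (x i)} {y i} (to-from α (y i)))
      back : Ovoids (to α ∘ x) ≐ Ovoids y
      back = (λ (i , O≐) → i , ≐-trans O≐ (to-from-φ₀ (i , zero))) ,
             (λ (i , O≐) → i , ≐-trans O≐ (≐-sym (to-from-φ₀ (i , zero))))

    -- One argument serves all sizes from 3 on; the third ovoid is the one that misses the point
    -- where the first two touch, in `configuration⇒nonlinear`.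
    inducedBijection : ∀ k → InducesBijection φ (IsCentricConfiguration (3 ℕ.+ k)) (IsNonLinearClique (3 ℕ.+ k))
    inducedBijection k = record
      { to        = image
      ; cong      = λ { {S , _} {S′ , _} (S⊆ , ⊆S) →
          (λ (z , z∈ , eq) → z , S⊆ z∈ , eq) , (λ (z , z∈ , eq) → z , ⊆S z∈ , eq) }
      ; bijective =
          (λ { {S , c} {S′ , c′} (⊆ , ⊇) → image-reflects-⊆ c′ ⊆ , image-reflects-⊆ c ⊇ }) ,
          (λ (C , nonlinear) → let S , c , φS≐C = from-configuration nonlinear in
            (S , c) , λ { {S′ , _} (S′⊆ , ⊆S′) → ≐-trans
              ((λ (z , z∈ , eq) → z , S′⊆ z∈ , eq) , (λ (z , z∈ , eq) → z , ⊆S′ z∈ , eq)) φS≐C })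
      } , λ S → ≐-refl
      where
      image : ∃ (IsCentricConfiguration (3 ℕ.+ k)) → ∃ (IsNonLinearClique (3 ℕ.+ k))
      image (S , c) = Sets.image pointSets φ S ,
        configuration⇒clique (to-configuration conf) φS≐ , configuration⇒nonlinear (to-configuration conf) φS≐
        where
        open IsCentricConfiguration c
        conf : Configuration x
        conf = centric⇒configuration c
        φS≐ : Sets.image pointSets φ S ≐ Ovoids (to α ∘ x)
        φS≐ = image-ovoids conf (Sets._EnumeratedBy_.exhaustive enumerated)

theorem3 :
    (n : ℕ) (𝔽 : FiniteField (2 ^ n)) →
    let open Space 𝔽 in
    (𝑓 : QuadraticForm) (H₀ : Subspace 5) →
    let open Form 𝑓
        open Geometry 𝑓 H₀ in
    Elliptic₅ → Parabolic₄ H₀ →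
    (α̂ : Automorphism) →
    let φ : X̂Point → PointSet
        φ = φ₀ ∘ Automorphism.to α̂ in
    InducesBijection φ IsCentricHexagon (IsNonLinearClique 3)
      × InducesBijection φ IsCentricCube (IsNonLinearClique 4)
      × InducesBijection φ IsCentricDodecade (IsNonLinearClique 6)
theorem3 n 𝔽 𝑓 H₀ elliptic parabolic α̂ =
  let ν , fν , H₀⟂ν , ⟂ν⇒∈H₀ = Nucleus.nucleus {n} 𝔽 (Ambient.ellipticForm {n} 𝔽 𝑓 elliptic) H₀ (proj₁ parabolic)
      bijection = Model.inducedBijection {n} 𝔽 𝑓 H₀ elliptic parabolic ν fν H₀⟂ν ⟂ν⇒∈H₀ α̂
  -- The argument counts the antipodal pairs beyond three.
  in bijection 0 , bijection 1 , bijection 3
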